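{- For every fixed $d\ge2$ there is a constant $c_d>0$ such that for infinitely many values of $n$ there is an $n$-point set $P\subset[0,1]^d$ with \[ \operatorname{disc}_{2,\overline{w}}\mathcal{A}_d(P)\ge c_d\log^{d-1}n . \]
   Context: For $x\in[0,1]^d$ let $A(x)=[0,x_1]\times\cdots\times[0,x_d]$. For a finite $P\subset[0,1]^d$, $\mathcal{A}_d(P)=\{A(x)\cap P: x\in[0,1]^d\}$ (the set system on $P$ induced by anchored boxes), and $\overline{w}:\mathcal{A}_d(P)\to[0,1]$ is the weight $\overline{w}(F)=\lambda^d\{x\in[0,1]^d: A(x)\cap P=F\}$, where $\lambda^d$ is Lebesgue measure. For a set system $\mathcal{F}$ on a ground set $V$ and a nonnegative weight $w:\mathcal{F}\to[0,\infty)$ not identically zero, $\operatorname{disc}_{p,w}\mathcal{F}=\min_{x\in\{ -1,1\}^V}\bigl(\frac{1}{w(\mathcal{F})}\sum_{F\in\mathcal{F}}w(F)|x(F)|^p\bigr)^{1/p}$, where $x(F)=\sum_{v\in F}x_v$ and $w(\mathcal{F})=\sum_{F\in\mathcal{F}}w(F)$. -}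

module Defs where

open import Algebra.Bundles using (AbelianGroup)
import Algebra.Properties.AbelianGroup as AbelianGroupProperties
import Algebra.Properties.CommutativeSemigroup as CommutativeSemigroup
open import Data.Bool using (if_then_else_)
open import Data.Fin using (Fin)
open import Data.Fin.Subset using (Subset; _∈_)
open import Data.Integer as ℤ using (ℤ)
import Data.Integer.Properties as ℤ
open import Data.List as List using (List)
import Data.List.Membership.Propositional as List
open import Data.List.Relation.Unary.Unique.Propositional using (Unique)
open import Data.Nat as ℕ using (ℕ; zero; suc)
import Data.Nat.Properties as ℕ
open import Data.Product using (Σ; ∃; _×_; _,_)
open import Data.Rational as ℚ using (ℚ; 0ℚ; 1ℚ; ½)
import Data.Rational.Properties as ℚ
import Data.Rational.Unnormalised as ℚᵘ
import Data.Rational.Unnormalised.Properties as ℚᵘ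
open import Data.Sign using (Sign)
open import Data.Sum using (inj₁; inj₂)
open import Data.Vec using (lookup)
open import Data.Vec.Functional as Vector using (Vector)
open import Function using (_⇔_; _∘_)
open import Relation.Binary.PropositionalEquality using (_≡_; refl; sym; trans; cong; cong₂; subst; subst₂)
open import Relation.Nullary using (¬_)

-- The reals are Cauchy sequences of rationals, as a setoid under _≈_.

IsCauchy : (ℕ → ℚ) → Set
IsCauchy f = ∀ ε → 0ℚ ℚ.< ε →
  ∃ λ N → ∀ m n → N ℕ.≤ m → N ℕ.≤ n → ℚ.∣ f m ℚ.- f n ∣ ℚ.< ε

record ℝ : Set where
  constructor mkℝ
  field
    seq    : ℕ → ℚ
    cauchy : IsCauchy seq

open ℝ public

infix 4 _≈_ _≤_ _<_

_≈_ : ℝ → ℝ → Set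
x ≈ y = ∀ ε → 0ℚ ℚ.< ε →
  ∃ λ N → ∀ n → N ℕ.≤ n → ℚ.∣ seq x n ℚ.- seq y n ∣ ℚ.< ε

_≤_ : ℝ → ℝ → Set
x ≤ y = ∀ ε → 0ℚ ℚ.< ε →
  ∃ λ N → ∀ n → N ℕ.≤ n → seq x n ℚ.≤ seq y n ℚ.+ ε

_<_ : ℝ → ℝ → Set
x < y = ∃ λ ε → 0ℚ ℚ.< ε ×
  ∃ λ N → ∀ n → N ℕ.≤ n → seq x n ℚ.+ ε ℚ.≤ seq y n

private
  module +-AG = AbelianGroupProperties ℚ.+-0-abelianGroup
  module +-CS = CommutativeSemigroup (AbelianGroup.commutativeSemigroup ℚ.+-0-abelianGroup)

  sum-diff : ∀ a b c d → (a ℚ.- b) ℚ.+ (c ℚ.- d) ≡ (a ℚ.+ c) ℚ.- (b ℚ.+ d)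
  sum-diff a b c d = trans (+-CS.interchange a (ℚ.- b) c (ℚ.- d))
    (cong (a ℚ.+ c ℚ.+_) (sym (ℚ.neg-distrib-+ b d)))

  neg-diff : ∀ a b → b ℚ.- a ≡ (ℚ.- a) ℚ.- (ℚ.- b)
  neg-diff a b = trans (ℚ.+-comm b (ℚ.- a)) (cong (ℚ.- a ℚ.+_) (sym (+-AG.⁻¹-involutive b)))

  diff-cancel : ∀ a b → (a ℚ.- b) ℚ.+ b ≡ a
  diff-cancel a b = trans (ℚ.+-assoc a (ℚ.- b) b)
    (trans (cong (a ℚ.+_) (ℚ.+-inverseˡ b)) (ℚ.+-identityʳ a))

  sum-cancel : ∀ a b → (a ℚ.+ b) ℚ.- a ≡ b
  sum-cancel a b = trans (cong (ℚ._- a) (ℚ.+-comm a b)) (trans (ℚ.+-assoc b a (ℚ.- a))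
    (trans (cong (b ℚ.+_) (ℚ.+-inverseʳ a)) (ℚ.+-identityʳ b)))

  neg-of-diff : ∀ a b → ℚ.- (a ℚ.- b) ≡ b ℚ.- a
  neg-of-diff a b = trans (ℚ.neg-distrib-+ a (ℚ.- b)) (sym (neg-diff a b))

  +-swap : ∀ a b c → (a ℚ.+ b) ℚ.+ c ≡ (a ℚ.+ c) ℚ.+ b
  +-swap a b c = trans (ℚ.+-assoc a b c)
    (trans (cong (a ℚ.+_) (ℚ.+-comm b c)) (sym (ℚ.+-assoc a c b)))

  *-distrib-diff : ∀ a b c → a ℚ.* (b ℚ.- c) ≡ a ℚ.* b ℚ.- a ℚ.* c
  *-distrib-diff a b c = trans (ℚ.*-distribˡ-+ a b (ℚ.- c))
    (cong (a ℚ.* b ℚ.+_) (sym (ℚ.neg-distribʳ-* a c)))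

  product-diff : ∀ a b c d → a ℚ.* (c ℚ.- d) ℚ.+ d ℚ.* (a ℚ.- b) ≡ a ℚ.* c ℚ.- b ℚ.* d
  product-diff a b c d = trans (cong₂ ℚ._+_ (*-distrib-diff a c d) (*-distrib-diff d a b))
    (trans (cong (λ z → (a ℚ.* c ℚ.- a ℚ.* d) ℚ.+ (z ℚ.- d ℚ.* b)) (ℚ.*-comm d a))
      (trans (sym (ℚ.+-assoc (a ℚ.* c ℚ.- a ℚ.* d) (a ℚ.* d) (ℚ.- (d ℚ.* b))))
        (cong₂ ℚ._-_ (diff-cancel (a ℚ.* c) (a ℚ.* d)) (ℚ.*-comm d b))))

  half-pos : ∀ {ε} → 0ℚ ℚ.< ε → 0ℚ ℚ.< ½ ℚ.* ε
  half-pos {ε} 0<ε = subst (ℚ._< ½ ℚ.* ε) (ℚ.*-zeroʳ ½) (ℚ.*-monoʳ-<-pos ½ 0<ε)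

  half+half : ∀ ε → ½ ℚ.* ε ℚ.+ ½ ℚ.* ε ≡ ε
  half+half ε = trans (sym (ℚ.*-distribʳ-+ ε ½ ½)) (ℚ.*-identityˡ ε)

  abs-+-< : ∀ p q {ε} → ℚ.∣ p ∣ ℚ.< ½ ℚ.* ε → ℚ.∣ q ∣ ℚ.< ½ ℚ.* ε → ℚ.∣ p ℚ.+ q ∣ ℚ.< ε
  abs-+-< p q {ε} p< q< = ℚ.≤-<-trans (ℚ.∣p+q∣≤∣p∣+∣q∣ p q)
    (subst (ℚ.∣ p ∣ ℚ.+ ℚ.∣ q ∣ ℚ.<_) (half+half ε) (ℚ.+-mono-< p< q<))

  const-cauchy : ∀ q → IsCauchy (λ _ → q)
  const-cauchy q ε 0<ε = 0 , λ _ _ _ _ →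
    subst (λ z → ℚ.∣ z ∣ ℚ.< ε) (sym (ℚ.+-inverseʳ q)) 0<ε

  +-cauchy : ∀ {f g} → IsCauchy f → IsCauchy g → IsCauchy (λ n → f n ℚ.+ g n)
  +-cauchy {f} {g} cf cg ε 0<ε with cf (½ ℚ.* ε) (half-pos 0<ε) | cg (½ ℚ.* ε) (half-pos 0<ε)
  ... | M , hf | N , hg = M ℕ.⊔ N , λ m n m≥ n≥ →
    subst (λ z → ℚ.∣ z ∣ ℚ.< ε) (sum-diff (f m) (f n) (g m) (g n))
      (abs-+-< (f m ℚ.- f n) (g m ℚ.- g n)
        (hf m n (ℕ.≤-trans (ℕ.m≤m⊔n M N) m≥) (ℕ.≤-trans (ℕ.m≤m⊔n M N) n≥))
        (hg m n (ℕ.≤-trans (ℕ.m≤n⊔m M N) m≥) (ℕ.≤-trans (ℕ.m≤n⊔m M N) n≥)))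

  neg-cauchy : ∀ {f} → IsCauchy f → IsCauchy (λ n → ℚ.- f n)
  neg-cauchy {f} cf ε 0<ε with cf ε 0<ε
  ... | N , h = N , λ m n m≥ n≥ →
    subst (λ z → ℚ.∣ z ∣ ℚ.< ε) (neg-diff (f m) (f n)) (h n m n≥ m≥)

  eventually-bounded : ∀ {f} → IsCauchy f →
    ∃ λ B → 0ℚ ℚ.< B × ∃ λ N → ∀ n → N ℕ.≤ n → ℚ.∣ f n ∣ ℚ.≤ B
  eventually-bounded {f} cf with cf 1ℚ (ℚ.positive⁻¹ 1ℚ)
  ... | N , h = 1ℚ ℚ.+ ℚ.∣ f N ∣
      , ℚ.+-mono-<-≤ (ℚ.positive⁻¹ 1ℚ) (ℚ.0≤∣p∣ (f N))
      , N , λ n n≥ → ℚ.≤-trans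
          (subst (λ z → ℚ.∣ z ∣ ℚ.≤ ℚ.∣ f n ℚ.- f N ∣ ℚ.+ ℚ.∣ f N ∣) (diff-cancel (f n) (f N))
            (ℚ.∣p+q∣≤∣p∣+∣q∣ (f n ℚ.- f N) (f N)))
          (ℚ.+-monoˡ-≤ ℚ.∣ f N ∣ (ℚ.<⇒≤ (h n N n≥ ℕ.≤-refl)))

  scale : ∀ B ε → 0ℚ ℚ.< B → 0ℚ ℚ.< ε → ∃ λ δ → 0ℚ ℚ.< δ × B ℚ.* δ ≡ ε
  scale B ε 0<B 0<ε = δ , ℚ.positive⁻¹ δ , eq
    where
    instance
      B⁺ : ℚ.Positive B
      B⁺ = ℚ.positive 0<B
      ε⁺ : ℚ.Positive ε
      ε⁺ = ℚ.positive 0<ε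
      B≢0 : ℚ.NonZero B
      B≢0 = ℚ.pos⇒nonZero B
      B⁻¹⁺ : ℚ.Positive (ℚ.1/ B)
      B⁻¹⁺ = ℚ.1/pos⇒pos B
    δ = (ℚ.1/ B) ℚ.* ε
    instance
      δ⁺ : ℚ.Positive δ
      δ⁺ = ℚ.pos*pos⇒pos (ℚ.1/ B) ε
    eq : B ℚ.* δ ≡ ε
    eq = trans (sym (ℚ.*-assoc B (ℚ.1/ B) ε))
      (trans (cong (ℚ._* ε) (ℚ.*-inverseʳ B)) (ℚ.*-identityˡ ε))

  abs-*-< : ∀ p q {B δ ε} → 0ℚ ℚ.< B → B ℚ.* δ ≡ ε →
    ℚ.∣ p ∣ ℚ.≤ B → ℚ.∣ q ∣ ℚ.< δ → ℚ.∣ p ℚ.* q ∣ ℚ.< ε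
  abs-*-< p q {B} {δ} 0<B refl p≤ q< =
    subst (ℚ._< B ℚ.* δ) (sym (ℚ.∣p*q∣≡∣p∣*∣q∣ p q))
      (ℚ.≤-<-trans
        (ℚ.*-monoʳ-≤-nonNeg ℚ.∣ q ∣ {{ℚ.nonNegative (ℚ.0≤∣p∣ q)}} p≤)
        (ℚ.*-monoʳ-<-pos B {{ℚ.positive 0<B}} q<))

  *-cauchy : ∀ {f g} → IsCauchy f → IsCauchy g → IsCauchy (λ n → f n ℚ.* g n)
  *-cauchy {f} {g} cf cg ε 0<ε =
    let A , 0<A , N₁ , hA = eventually-bounded cf
        B , 0<B , N₂ , hB = eventually-bounded cg
        α , 0<α , Aα = scale A (½ ℚ.* ε) 0<A (half-pos 0<ε)
        β , 0<β , Bβ = scale B (½ ℚ.* ε) 0<B (half-pos 0<ε)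
        N₃ , hg = cg α 0<α
        N₄ , hf = cf β 0<β
    in (N₁ ℕ.⊔ N₂) ℕ.⊔ (N₃ ℕ.⊔ N₄) , λ m n m≥ n≥ →
      let m≥₁₂ = ℕ.m⊔n≤o⇒m≤o (N₁ ℕ.⊔ N₂) (N₃ ℕ.⊔ N₄) m≥
          m≥₃₄ = ℕ.m⊔n≤o⇒n≤o (N₁ ℕ.⊔ N₂) (N₃ ℕ.⊔ N₄) m≥
          n≥₁₂ = ℕ.m⊔n≤o⇒m≤o (N₁ ℕ.⊔ N₂) (N₃ ℕ.⊔ N₄) n≥
          n≥₃₄ = ℕ.m⊔n≤o⇒n≤o (N₁ ℕ.⊔ N₂) (N₃ ℕ.⊔ N₄) n≥
      in subst (λ z → ℚ.∣ z ∣ ℚ.< ε) (product-diff (f m) (f n) (g m) (g n))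
        (abs-+-< (f m ℚ.* (g m ℚ.- g n)) (g n ℚ.* (f m ℚ.- f n))
          (abs-*-< (f m) (g m ℚ.- g n) 0<A Aα (hA m (ℕ.m⊔n≤o⇒m≤o N₁ N₂ m≥₁₂))
            (hg m n (ℕ.m⊔n≤o⇒m≤o N₃ N₄ m≥₃₄) (ℕ.m⊔n≤o⇒m≤o N₃ N₄ n≥₃₄)))
          (abs-*-< (g n) (f m ℚ.- f n) 0<B Bβ (hB n (ℕ.m⊔n≤o⇒n≤o N₁ N₂ n≥₁₂))
            (hf m n (ℕ.m⊔n≤o⇒n≤o N₃ N₄ m≥₃₄) (ℕ.m⊔n≤o⇒n≤o N₃ N₄ n≥₃₄))))

fromℚ : ℚ → ℝ
fromℚ q = mkℝ (λ _ → q) (const-cauchy q)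

fromℕ : ℕ → ℝ
fromℕ n = fromℚ (ℤ.+ n ℚ./ 1)

0ℝ 1ℝ : ℝ
0ℝ = fromℚ 0ℚ
1ℝ = fromℚ 1ℚ

infix  8 -_
infixr 8 _^_
infixl 7 _*_
infixl 6 _+_ _-_

_+_ : ℝ → ℝ → ℝ
x + y = mkℝ (λ n → seq x n ℚ.+ seq y n) (+-cauchy {seq x} {seq y} (cauchy x) (cauchy y))

-_ : ℝ → ℝ
- x = mkℝ (λ n → ℚ.- seq x n) (neg-cauchy {seq x} (cauchy x))

_-_ : ℝ → ℝ → ℝ
x - y = x + (- y)

_*_ : ℝ → ℝ → ℝ
x * y = mkℝ (λ n → seq x n ℚ.* seq y n) (*-cauchy {seq x} {seq y} (cauchy x) (cauchy y))

_^_ : ℝ → ℕ → ℝ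
x ^ zero  = 1ℝ
x ^ suc n = x * x ^ n

sum : ∀ {n} → Vector ℝ n → ℝ
sum = Vector.foldr _+_ 0ℝ

product : ∀ {n} → Vector ℝ n → ℝ
product = Vector.foldr _*_ 1ℝ

-- log n = ∫₁ⁿ dt/t, as the limit of the right-endpoint Riemann sums with
-- mesh h = 2⁻ᵏ; the i-th summand is h / (1 + (i + 1) h) = 1 / (2ᵏ + i + 1).

sumℚ : ℕ → (ℕ → ℚ) → ℚ
sumℚ zero    f = 0ℚ
sumℚ (suc m) f = sumℚ m f ℚ.+ f m

logSum : ℕ → ℕ → ℚ
logSum n k = sumℚ ((n ℕ.∸ 1) ℕ.* 2 ℕ.^ k) (λ i → ℤ.1ℤ ℚ./ suc (2 ℕ.^ k ℕ.+ i))

private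
  recip : ℕ → ℚ
  recip zero    = 0ℚ
  recip (suc j) = ℤ.1ℤ ℚ./ suc j

  fromℚᵘ-mono-≤ : ∀ {p q} → p ℚᵘ.≤ q → ℚ.fromℚᵘ p ℚ.≤ ℚ.fromℚᵘ q
  fromℚᵘ-mono-≤ {p} {q} p≤q = ℚ.toℚᵘ-cancel-≤
    (ℚᵘ.≤-respˡ-≃ (ℚᵘ.≃-sym (ℚ.toℚᵘ-fromℚᵘ p))
      (ℚᵘ.≤-respʳ-≃ (ℚᵘ.≃-sym (ℚ.toℚᵘ-fromℚᵘ q)) p≤q))

  recip-antimono : ∀ {i j} → 0 ℕ.< i → i ℕ.≤ j → recip j ℚ.≤ recip i
  recip-antimono {suc i} {suc j} _ i≤j =
    fromℚᵘ-mono-≤ {ℚᵘ.mkℚᵘ ℤ.1ℤ j} {ℚᵘ.mkℚᵘ ℤ.1ℤ i}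
      (ℚᵘ.*≤* (subst₂ ℤ._≤_ (sym (ℤ.*-identityˡ (ℤ.+ suc i))) (sym (ℤ.*-identityˡ (ℤ.+ suc j)))
        (ℤ.+≤+ i≤j)))

  0≤recip : ∀ i → 0ℚ ℚ.≤ recip i
  0≤recip zero    = ℚ.≤-refl
  0≤recip (suc i) = fromℚᵘ-mono-≤ {ℚᵘ.0ℚᵘ} {ℚᵘ.mkℚᵘ ℤ.1ℤ i} (ℚᵘ.*≤* (ℤ.+≤+ ℕ.z≤n))

  recip-double : ∀ j → recip (j ℕ.+ j) ℚ.+ recip (j ℕ.+ j) ≡ recip j
  recip-double zero    = refl
  recip-double (suc j) = ℚ.toℚᵘ-injective
    (ℚᵘ.≃-trans (ℚ.toℚᵘ-homo-+ (recip (suc j ℕ.+ suc j)) (recip (suc j ℕ.+ suc j)))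
      (ℚᵘ.≃-trans (ℚᵘ.+-cong r r) (ℚᵘ.≃-trans unnormalised (ℚᵘ.≃-sym (ℚ.toℚᵘ-fromℚᵘ (ℚᵘ.mkℚᵘ ℤ.1ℤ j))))))
    where
    u = ℚᵘ.mkℚᵘ ℤ.1ℤ (j ℕ.+ suc j)
    r : ℚ.toℚᵘ (recip (suc j ℕ.+ suc j)) ℚᵘ.≃ u
    r = ℚ.toℚᵘ-fromℚᵘ u
    a = ℤ.+ (suc j ℕ.+ suc j)
    unnormalised : u ℚᵘ.+ u ℚᵘ.≃ ℚᵘ.mkℚᵘ ℤ.1ℤ j
    unnormalised = ℚᵘ.*≡* (trans
      (cong (λ z → (z ℤ.+ z) ℤ.* ℤ.+ suc j) (ℤ.*-identityˡ a))
      (trans (trans (ℤ.*-distribʳ-+ (ℤ.+ suc j) a a) (sym (ℤ.*-distribˡ-+ a (ℤ.+ suc j) (ℤ.+ suc j))))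
        (trans (sym (ℤ.pos-* (suc j ℕ.+ suc j) (suc j ℕ.+ suc j)))
          (sym (ℤ.*-identityˡ (ℤ.+ ((suc j ℕ.+ suc j) ℕ.* (suc j ℕ.+ suc j))))))))

  R : ℕ → ℕ → ℚ
  R N i = recip (suc (N ℕ.+ i))

  shift : ∀ N m → suc ((N ℕ.+ N) ℕ.+ suc (m ℕ.+ m)) ≡ suc (N ℕ.+ m) ℕ.+ suc (N ℕ.+ m)
  shift N m = cong suc (trans (ℕ.+-suc (N ℕ.+ N) (m ℕ.+ m))
    (trans (cong suc (interchange N N m m)) (sym (ℕ.+-suc (N ℕ.+ m) (N ℕ.+ m)))))
    where
    interchange : ∀ a b c d → (a ℕ.+ b) ℕ.+ (c ℕ.+ d) ≡ (a ℕ.+ c) ℕ.+ (b ℕ.+ d)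
    interchange a b c d = trans (ℕ.+-assoc a b (c ℕ.+ d))
      (trans (cong (a ℕ.+_) (trans (sym (ℕ.+-assoc b c d))
        (trans (cong (ℕ._+ d) (ℕ.+-comm b c)) (ℕ.+-assoc c b d))))
        (sym (ℕ.+-assoc a c (b ℕ.+ d))))

  double-suc : ∀ m → suc m ℕ.+ suc m ≡ suc (suc (m ℕ.+ m))
  double-suc m = cong suc (ℕ.+-suc m m)

  odd-even : ∀ N m → R (N ℕ.+ N) (suc (m ℕ.+ m)) ℚ.+ R (N ℕ.+ N) (suc (m ℕ.+ m)) ≡ R N m
  odd-even N m = trans (cong (λ z → recip z ℚ.+ recip z) (shift N m)) (recip-double (suc (N ℕ.+ m)))

  refine-lower : ∀ N m → sumℚ m (R N) ℚ.≤ sumℚ (m ℕ.+ m) (R (N ℕ.+ N))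
  refine-lower N zero    = ℚ.≤-refl
  refine-lower N (suc m) =
    subst (λ z → sumℚ (suc m) (R N) ℚ.≤ sumℚ z (R NN)) (sym (double-suc m)) (begin
      t ℚ.+ R N m
        ≡⟨ cong (t ℚ.+_) (sym (odd-even N m)) ⟩
      t ℚ.+ (e ℚ.+ e)
        ≤⟨ ℚ.+-mono-≤ (refine-lower N m) (ℚ.+-monoˡ-≤ e
             (recip-antimono ℕ.z<s (ℕ.s≤s (ℕ.+-monoʳ-≤ NN (ℕ.n≤1+n mm))))) ⟩
      s ℚ.+ (R NN mm ℚ.+ e)
        ≡⟨ sym (ℚ.+-assoc s (R NN mm) e) ⟩
      (s ℚ.+ R NN mm) ℚ.+ e ∎)
    where
    open ℚ.≤-Reasoning
    NN = N ℕ.+ N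
    mm = m ℕ.+ m
    s = sumℚ mm (R NN)
    t = sumℚ m (R N)
    e = R NN (suc mm)

  refine-upper : ∀ N m → 0 ℕ.< N →
    sumℚ (m ℕ.+ m) (R (N ℕ.+ N)) ℚ.+ recip ((N ℕ.+ N) ℕ.+ (m ℕ.+ m))
      ℚ.≤ sumℚ m (R N) ℚ.+ recip (N ℕ.+ N)
  refine-upper N zero 0<N =
    ℚ.≤-reflexive (cong (λ z → 0ℚ ℚ.+ recip z) (ℕ.+-identityʳ (N ℕ.+ N)))
  refine-upper N (suc m) 0<N =
    subst (λ z → sumℚ z (R NN) ℚ.+ recip (NN ℕ.+ z) ℚ.≤ sumℚ (suc m) (R N) ℚ.+ recip NN)
      (sym (double-suc m)) (begin
      ((s ℚ.+ R NN mm) ℚ.+ e) ℚ.+ recip (NN ℕ.+ suc (suc mm))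
        ≡⟨ cong (λ z → ((s ℚ.+ R NN mm) ℚ.+ e) ℚ.+ recip z) (ℕ.+-suc NN (suc mm)) ⟩
      ((s ℚ.+ R NN mm) ℚ.+ e) ℚ.+ e
        ≡⟨ ℚ.+-assoc (s ℚ.+ R NN mm) e e ⟩
      (s ℚ.+ R NN mm) ℚ.+ (e ℚ.+ e)
        ≤⟨ ℚ.+-monoˡ-≤ (e ℚ.+ e) (ℚ.+-monoʳ-≤ s (recip-antimono
             (ℕ.≤-trans 0<N (ℕ.≤-trans (ℕ.m≤m+n N N) (ℕ.m≤m+n NN mm))) (ℕ.n≤1+n (NN ℕ.+ mm)))) ⟩
      (s ℚ.+ recip (NN ℕ.+ mm)) ℚ.+ (e ℚ.+ e)
        ≤⟨ ℚ.+-mono-≤ (refine-upper N m 0<N) (ℚ.≤-reflexive (odd-even N m)) ⟩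
      (t ℚ.+ recip NN) ℚ.+ R N m
        ≡⟨ +-swap t (recip NN) (R N m) ⟩
      (t ℚ.+ R N m) ℚ.+ recip NN ∎)
    where
    open ℚ.≤-Reasoning
    NN = N ℕ.+ N
    mm = m ℕ.+ m
    s = sumℚ mm (R NN)
    t = sumℚ m (R N)
    e = R NN (suc mm)

  2^suc : ∀ k → 2 ℕ.^ suc k ≡ 2 ℕ.^ k ℕ.+ 2 ℕ.^ k
  2^suc k = cong (2 ℕ.^ k ℕ.+_) (ℕ.+-identityʳ (2 ℕ.^ k))

  0<2^ : ∀ k → 0 ℕ.< 2 ℕ.^ k
  0<2^ k = ℕ.m^n>0 2 k

  logSum-suc : ∀ n k → let N = 2 ℕ.^ k ; m = (n ℕ.∸ 1) ℕ.* N in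
    logSum n (suc k) ≡ sumℚ (m ℕ.+ m) (R (N ℕ.+ N))
  logSum-suc n k = trans
    (cong (λ N → sumℚ ((n ℕ.∸ 1) ℕ.* N) (R N)) (2^suc k))
    (cong (λ m → sumℚ m (R (2 ℕ.^ k ℕ.+ 2 ℕ.^ k))) (ℕ.*-distribˡ-+ (n ℕ.∸ 1) (2 ℕ.^ k) (2 ℕ.^ k)))

  logSum-step : ∀ n k → logSum n k ℚ.≤ logSum n (suc k)
  logSum-step n k = subst (logSum n k ℚ.≤_) (sym (logSum-suc n k)) (refine-lower (2 ℕ.^ k) ((n ℕ.∸ 1) ℕ.* 2 ℕ.^ k))

  upper-step : ∀ n k →
    logSum n (suc k) ℚ.+ recip (2 ℕ.^ suc k) ℚ.≤ logSum n k ℚ.+ recip (2 ℕ.^ k)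
  upper-step n k = begin
    logSum n (suc k) ℚ.+ recip (2 ℕ.^ suc k)
      ≡⟨ cong₂ (λ a b → a ℚ.+ recip b) (logSum-suc n k) (2^suc k) ⟩
    s ℚ.+ r
      ≤⟨ ℚ.+-monoˡ-≤ r (ℚ.≤-trans (ℚ.≤-reflexive (sym (ℚ.+-identityʳ s)))
           (ℚ.+-monoʳ-≤ s (0≤recip ((N ℕ.+ N) ℕ.+ (m ℕ.+ m))))) ⟩
    (s ℚ.+ recip ((N ℕ.+ N) ℕ.+ (m ℕ.+ m))) ℚ.+ r
      ≤⟨ ℚ.+-monoˡ-≤ r (refine-upper N m (0<2^ k)) ⟩
    (logSum n k ℚ.+ r) ℚ.+ r
      ≡⟨ ℚ.+-assoc (logSum n k) r r ⟩
    logSum n k ℚ.+ (r ℚ.+ r)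
      ≡⟨ cong (logSum n k ℚ.+_) (recip-double N) ⟩
    logSum n k ℚ.+ recip N ∎
    where
    open ℚ.≤-Reasoning
    N = 2 ℕ.^ k
    m = (n ℕ.∸ 1) ℕ.* N
    s = sumℚ (m ℕ.+ m) (R (N ℕ.+ N))
    r = recip (N ℕ.+ N)

  ascend : ∀ n {K k} → K ℕ.≤′ k → logSum n K ℚ.≤ logSum n k
  ascend n ℕ.≤′-refl = ℚ.≤-refl
  ascend n {k = suc k} (ℕ.≤′-step p) = ℚ.≤-trans (ascend n p) (logSum-step n k)

  descend : ∀ n {K k} → K ℕ.≤′ k →
    logSum n k ℚ.+ recip (2 ℕ.^ k) ℚ.≤ logSum n K ℚ.+ recip (2 ℕ.^ K)
  descend n ℕ.≤′-refl = ℚ.≤-refl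
  descend n {k = suc k} (ℕ.≤′-step p) = ℚ.≤-trans (upper-step n k) (descend n p)

  n<2^n : ∀ n → n ℕ.< 2 ℕ.^ n
  n<2^n zero    = ℕ.z<s
  n<2^n (suc n) = subst (suc n ℕ.<_) (sym (2^suc n)) (ℕ.+-mono-≤-< (0<2^ n) (n<2^n n))

  recip-small : ∀ ε → 0ℚ ℚ.< ε → ∃ λ K → recip (2 ℕ.^ K) ℚ.< ε
  recip-small ε 0<ε = archimedean ε (ℚ.positive 0<ε)
    where
    archimedean : ∀ ε → ℚ.Positive ε → ∃ λ K → recip (2 ℕ.^ K) ℚ.< ε
    archimedean ε@(ℚ.mkℚ (ℤ.+ suc p) d _) _ = suc d , lt (n<2^n (suc d))
      where
      lt : ∀ {j} → suc d ℕ.< j → recip j ℚ.< ε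
      lt {suc j} d<j = ℚ.toℚᵘ-cancel-<
        (ℚᵘ.<-respˡ-≃ (ℚᵘ.≃-sym (ℚ.toℚᵘ-fromℚᵘ (ℚᵘ.mkℚᵘ ℤ.1ℤ j)))
          (ℚᵘ.*<* (subst₂ ℤ._<_ (sym (ℤ.*-identityˡ (ℤ.+ suc d))) (ℤ.pos-* (suc p) (suc j))
            (ℤ.+<+ (ℕ.<-≤-trans d<j (ℕ.m≤n*m (suc j) (suc p)))))))

  bracket : ∀ a g x y → a ℚ.≤ y → x ℚ.≤ a ℚ.+ g → x ℚ.- y ℚ.≤ g
  bracket a g x y a≤y x≤ = begin
    x ℚ.- y          ≤⟨ ℚ.+-mono-≤ {x} {a ℚ.+ g} {ℚ.- y} {ℚ.- a} x≤ (ℚ.neg-antimono-≤ {a} {y} a≤y) ⟩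
    (a ℚ.+ g) ℚ.- a  ≡⟨ sum-cancel a g ⟩
    g                ∎
    where open ℚ.≤-Reasoning

  abs-≤ : ∀ z g → z ℚ.≤ g → ℚ.- z ℚ.≤ g → ℚ.∣ z ∣ ℚ.≤ g
  abs-≤ z g z≤ -z≤ with ℚ.∣p∣≡p∨∣p∣≡-p z
  ... | inj₁ eq = subst (ℚ._≤ g) (sym eq) z≤
  ... | inj₂ eq = subst (ℚ._≤ g) (sym eq) -z≤

  squeeze : ∀ a g x y → a ℚ.≤ x → x ℚ.≤ a ℚ.+ g → a ℚ.≤ y → y ℚ.≤ a ℚ.+ g → ℚ.∣ x ℚ.- y ∣ ℚ.≤ g
  squeeze a g x y a≤x x≤ a≤y y≤ = abs-≤ (x ℚ.- y) g (bracket a g x y a≤y x≤)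
    (subst (ℚ._≤ g) (sym (neg-of-diff x y)) (bracket a g y x a≤x y≤))

  logSum-below : ∀ n {K k} → K ℕ.≤′ k → logSum n k ℚ.≤ logSum n K ℚ.+ recip (2 ℕ.^ K)
  logSum-below n {K} {k} K≤k = begin
    logSum n k                       ≡⟨ sym (ℚ.+-identityʳ (logSum n k)) ⟩
    logSum n k ℚ.+ 0ℚ                ≤⟨ ℚ.+-monoʳ-≤ (logSum n k) (0≤recip (2 ℕ.^ k)) ⟩
    logSum n k ℚ.+ recip (2 ℕ.^ k)   ≤⟨ descend n K≤k ⟩
    logSum n K ℚ.+ recip (2 ℕ.^ K)   ∎
    where open ℚ.≤-Reasoning

  logSum-cauchy : ∀ n → IsCauchy (logSum n)
  logSum-cauchy n ε 0<ε = let K , small = recip-small ε 0<ε in K , λ i j i≥ j≥ →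
    ℚ.≤-<-trans {ℚ.∣ logSum n i ℚ.- logSum n j ∣} {recip (2 ℕ.^ K)} {ε}
      (squeeze (logSum n K) (recip (2 ℕ.^ K)) (logSum n i) (logSum n j)
        (ascend n (ℕ.≤⇒≤′ i≥)) (logSum-below n (ℕ.≤⇒≤′ i≥))
        (ascend n (ℕ.≤⇒≤′ j≥)) (logSum-below n (ℕ.≤⇒≤′ j≥)))
      small

-- Meaningful for n ≥ 1; log 0 is the junk value 0.
log : ℕ → ℝ
log n = mkℝ (logSum n) (logSum-cauchy n)

Point : ℕ → Set
Point d = Vector ℝ d

UnitCube : ∀ {d} → Point d → Set
UnitCube x = ∀ i → 0ℝ ≤ x i × x i ≤ 1ℝ

record Box (d : ℕ) : Set where
  field
    lower upper : Point d
    lower≤upper : ∀ i → lower i ≤ upper i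

open Box public

_∈ᴮ_ : ∀ {d} → Point d → Box d → Set
x ∈ᴮ B = ∀ i → lower B i ≤ x i × x i ≤ upper B i

volume : ∀ {d} → Box d → ℝ
volume B = product (λ i → upper B i - lower B i)

partialSum : (ℕ → ℝ) → ℕ → ℝ
partialSum f zero    = 0ℝ
partialSum f (suc N) = partialSum f N + f N

-- λ*(S) ≤ r, where λ*(S) is the infimum of the total volumes of the
-- countable covers of S by boxes.
OuterMeasure≤ : ∀ {d} → (Point d → Set) → ℝ → Set
OuterMeasure≤ {d} S r = ∀ ε → 0ℝ < ε → Σ (ℕ → Box d) λ B →
  (∀ x → S x → ∃ λ k → x ∈ᴮ B k) ×
  (∀ N → partialSum (volume ∘ B) N ≤ r + ε)

-- λ₊(S) ≥ r for S ⊆ [0,1]^d, where λ₊(S) = 1 - λ*([0,1]^d ∖ S) is Lebesgue's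
-- inner measure.
InnerMeasure≥ : ∀ {d} → (Point d → Set) → ℝ → Set
InnerMeasure≥ S r = OuterMeasure≤ (λ x → UnitCube x × ¬ S x) (1ℝ - r)

-- For S ⊆ [0,1]^d: S is Lebesgue measurable and its measure is r. Since
-- λ₊(S) ≤ λ*(S), the two bounds say that λ₊(S) = λ*(S) = r.
HasLebesgueMeasure : ∀ {d} → (Point d → Set) → ℝ → Set
HasLebesgueMeasure S r = OuterMeasure≤ S r × InnerMeasure≥ S r

-- A set system on the ground set Fin n.
record SetSystem (n : ℕ) : Set where
  field
    members : List (Subset n)
    unique  : Unique members

open SetSystem public

_∈ˢ_ : ∀ {n} → Subset n → SetSystem n → Set
F ∈ˢ 𝓕 = F List.∈ members 𝓕

Coloring : ℕ → Set
Coloring n = Vector Sign n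

colorSum : ∀ {n} → Coloring n → Subset n → ℤ
colorSum χ F = Vector.foldr ℤ._+_ ℤ.0ℤ
  (λ v → if lookup F v then χ v ℤ.◃ 1 else ℤ.0ℤ)

sumOver : ∀ {n} → SetSystem n → (Subset n → ℝ) → ℝ
sumOver 𝓕 f = List.foldr _+_ 0ℝ (List.map f (members 𝓕))

IsInverse : ℝ → ℝ → Set
IsInverse a u = u * a ≈ 1ℝ

IsRoot : ℕ → ℝ → ℝ → Set
IsRoot p a r = 0ℝ ≤ r × r ^ p ≈ a

-- v = ((1 / w(𝓕)) Σ_{F ∈ 𝓕} w(F) |χ(F)|ᵖ)^(1/p)
IsDiscOf : ∀ {n} → ℕ → (Subset n → ℝ) → SetSystem n → Coloring n → ℝ → Set
IsDiscOf p w 𝓕 χ v = ∃ λ u → IsInverse (sumOver 𝓕 w) u ×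
  IsRoot p (u * sumOver 𝓕 (λ F → w F * fromℕ (ℤ.∣ colorSum χ F ∣ ℕ.^ p))) v

-- D = disc_{p,w} 𝓕; only the values of w on members of 𝓕 matter.
IsDisc : ∀ {n} → ℕ → (Subset n → ℝ) → SetSystem n → ℝ → Set
IsDisc p w 𝓕 D =
  (∀ F → F ∈ˢ 𝓕 → 0ℝ ≤ w F) ×
  0ℝ < sumOver 𝓕 w ×
  (∃ λ χ → IsDiscOf p w 𝓕 χ D) ×
  (∀ χ v → IsDiscOf p w 𝓕 χ v → D ≤ v)

Anchored : ∀ {d} → Point d → Point d → Set
Anchored x y = ∀ i → 0ℝ ≤ y i × y i ≤ x i

-- An n-point subset of [0,1]^d, its points indexed by Fin n.
record PointSet (d n : ℕ) : Set where
  field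
    point    : Fin n → Point d
    inCube   : ∀ v → UnitCube (point v)
    distinct : ∀ u v → (∀ i → point u i ≈ point v i) → u ≡ v

open PointSet public

-- x ∈ [0,1]^d and A(x) ∩ P = F
Cell : ∀ {d n} → PointSet d n → Subset n → Point d → Set
Cell P F x = UnitCube x × (∀ v → v ∈ F ⇔ Anchored x (point P v))

-- 𝓐 = 𝒜_d(P)
IsAnchoredSystem : ∀ {d n} → PointSet d n → SetSystem n → Set
IsAnchoredSystem P 𝓐 = ∀ F → F ∈ˢ 𝓐 ⇔ ∃ (Cell P F)

-- w is the weight w̄ on 𝓐
IsCellMeasure : ∀ {d n} → PointSet d n → SetSystem n → (Subset n → ℝ) → Set
IsCellMeasure P 𝓐 w = ∀ F → F ∈ˢ 𝓐 → HasLebesgueMeasure (Cell P F) (w F)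

-- D = disc_{p,w̄} 𝒜_d(P)
IsAnchoredDisc : ∀ {d n} → ℕ → PointSet d n → ℝ → Set
IsAnchoredDisc {n = n} p P D =
  Σ (SetSystem n) λ 𝓐 → IsAnchoredSystem P 𝓐 ×
  Σ (Subset n → ℝ) λ w → IsCellMeasure P 𝓐 w ×
  IsDisc p w 𝓐 D

{-# OPTIONS --safe #-}
module Submission where

-- On a fine grid, the discrepancy function x ↦ χ(A(x) ∩ P) is the image of the signed measure χ
-- under the d-fold tensor power of the matrix T of the order of {0, …, 4 ^ L - 1}. In dimension
-- one, the step functions with values -1, 3, -3, 1 on the quarters of the base 4 intervals are
-- orthogonal, and so are their tail sums. Hence T E Tᵀ is a multiple, of order 16 ^ (L - b), of K,
-- where E and K are the orthogonal projections onto the spans of the step functions of level b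
-- and of their tail sums. By Bessel's inequality in x, the energy of the discrepancy function is
-- at least a multiple of the quadratic form of Γ, the sum of K b₁ ⊗ ⋯ ⊗ K b_d over the
-- k ^ (d - 1) tuples (b₁, …, b_d) with a given sum whose entries, except the last one, are less
-- than k. This Γ is a projection of large trace, so Cholesky elimination finds many grid points
-- with large pivots, and a potential argument finds among them a set P such that every signing
-- of P makes the quadratic form large. The weights of the cells are rational, so the
-- discrepancy of P is the square root of a rational number.

open import Algebra.Bundles using (module CommutativeRing)
import Algebra.Properties.CommutativeSemiring.Exp as CommutativeSemiringExp
import Algebra.Properties.Semiring.Exp as SemiringExp
open import Data.Bool using (Bool; true; false; if_then_else_)
import Data.Bool.Properties as Bool
open import Data.Fin as Fin using (Fin; zero; suc)
open import Data.Fin.Patterns using (0F; 1F; 2F; 3F)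
import Data.Fin.Properties as Fin
open import Data.Fin.Subset as Subset using (Subset)
import Data.Fin.Subset.Properties as Subset
open import Data.Integer as ℤ using (ℤ)
import Data.Integer.Properties as ℤ
open import Data.List as List using (List; []; _∷_; _++_; map; length; cartesianProductWith; upTo; allFin; filter; deduplicate)
open import Data.List.Membership.Propositional using (_∈_; lose)
open import Data.List.Membership.Propositional.Properties using (∈-upTo⁻; ∈-allFin; ∈-filter⁺; ∈-cartesianProductWith⁺; ∈-map⁺; ∈-map⁻; ∈-deduplicate⁺; ∈-deduplicate⁻)
open import Data.List.Properties using (length-upTo; length-++; length-map)
open import Data.List.Relation.Unary.All as All using (All; []; _∷_)
open import Data.List.Relation.Unary.AllPairs using (_∷_)
open import Data.List.Relation.Unary.Any as Any using (Any; here; there; any?)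
open import Data.List.Relation.Unary.Unique.DecPropositional.Properties using (deduplicate-!)
open import Data.List.Relation.Unary.Unique.Propositional using (Unique)
open import Data.List.Relation.Unary.Unique.Propositional.Properties using (upTo⁺; allFin⁺)
open import Data.Nat as ℕ using (ℕ; zero; suc; _∸_) renaming (_≤_ to _≤ℕ_)
open import Data.Nat.DivMod using (_/_; _%_; m≡m%n+[m/n]*n; m%n<n; m<n*o⇒m/o<n)
import Data.Nat.Properties as ℕ
open import Data.Nat.Tactic.RingSolver using () renaming (solve-∀ to ℕ-solve-∀)
open import Data.Product using (Σ; ∃; _×_; _,_; proj₁; proj₂)
open import Data.Rational as ℚ using (ℚ; 0ℚ; 1ℚ; ½)
import Data.Rational.Properties as ℚ
import Data.Rational.Unnormalised as ℚᵘ
import Data.Rational.Unnormalised.Properties as ℚᵘ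
open import Data.Sign as Sign using (Sign)
open import Data.Sum using (_⊎_; inj₁; inj₂)
open import Data.Vec as Vec using (Vec; []; _∷_; lookup; head; tail)
import Data.Vec.Functional as Vector
import Data.Vec.Properties as Vec
open import Function using (_∘_; mk⇔; Equivalence)
open import Level using (0ℓ)
open import Relation.Binary.Definitions using (tri<; tri≈; tri>)
open import Relation.Binary.PropositionalEquality using (_≡_; _≢_; refl; sym; trans; cong; cong₂; subst; subst₂; module ≡-Reasoning)
open import Relation.Nullary using (¬_; Dec; yes; no; does; contradiction)
open import Relation.Nullary.Decidable using (dec⇒maybe; dec-true; dec-false; _×-dec_; ¬?; decidable-stable; ¬¬-excluded-middle)
open import Tactic.RingSolver using (solve-∀)
open import Tactic.RingSolver.Core.AlmostCommutativeRing using (AlmostCommutativeRing; fromCommutativeRing)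

open SemiringExp (CommutativeRing.semiring ℚ.+-*-commutativeRing) using () renaming (_^_ to _^ℚ_; ^-homo-* to ^ℚ-homo-*)
open CommutativeSemiringExp (CommutativeRing.commutativeSemiring ℚ.+-*-commutativeRing) using () renaming (^-distrib-* to ^ℚ-distrib-*)

-- The four values are forced by moments. A tail sum vanishes off its interval only if the step
-- function has sum 0, and is orthogonal to affine functions only if the first and second moments of
-- the step function vanish too. On four equal pieces these three conditions leave one step function
-- up to a factor, while a Haar function satisfies just the first. Orthogonality to affine functions
-- separates the levels, since the coarser function is affine on each finer interval. The sum of the
-- levels is prescribed because the factors `16 ^ (L - b)` then multiply to the same number for all
-- tuples, so that the energy can be compared with a single projection.
--
-- Taking every pivot as a point would not do. If `B` is the base of the potential, the two signs of
-- a point can multiply the potential by `B + 1`, whereas a signing that fails at every step has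
-- potential `B ^ M`. With the option to leave the point out, the better choice costs at most
-- `(B + 2) / 2`, which is below `B` as soon as `B > 2`. The values 8 and 5 satisfy `5 ^ 5 < 8 ^ 4`,
-- so at least a fifth of the pivots succeeds under every signing.

ℚ-ring : AlmostCommutativeRing 0ℓ 0ℓ
ℚ-ring = fromCommutativeRing ℚ.+-*-commutativeRing (λ q → dec⇒maybe (0ℚ ℚ.≟ q))

-- Rational arithmetic.

module RationalLemmas where
  open import Data.Rational using (_+_; _*_; _-_; -_; _≤_; _<_)

  ι : ℕ → ℚ
  ι n = ℤ.+ n ℚ./ 1

  toℚᵘ-ι : ∀ n → ℚ.toℚᵘ (ι n) ℚᵘ.≃ ℚᵘ.mkℚᵘ (ℤ.+ n) 0
  toℚᵘ-ι n = ℚ.toℚᵘ-fromℚᵘ (ℚᵘ.mkℚᵘ (ℤ.+ n) 0)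

  toℚᵘ-/1 : ∀ i → ℚ.toℚᵘ (i ℚ./ 1) ℚᵘ.≃ ℚᵘ.mkℚᵘ i 0
  toℚᵘ-/1 i = ℚ.toℚᵘ-fromℚᵘ (ℚᵘ.mkℚᵘ i 0)

  /1-+ : ∀ i j → (i ℤ.+ j) ℚ./ 1 ≡ i ℚ./ 1 + j ℚ./ 1
  /1-+ i j = ℚ.toℚᵘ-injective (ℚᵘ.≃-trans (toℚᵘ-/1 (i ℤ.+ j)) (ℚᵘ.≃-trans
    (ℚᵘ.*≡* (cong (ℤ._* ℤ.1ℤ) (cong₂ ℤ._+_ (sym (ℤ.*-identityʳ i)) (sym (ℤ.*-identityʳ j)))))
    (ℚᵘ.≃-trans (ℚᵘ.+-cong (ℚᵘ.≃-sym (toℚᵘ-/1 i)) (ℚᵘ.≃-sym (toℚᵘ-/1 j)))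
      (ℚᵘ.≃-sym (ℚ.toℚᵘ-homo-+ (i ℚ./ 1) (j ℚ./ 1))))))

  /1-* : ∀ i j → (i ℤ.* j) ℚ./ 1 ≡ i ℚ./ 1 * (j ℚ./ 1)
  /1-* i j = ℚ.toℚᵘ-injective (ℚᵘ.≃-trans (toℚᵘ-/1 (i ℤ.* j)) (ℚᵘ.≃-trans
    (ℚᵘ.*≡* refl)
    (ℚᵘ.≃-trans (ℚᵘ.*-cong (ℚᵘ.≃-sym (toℚᵘ-/1 i)) (ℚᵘ.≃-sym (toℚᵘ-/1 j)))
      (ℚᵘ.≃-sym (ℚ.toℚᵘ-homo-* (i ℚ./ 1) (j ℚ./ 1))))))

  ι-+ : ∀ m n → ι (m ℕ.+ n) ≡ ι m + ι n
  ι-+ m n = /1-+ (ℤ.+ m) (ℤ.+ n)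

  ι-* : ∀ m n → ι (m ℕ.* n) ≡ ι m * ι n
  ι-* m n = trans (cong (ℚ._/ 1) (ℤ.pos-* m n)) (/1-* (ℤ.+ m) (ℤ.+ n))

  ι-suc : ∀ n → ι (suc n) ≡ 1ℚ + ι n
  ι-suc = ι-+ 1

  ι-mono-≤ : ∀ {m n} → m ℕ.≤ n → ι m ≤ ι n
  ι-mono-≤ {m} {n} m≤n = ℚ.toℚᵘ-cancel-≤
    (ℚᵘ.≤-respˡ-≃ (ℚᵘ.≃-sym (toℚᵘ-ι m)) (ℚᵘ.≤-respʳ-≃ (ℚᵘ.≃-sym (toℚᵘ-ι n))
      (ℚᵘ.*≤* (ℤ.*-monoʳ-≤-nonNeg ℤ.1ℤ (ℤ.+≤+ m≤n)))))

  ι-mono-< : ∀ {m n} → m ℕ.< n → ι m < ι n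
  ι-mono-< {m} {n} m<n = ℚ.toℚᵘ-cancel-<
    (ℚᵘ.<-respˡ-≃ (ℚᵘ.≃-sym (toℚᵘ-ι m)) (ℚᵘ.<-respʳ-≃ (ℚᵘ.≃-sym (toℚᵘ-ι n))
      (ℚᵘ.*<* (ℤ.*-monoʳ-<-pos ℤ.1ℤ (ℤ.+<+ m<n)))))

  ι-cancel-≤ : ∀ {m n} → ι m ≤ ι n → m ℕ.≤ n
  ι-cancel-≤ {m} {n} ιm≤ιn with m ℕ.≤? n
  ... | yes m≤n = m≤n
  ... | no  m≰n = contradiction (ℚ.≤-<-trans ιm≤ιn (ι-mono-< (ℕ.≰⇒> m≰n))) (ℚ.<-irrefl refl)

  0≤ι : ∀ n → 0ℚ ≤ ι n
  0≤ι n = ι-mono-≤ {0} {n} ℕ.z≤n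

  0<1 : 0ℚ < 1ℚ
  0<1 = ℚ.positive⁻¹ 1ℚ

  ≤-by : ∀ {p q} r → 0ℚ ≤ r → p + r ≡ q → p ≤ q
  ≤-by {p} r 0≤r refl = subst (_≤ p + r) (ℚ.+-identityʳ p) (ℚ.+-monoʳ-≤ p 0≤r)

  0≤+ : ∀ {p q} → 0ℚ ≤ p → 0ℚ ≤ q → 0ℚ ≤ p + q
  0≤+ = ℚ.+-mono-≤

  *-monoˡ : ∀ {p q} r → 0ℚ ≤ r → p ≤ q → r * p ≤ r * q
  *-monoˡ r 0≤r = ℚ.*-monoˡ-≤-nonNeg r {{ℚ.nonNegative 0≤r}}

  *-monoʳ : ∀ {p q} r → 0ℚ ≤ r → p ≤ q → p * r ≤ q * r
  *-monoʳ r 0≤r = ℚ.*-monoʳ-≤-nonNeg r {{ℚ.nonNegative 0≤r}}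

  *-mono-≤ : ∀ {p q r s} → 0ℚ ≤ p → 0ℚ ≤ s → p ≤ q → r ≤ s → p * r ≤ q * s
  *-mono-≤ {p} {s = s} 0≤p 0≤s p≤q r≤s = ℚ.≤-trans (*-monoˡ p 0≤p r≤s) (*-monoʳ s 0≤s p≤q)

  0≤* : ∀ {p q} → 0ℚ ≤ p → 0ℚ ≤ q → 0ℚ ≤ p * q
  0≤* {p} {q} 0≤p 0≤q = subst (_≤ p * q) (ℚ.*-zeroʳ p) (*-monoˡ p 0≤p 0≤q)

  0<* : ∀ {p q} → 0ℚ < p → 0ℚ < q → 0ℚ < p * q
  0<* {p} {q} 0<p 0<q = subst (_< p * q) (ℚ.*-zeroʳ p) (ℚ.*-monoʳ-<-pos p {{ℚ.positive 0<p}} 0<q)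

  0≤sq : ∀ p → 0ℚ ≤ p * p
  0≤sq p with ℚ.≤-total 0ℚ p
  ... | inj₁ 0≤p = 0≤* 0≤p 0≤p
  ... | inj₂ p≤0 = subst (0ℚ ≤_) (lemma p) (0≤* (ℚ.neg-antimono-≤ p≤0) (ℚ.neg-antimono-≤ p≤0))
    where
    lemma : ∀ p → - p * - p ≡ p * p
    lemma = solve-∀ ℚ-ring

  +-cancelʳ-≤ : ∀ {p q} r → p + r ≤ q + r → p ≤ q
  +-cancelʳ-≤ {p} {q} r le = subst₂ _≤_ (lemma p r) (lemma q r) (ℚ.+-monoˡ-≤ (- r) le)
    where
    lemma : ∀ p r → p + r - r ≡ p
    lemma = solve-∀ ℚ-ring

  p-q≥0 : ∀ {p q} → q ≤ p → 0ℚ ≤ p - q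
  p-q≥0 {p} {q} q≤p = subst (_≤ p - q) (ℚ.+-inverseʳ q) (ℚ.+-monoˡ-≤ (- q) q≤p)

  sq-cancel-≤ : ∀ {p q} → 0ℚ ≤ q → p * p ≤ q * q → p ≤ q
  sq-cancel-≤ {p} {q} 0≤q pp≤qq with p ℚ.≤? q
  ... | yes p≤q = p≤q
  ... | no  p≰q = contradiction (ℚ.≤-<-trans pp≤qq qq<pp) (ℚ.<-irrefl refl)
    where
    q<p : q < p
    q<p = ℚ.≰⇒> p≰q
    qq<pp : q * q < p * p
    qq<pp = ℚ.≤-<-trans (*-monoˡ q 0≤q (ℚ.<⇒≤ q<p)) (ℚ.*-monoˡ-<-pos p {{ℚ.positive (ℚ.≤-<-trans 0≤q q<p)}} q<p)

  abstract
    inverse : ∀ p → 0ℚ < p → ∃ λ q → 0ℚ < q × p * q ≡ 1ℚ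
    inverse p 0<p = ℚ.1/ p , ℚ.positive⁻¹ (ℚ.1/ p) {{ℚ.1/pos⇒pos p}} , ℚ.*-inverseʳ p
      where
      instance
        p⁺ : ℚ.Positive p
        p⁺ = ℚ.positive 0<p
        p≢0 : ℚ.NonZero p
        p≢0 = ℚ.pos⇒nonZero p

open RationalLemmas

-- Finite sums over lists.

module Sums where
  open import Data.Rational using (_+_; _*_; _-_; -_; _≤_; _<_)

  private variable
    A B : Set

  ∑ : List A → (A → ℚ) → ℚ
  ∑ []       f = 0ℚ
  ∑ (x ∷ xs) f = f x + ∑ xs f

  ∑-cong-∈ : ∀ (xs : List A) {f g : A → ℚ} → (∀ x → x ∈ xs → f x ≡ g x) → ∑ xs f ≡ ∑ xs g
  ∑-cong-∈ []       eq = refl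
  ∑-cong-∈ (x ∷ xs) eq = cong₂ _+_ (eq x (here refl)) (∑-cong-∈ xs (λ y y∈ → eq y (there y∈)))

  ∑-cong : ∀ (xs : List A) {f g : A → ℚ} → (∀ x → f x ≡ g x) → ∑ xs f ≡ ∑ xs g
  ∑-cong xs eq = ∑-cong-∈ xs (λ x _ → eq x)

  ∑-mono-∈ : ∀ (xs : List A) {f g : A → ℚ} → (∀ x → x ∈ xs → f x ≤ g x) → ∑ xs f ≤ ∑ xs g
  ∑-mono-∈ []       f≤g = ℚ.≤-refl
  ∑-mono-∈ (x ∷ xs) f≤g = ℚ.+-mono-≤ (f≤g x (here refl)) (∑-mono-∈ xs (λ y y∈ → f≤g y (there y∈)))

  ∑-mono : ∀ (xs : List A) {f g : A → ℚ} → (∀ x → f x ≤ g x) → ∑ xs f ≤ ∑ xs g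
  ∑-mono xs f≤g = ∑-mono-∈ xs (λ x _ → f≤g x)

  ∑-zero : ∀ (xs : List A) → ∑ xs (λ _ → 0ℚ) ≡ 0ℚ
  ∑-zero []       = refl
  ∑-zero (x ∷ xs) = trans (ℚ.+-identityˡ _) (∑-zero xs)

  0≤∑ : ∀ (xs : List A) {f : A → ℚ} → (∀ x → 0ℚ ≤ f x) → 0ℚ ≤ ∑ xs f
  0≤∑ xs {f} 0≤f = subst (_≤ ∑ xs f) (∑-zero xs) (∑-mono xs 0≤f)

  private
    interchange : ∀ a b c d → (a + b) + (c + d) ≡ (a + c) + (b + d)
    interchange = solve-∀ ℚ-ring

  ∑-+ : ∀ (xs : List A) (f g : A → ℚ) → ∑ xs (λ x → f x + g x) ≡ ∑ xs f + ∑ xs g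
  ∑-+ []       f g = refl
  ∑-+ (x ∷ xs) f g = trans (cong (f x + g x +_) (∑-+ xs f g)) (interchange (f x) (g x) (∑ xs f) (∑ xs g))

  ∑-*ˡ : ∀ (xs : List A) c (f : A → ℚ) → ∑ xs (λ x → c * f x) ≡ c * ∑ xs f
  ∑-*ˡ []       c f = sym (ℚ.*-zeroʳ c)
  ∑-*ˡ (x ∷ xs) c f = trans (cong (c * f x +_) (∑-*ˡ xs c f)) (sym (ℚ.*-distribˡ-+ c (f x) (∑ xs f)))

  ∑-*ʳ : ∀ (xs : List A) c (f : A → ℚ) → ∑ xs (λ x → f x * c) ≡ ∑ xs f * c
  ∑-*ʳ xs c f = trans (∑-cong xs (λ x → ℚ.*-comm (f x) c)) (trans (∑-*ˡ xs c f) (ℚ.*-comm c (∑ xs f)))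

  ∑-const : ∀ (xs : List A) c → ∑ xs (λ _ → c) ≡ ι (length xs) * c
  ∑-const []       c = sym (ℚ.*-zeroˡ c)
  ∑-const (x ∷ xs) c = trans (cong (c +_) (∑-const xs c)) (trans (lemma c (ι (length xs)))
      (cong (_* c) (sym (ι-suc (length xs)))))
    where
    lemma : ∀ c l → c + l * c ≡ (1ℚ + l) * c
    lemma = solve-∀ ℚ-ring

  ∑-++ : ∀ (xs ys : List A) (f : A → ℚ) → ∑ (xs ++ ys) f ≡ ∑ xs f + ∑ ys f
  ∑-++ []       ys f = sym (ℚ.+-identityˡ _)
  ∑-++ (x ∷ xs) ys f = trans (cong (f x +_) (∑-++ xs ys f)) (sym (ℚ.+-assoc (f x) (∑ xs f) (∑ ys f)))

  ∑-map : ∀ (xs : List A) (g : A → B) (f : B → ℚ) → ∑ (map g xs) f ≡ ∑ xs (f ∘ g)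
  ∑-map []       g f = refl
  ∑-map (x ∷ xs) g f = cong (f (g x) +_) (∑-map xs g f)

  ∑-swap : ∀ (xs : List A) (ys : List B) (f : A → B → ℚ) →
    ∑ xs (λ x → ∑ ys (f x)) ≡ ∑ ys (λ y → ∑ xs (λ x → f x y))
  ∑-swap []       ys f = sym (∑-zero ys)
  ∑-swap (x ∷ xs) ys f = trans (cong (∑ ys (f x) +_) (∑-swap xs ys f))
    (sym (∑-+ ys (f x) (λ y → ∑ xs (λ x → f x y))))

  ∑-×-∑ : ∀ (xs : List A) (ys : List B) (f : A → ℚ) (g : B → ℚ) →
    ∑ xs (λ x → ∑ ys (λ y → f x * g y)) ≡ ∑ xs f * ∑ ys g
  ∑-×-∑ xs ys f g = trans (∑-cong xs (λ x → ∑-*ˡ ys (f x) g)) (∑-*ʳ xs (∑ ys g) f)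

  ∑-cartesianProductWith : ∀ {C : Set} (h : A → B → C) (xs : List A) (ys : List B) (f : C → ℚ) →
    ∑ (cartesianProductWith h xs ys) f ≡ ∑ xs (λ x → ∑ ys (λ y → f (h x y)))
  ∑-cartesianProductWith h []       ys f = refl
  ∑-cartesianProductWith h (x ∷ xs) ys f = trans (∑-++ (map (h x) ys) _ f)
    (cong₂ _+_ (∑-map ys (h x) f) (∑-cartesianProductWith h xs ys f))

  ∑-delta : ∀ {xs : List A} → Unique xs → ∀ {a} → a ∈ xs → (f : A → ℚ) →
    (∀ b → b ≢ a → f b ≡ 0ℚ) → ∑ xs f ≡ f a
  ∑-delta {xs = x ∷ xs} (x∉ ∷ u) (here refl) f off = trans
    (cong (f x +_) (trans (∑-cong-∈ xs (λ y y∈ → off y (λ y≡x → All.lookup x∉ y∈ (sym y≡x)))) (∑-zero xs)))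
    (ℚ.+-identityʳ (f x))
  ∑-delta {xs = x ∷ xs} (x∉ ∷ u) {a} (there a∈) f off = trans
    (cong₂ _+_ (off x (All.lookup x∉ a∈)) (∑-delta u a∈ f off)) (ℚ.+-identityˡ (f a))

  ∑-pigeonhole : ∀ (xs : List A) (f : A → ℚ) c → ∑ xs (λ _ → c) < ∑ xs f → ∃ λ x → c ≤ f x
  ∑-pigeonhole []       f c lt = contradiction lt (ℚ.<-irrefl refl)
  ∑-pigeonhole (x ∷ xs) f c lt with c ℚ.≤? f x
  ... | yes c≤ = x , c≤
  ... | no  c≰ with ∑ xs (λ _ → c) ℚ.<? ∑ xs f
  ...   | yes lt' = ∑-pigeonhole xs f c lt'
  ...   | no  ≮   = contradiction (ℚ.<-≤-trans lt (ℚ.+-mono-≤ (ℚ.<⇒≤ (ℚ.≰⇒> c≰)) (ℚ.≮⇒≥ ≮)))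
                      (ℚ.<-irrefl refl)

open Sums

-- Kernels and their quadratic forms on signed measures.

module Kernels where
  open import Data.Rational using (_+_; _*_; _-_; -_; _≤_; _<_)

  private variable
    A : Set

  Kernel : Set → Set
  Kernel A = A → A → ℚ

  IsSymmetric : Kernel A → Set
  IsSymmetric K = ∀ x y → K x y ≡ K y x

  IsIdempotent : List A → Kernel A → Set
  IsIdempotent xs K = ∀ x z → ∑ xs (λ y → K x y * K y z) ≡ K x z

  trace : List A → Kernel A → ℚ
  trace xs K = ∑ xs (λ x → K x x)

  -- A finitely supported signed measure, as a list of weighted points.
  Measure : Set → Set
  Measure A = List (ℚ × A)

  ∫ : Measure A → (A → ℚ) → ℚ
  ∫ μ f = ∑ μ (λ a → proj₁ a * f (proj₂ a))

  quad : Kernel A → Measure A → ℚ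
  quad K μ = ∫ μ (λ x → ∫ μ (K x))

  ∫-cong : ∀ (μ : Measure A) {f g : A → ℚ} → (∀ x → f x ≡ g x) → ∫ μ f ≡ ∫ μ g
  ∫-cong μ eq = ∑-cong μ (λ a → cong (proj₁ a *_) (eq (proj₂ a)))

  ∫-+ : ∀ (μ : Measure A) (f g : A → ℚ) → ∫ μ (λ x → f x + g x) ≡ ∫ μ f + ∫ μ g
  ∫-+ μ f g = trans (∑-cong μ (λ a → ℚ.*-distribˡ-+ (proj₁ a) (f (proj₂ a)) (g (proj₂ a)))) (∑-+ μ _ _)

  ∫-*ˡ : ∀ (μ : Measure A) c (f : A → ℚ) → ∫ μ (λ x → c * f x) ≡ c * ∫ μ f
  ∫-*ˡ μ c f = trans (∑-cong μ (λ a → lemma (proj₁ a) c (f (proj₂ a)))) (∑-*ˡ μ c _)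
    where
    lemma : ∀ a c x → a * (c * x) ≡ c * (a * x)
    lemma = solve-∀ ℚ-ring

  ∫-*ʳ : ∀ (μ : Measure A) c (f : A → ℚ) → ∫ μ (λ x → f x * c) ≡ ∫ μ f * c
  ∫-*ʳ μ c f = trans (∫-cong μ (λ x → ℚ.*-comm (f x) c)) (trans (∫-*ˡ μ c f) (ℚ.*-comm c _))

  ∫-zero : ∀ (μ : Measure A) → ∫ μ (λ _ → 0ℚ) ≡ 0ℚ
  ∫-zero μ = trans (∑-cong μ (λ a → ℚ.*-zeroʳ (proj₁ a))) (∑-zero μ)

  ∫-∑ : ∀ {B : Set} (μ : Measure A) (ys : List B) (f : A → B → ℚ) →
    ∫ μ (λ x → ∑ ys (f x)) ≡ ∑ ys (λ y → ∫ μ (λ x → f x y))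
  ∫-∑ μ ys f = trans (∑-cong μ (λ a → sym (∑-*ˡ ys (proj₁ a) (f (proj₂ a))))) (∑-swap μ ys _)

  quad-cong : ∀ (μ : Measure A) {K H : Kernel A} → (∀ x y → K x y ≡ H x y) → quad K μ ≡ quad H μ
  quad-cong μ eq = ∫-cong μ (λ x → ∫-cong μ (eq x))

  quad-+ : ∀ (μ : Measure A) (K H : Kernel A) → quad (λ x y → K x y + H x y) μ ≡ quad K μ + quad H μ
  quad-+ μ K H = trans (∫-cong μ (λ x → ∫-+ μ (K x) (H x))) (∫-+ μ _ _)

  quad-*ˡ : ∀ (μ : Measure A) c (K : Kernel A) → quad (λ x y → c * K x y) μ ≡ c * quad K μ
  quad-*ˡ μ c K = trans (∫-cong μ (λ x → ∫-*ˡ μ c (K x))) (∫-*ˡ μ c _)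

  quad-∑ : ∀ {B : Set} (μ : Measure A) (bs : List B) (K : B → Kernel A) →
    quad (λ x y → ∑ bs (λ b → K b x y)) μ ≡ ∑ bs (λ b → quad (K b) μ)
  quad-∑ μ bs K = trans (∫-cong μ (λ x → ∫-∑ μ bs (λ y b → K b x y))) (∫-∑ μ bs _)

  quad-rank-one : ∀ (μ : Measure A) (f : A → ℚ) → quad (λ x y → f x * f y) μ ≡ ∫ μ f * ∫ μ f
  quad-rank-one μ f = trans (∫-cong μ (λ x → ∫-*ˡ μ (f x) f)) (∫-*ʳ μ (∫ μ f) f)

  -- A symmetric idempotent matrix equals `K Kᵀ`, so its form is a sum of squares, one for each row
  -- `K r`. This gives nonnegativity without eigenvalues.
  quad-projection : ∀ {xs : List A} {K} → IsSymmetric K → IsIdempotent xs K → ∀ μ →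
    quad K μ ≡ ∑ xs (λ r → ∫ μ (K r) * ∫ μ (K r))
  quad-projection {xs = xs} {K} K-sym idem μ = trans
    (quad-cong μ (λ x y → trans (sym (idem x y)) (∑-cong xs (λ r → cong (_* K r y) (K-sym x r)))))
    (trans (quad-∑ μ xs _) (∑-cong xs (λ r → quad-rank-one μ (K r))))

  0≤quad : ∀ {xs : List A} {K} → IsSymmetric K → IsIdempotent xs K → ∀ μ → 0ℚ ≤ quad K μ
  0≤quad {xs = xs} {K} K-sym idem μ = subst (0ℚ ≤_) (sym (quad-projection {xs = xs} K-sym idem μ))
    (0≤∑ xs (λ r → 0≤sq (∫ μ (K r))))

open Kernels

-- Cholesky elimination and the potential argument.

module Selections where
  open import Data.Rational using (_+_; _*_; _-_; -_; _≤_; _<_)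

  private variable
    A : Set

  module Pivot {xs : List A} {Γ : Kernel A} (Γ-sym : IsSymmetric Γ) (Γ-idem : IsIdempotent xs Γ)
    (p : A) (g : ℚ) (γg≡1 : Γ p p * g ≡ 1ℚ) where

    -- The Schur complement at `p`. As `Γ` is a projection, its column at `p` lies in its range and
    -- has squared norm `Γ p p`; hence `Γ'` is the projection onto the orthogonal complement of this
    -- column in the range, and its trace is smaller by exactly 1, however large the pivot is.
    Γ' : Kernel A
    Γ' x y = Γ x y - Γ x p * Γ p y * g

    split : ∀ x y → Γ x y ≡ Γ' x y + g * (Γ p x * Γ p y)
    split x y = trans (lemma (Γ x y) (Γ x p) (Γ p y) g)
        (cong (λ z → Γ' x y + g * (z * Γ p y)) (Γ-sym x p))
      where
      lemma : ∀ a b c g → a ≡ (a - b * c * g) + g * (b * c)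
      lemma = solve-∀ ℚ-ring

    Γ'-sym : IsSymmetric Γ'
    Γ'-sym x y = cong₂ (λ a b → a - b) (Γ-sym x y)
      (cong (_* g) (trans (cong₂ _*_ (Γ-sym x p) (Γ-sym p y)) (ℚ.*-comm (Γ p x) (Γ y p))))

    Γ'-idem : IsIdempotent xs Γ'
    Γ'-idem x z = begin
        ∑ xs (λ y → Γ' x y * Γ' y z)
          ≡⟨ ∑-cong xs (λ y → expand (Γ x y) (Γ x p) (Γ p y) (Γ y z) (Γ y p) (Γ p z) g) ⟩
        ∑ xs (λ y → Γ x y * Γ y z + (b * (Γ x y * Γ y p) + (c * (Γ p y * Γ y z) + e * (Γ p y * Γ y p))))
          ≡⟨ trans (∑-+ xs _ _) (cong₂ _+_ (Γ-idem x z) (trans (∑-+ xs _ _) (cong₂ _+_ (scaled x p b)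
               (trans (∑-+ xs _ _) (cong₂ _+_ (scaled p z c) (scaled p p e)))))) ⟩
        Γ x z + (b * Γ x p + (c * Γ p z + e * Γ p p))
          ≡⟨ collect (Γ x z) (Γ x p) (Γ p z) (Γ p p) g ⟩
        Γ x z - Γ x p * Γ p z * g - Γ x p * Γ p z * g * (1ℚ - Γ p p * g)
          ≡⟨ cong (λ t → Γ x z - Γ x p * Γ p z * g - Γ x p * Γ p z * g * (1ℚ - t)) γg≡1 ⟩
        Γ x z - Γ x p * Γ p z * g - Γ x p * Γ p z * g * (1ℚ - 1ℚ)
          ≡⟨ finish (Γ' x z) (Γ x p * Γ p z * g) ⟩
        Γ' x z ∎
      where
      open ≡-Reasoning
      b = - (Γ p z * g)
      c = - (Γ x p * g)
      e = Γ x p * g * (Γ p z * g)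
      scaled : ∀ u v t → ∑ xs (λ y → t * (Γ u y * Γ y v)) ≡ t * Γ u v
      scaled u v t = trans (∑-*ˡ xs t _) (cong (t *_) (Γ-idem u v))
      expand : ∀ xy xp py yz yp pz g → (xy - xp * py * g) * (yz - yp * pz * g) ≡
        xy * yz + (- (pz * g) * (xy * yp) + (- (xp * g) * (py * yz) + xp * g * (pz * g) * (py * yp)))
      expand = solve-∀ ℚ-ring
      collect : ∀ xz xp pz pp g → xz + (- (pz * g) * xp + (- (xp * g) * pz + xp * g * (pz * g) * pp)) ≡
        xz - xp * pz * g - xp * pz * g * (1ℚ - pp * g)
      collect = solve-∀ ℚ-ring
      finish : ∀ a b → a - b * (1ℚ - 1ℚ) ≡ a
      finish = solve-∀ ℚ-ring

    Γ'-trace : trace xs Γ ≡ trace xs Γ' + 1ℚ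
    Γ'-trace = begin
        ∑ xs (λ x → Γ x x)                            ≡⟨ ∑-cong xs (λ x → split x x) ⟩
        ∑ xs (λ x → Γ' x x + g * (Γ p x * Γ p x))     ≡⟨ ∑-+ xs _ _ ⟩
        trace xs Γ' + ∑ xs (λ x → g * (Γ p x * Γ p x)) ≡⟨ cong (trace xs Γ' +_) (∑-*ˡ xs g _) ⟩
        trace xs Γ' + g * ∑ xs (λ x → Γ p x * Γ p x)
          ≡⟨ cong (λ t → trace xs Γ' + g * t)
               (trans (∑-cong xs (λ x → cong (Γ p x *_) (Γ-sym p x))) (Γ-idem p p)) ⟩
        trace xs Γ' + g * Γ p p ≡⟨ cong (trace xs Γ' +_) (trans (ℚ.*-comm g (Γ p p)) γg≡1) ⟩
        trace xs Γ' + 1ℚ ∎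
      where open ≡-Reasoning

    -- Elimination clears the row of `p`. Hence a mass at `p` does not affect the form of `Γ'`, and
    -- later pivots, whose diagonal entries are positive, differ from `p`.
    Γ'-pivot : ∀ x → Γ' p x ≡ 0ℚ
    Γ'-pivot x = trans (lemma (Γ p p) (Γ p x) g) (trans (cong (λ t → Γ p x - t * Γ p x) γg≡1) (lemma' (Γ p x)))
      where
      lemma : ∀ pp px g → px - pp * px * g ≡ px - pp * g * px
      lemma = solve-∀ ℚ-ring
      lemma' : ∀ px → px - 1ℚ * px ≡ 0ℚ
      lemma' = solve-∀ ℚ-ring

    -- The Cholesky coordinate of `μ` at the pivot, scaled so that a unit mass at `p` counts 1: the
    -- sign given to `p` shifts it by exactly 1 or -1.
    coefficient : Measure A → ℚ
    coefficient μ = ∫ μ (Γ p) * g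

    quad-split : ∀ μ → quad Γ μ ≡ quad Γ' μ + Γ p p * (coefficient μ * coefficient μ)
    quad-split μ = begin
        quad Γ μ
          ≡⟨ trans (quad-cong μ split) (quad-+ μ Γ' _) ⟩
        quad Γ' μ + quad (λ x y → g * (Γ p x * Γ p y)) μ
          ≡⟨ cong (quad Γ' μ +_) (trans (quad-*ˡ μ g _) (cong (g *_) (quad-rank-one μ (Γ p)))) ⟩
        quad Γ' μ + g * (∫ μ (Γ p) * ∫ μ (Γ p))
          ≡⟨ cong (quad Γ' μ +_) (trans (sym (ℚ.*-identityˡ _)) (trans
               (cong (_* (g * (∫ μ (Γ p) * ∫ μ (Γ p)))) (sym γg≡1)) (regroup (Γ p p) g (∫ μ (Γ p))))) ⟩
        quad Γ' μ + Γ p p * (coefficient μ * coefficient μ) ∎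
      where
      open ≡-Reasoning
      regroup : ∀ c g i → c * g * (g * (i * i)) ≡ c * (i * g * (i * g))
      regroup = solve-∀ ℚ-ring

    quad-pivot : ∀ c μ → quad Γ' ((c , p) ∷ μ) ≡ quad Γ' μ
    quad-pivot c μ = begin
        c * (c * Γ' p p + ∫ μ (Γ' p)) + ∫ μ (λ x → c * Γ' x p + ∫ μ (Γ' x))
          ≡⟨ cong₂ (λ s t → c * (c * s + t) + ∫ μ (λ x → c * Γ' x p + ∫ μ (Γ' x))) (Γ'-pivot p)
               (trans (∫-cong μ Γ'-pivot) (∫-zero μ)) ⟩
        c * (c * 0ℚ + 0ℚ) + ∫ μ (λ x → c * Γ' x p + ∫ μ (Γ' x))
          ≡⟨ cong (c * (c * 0ℚ + 0ℚ) +_) (∫-cong μ (λ x →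
               cong (λ t → c * t + ∫ μ (Γ' x)) (trans (Γ'-sym x p) (Γ'-pivot x)))) ⟩
        c * (c * 0ℚ + 0ℚ) + ∫ μ (λ x → c * 0ℚ + ∫ μ (Γ' x))
          ≡⟨ cong₂ _+_ (lemma c) (∫-cong μ (λ x → lemma' c (∫ μ (Γ' x)))) ⟩
        0ℚ + quad Γ' μ
          ≡⟨ ℚ.+-identityˡ _ ⟩
        quad Γ' μ ∎
      where
      open ≡-Reasoning
      lemma : ∀ c → c * (c * 0ℚ + 0ℚ) ≡ 0ℚ
      lemma = solve-∀ ℚ-ring
      lemma' : ∀ c t → c * 0ℚ + t ≡ t
      lemma' = solve-∀ ℚ-ring

    coefficient-pivot : ∀ c μ → coefficient ((c , p) ∷ μ) ≡ c + coefficient μ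
    coefficient-pivot c μ = trans (lemma c (Γ p p) (∫ μ (Γ p)) g)
        (trans (cong (λ t → c * t + coefficient μ) γg≡1) (cong (_+ coefficient μ) (ℚ.*-identityʳ c)))
      where
      lemma : ∀ c s i g → (c * s + i) * g ≡ c * (s * g) + i * g
      lemma = solve-∀ ℚ-ring

  indicator : {P : Set} → Dec P → ℕ
  indicator P? = if does P? then 1 else 0

  -- This is `|u| < ½`. Outside this range a pivot of at least `4 β` contributes at least `β`, and
  -- two numbers at distance at least 1 cannot both be in it.
  near? : ∀ u → Dec (ι 4 * (u * u) < 1ℚ)
  near? u = ι 4 * (u * u) ℚ.<? 1ℚ

  -- By the parallelogram identity, `2 (u - v)² ≤ 4 u² + 4 v²`, where the left side is at least 2
  -- and the right side would be less than 2.
  near-exclusive : ∀ {u v} → 1ℚ ≤ (u - v) * (u - v) →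
    ι 4 * (u * u) < 1ℚ → ¬ (ι 4 * (v * v) < 1ℚ)
  near-exclusive {u} {v} far u< v< = ℚ.<-irrefl refl (begin-strict
      1ℚ + 1ℚ                                     ≤⟨ ℚ.+-mono-≤ far far ⟩
      (u - v) * (u - v) + (u - v) * (u - v)       ≤⟨ ≤-by _ (ℚ.+-mono-≤ (0≤sq (u + v)) (0≤sq (u + v))) (lemma u v) ⟩
      ι 4 * (u * u) + ι 4 * (v * v)               <⟨ ℚ.+-mono-< u< v< ⟩
      1ℚ + 1ℚ                                     ∎)
    where
    open ℚ.≤-Reasoning
    lemma : ∀ u v → (u - v) * (u - v) + (u - v) * (u - v) + ((u + v) * (u + v) + (u + v) * (u + v)) ≡
      ι 4 * (u * u) + ι 4 * (v * v)
    lemma = solve-∀ ℚ-ring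

  abstract
    near : ℚ → ℕ
    near u = indicator (near? u)

    near-bound : ∀ u {β γ} → 0ℚ ≤ β → ι 4 * β ≤ γ → β ≤ γ * (u * u) + β * ι (near u)
    near-bound u {β} {γ} 0≤β 4β≤γ = go (near? u)
      where
      open ℚ.≤-Reasoning
      swap : ∀ b t → b + t ≡ t + b * 1ℚ
      swap = solve-∀ ℚ-ring
      regroup : ∀ b c u → b * (c * u) ≡ c * b * u
      regroup = solve-∀ ℚ-ring
      pad : ∀ t b → t ≡ t + b * 0ℚ
      pad = solve-∀ ℚ-ring
      go : (near : Dec (ι 4 * (u * u) < 1ℚ)) → β ≤ γ * (u * u) + β * ι (indicator near)
      go (yes _) = ≤-by (γ * (u * u)) (0≤* (ℚ.≤-trans (0≤* (0≤ι 4) 0≤β) 4β≤γ) (0≤sq u)) (swap β (γ * (u * u)))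
      go (no ≮)  = begin
        β                         ≡⟨ sym (ℚ.*-identityʳ β) ⟩
        β * 1ℚ                    ≤⟨ *-monoˡ β 0≤β (ℚ.≮⇒≥ ≮) ⟩
        β * (ι 4 * (u * u))       ≡⟨ regroup β (ι 4) (u * u) ⟩
        ι 4 * β * (u * u)         ≤⟨ *-monoʳ (u * u) (0≤sq u) 4β≤γ ⟩
        γ * (u * u)               ≡⟨ pad (γ * (u * u)) β ⟩
        γ * (u * u) + β * 0ℚ      ∎

    -- At most one of u, u + 1, u - 1 lies in (-½, ½).
    near-sum : ∀ u → 8 ℕ.^ near u ℕ.+ (8 ℕ.^ near (1ℚ + u) ℕ.+ 8 ℕ.^ near (- 1ℚ + u)) ℕ.≤ 10
    near-sum u = go (near? u) (near? (1ℚ + u)) (near? (- 1ℚ + u))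
      where
      dist₁ : ∀ u → 1ℚ ≡ (u - (1ℚ + u)) * (u - (1ℚ + u))
      dist₁ = solve-∀ ℚ-ring
      dist₂ : ∀ u → 1ℚ ≡ (u - (- 1ℚ + u)) * (u - (- 1ℚ + u))
      dist₂ = solve-∀ ℚ-ring
      dist₃ : ∀ u → 1ℚ + ι 3 ≡ (1ℚ + u - (- 1ℚ + u)) * (1ℚ + u - (- 1ℚ + u))
      dist₃ = solve-∀ ℚ-ring
      go :
        (p? : Dec (ι 4 * (u * u) < 1ℚ)) → (q? : Dec (ι 4 * ((1ℚ + u) * (1ℚ + u)) < 1ℚ)) →
        (r? : Dec (ι 4 * ((- 1ℚ + u) * (- 1ℚ + u)) < 1ℚ)) →
        8 ℕ.^ indicator p? ℕ.+ (8 ℕ.^ indicator q? ℕ.+ 8 ℕ.^ indicator r?) ℕ.≤ 10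
      go (yes a) (yes b) _       = contradiction b (near-exclusive {u} {1ℚ + u} (ℚ.≤-reflexive (dist₁ u)) a)
      go (yes a) (no _)  (yes c) = contradiction c (near-exclusive {u} { - 1ℚ + u} (ℚ.≤-reflexive (dist₂ u)) a)
      go (no _)  (yes b) (yes c) = contradiction c (near-exclusive {1ℚ + u} { - 1ℚ + u} (≤-by (ι 3) (0≤ι 3) (dist₃ u)) b)
      go (yes _) (no _)  (no _)  = ℕ.≤-refl
      go (no _)  (yes _) (no _)  = ℕ.≤-refl
      go (no _)  (no _)  (yes _) = ℕ.≤-refl
      go (no _)  (no _)  (no _)  = ℕ.m≤m+n 3 7

  sumSigns : ∀ n → (Vec Sign n → ℕ) → ℕ
  sumSigns zero    f = f []
  sumSigns (suc n) f = sumSigns n (λ χ → f (Sign.+ ∷ χ)) ℕ.+ sumSigns n (λ χ → f (Sign.- ∷ χ))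

  sumSigns-mono : ∀ n {f g : Vec Sign n → ℕ} → (∀ χ → f χ ℕ.≤ g χ) → sumSigns n f ℕ.≤ sumSigns n g
  sumSigns-mono zero    f≤g = f≤g []
  sumSigns-mono (suc n) f≤g = ℕ.+-mono-≤ (sumSigns-mono n (λ χ → f≤g (Sign.+ ∷ χ)))
    (sumSigns-mono n (λ χ → f≤g (Sign.- ∷ χ)))

  sumSigns-+ : ∀ n (f g : Vec Sign n → ℕ) → sumSigns n (λ χ → f χ ℕ.+ g χ) ≡ sumSigns n f ℕ.+ sumSigns n g
  sumSigns-+ zero    f g = refl
  sumSigns-+ (suc n) f g = trans (cong₂ ℕ._+_ (sumSigns-+ n _ _) (sumSigns-+ n _ _))
    (ℕ-interchange (sumSigns n _) (sumSigns n _) (sumSigns n _) (sumSigns n _))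
    where
    ℕ-interchange : ∀ a b c d → (a ℕ.+ b) ℕ.+ (c ℕ.+ d) ≡ (a ℕ.+ c) ℕ.+ (b ℕ.+ d)
    ℕ-interchange = ℕ-solve-∀

  sumSigns-* : ∀ n c (f : Vec Sign n → ℕ) → sumSigns n (λ χ → c ℕ.* f χ) ≡ c ℕ.* sumSigns n f
  sumSigns-* zero    c f = refl
  sumSigns-* (suc n) c f = trans (cong₂ ℕ._+_ (sumSigns-* n c _) (sumSigns-* n c _))
    (sym (ℕ.*-distribˡ-+ c (sumSigns n _) (sumSigns n _)))

  term≤sumSigns : ∀ n (f : Vec Sign n → ℕ) χ → f χ ℕ.≤ sumSigns n f
  term≤sumSigns zero    f []             = ℕ.≤-refl
  term≤sumSigns (suc n) f (Sign.+ ∷ χ) = ℕ.≤-trans (term≤sumSigns n (λ χ → f (Sign.+ ∷ χ)) χ) (ℕ.m≤m+n _ _)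
  term≤sumSigns (suc n) f (Sign.- ∷ χ) = ℕ.≤-trans (term≤sumSigns n (λ χ → f (Sign.- ∷ χ)) χ) (ℕ.m≤n+m _ _)

  one-small : ∀ {a b} c d → a ℕ.+ b ℕ.≤ c ℕ.+ d → a ℕ.≤ c ⊎ b ℕ.≤ d
  one-small {a} c d le with a ℕ.≤? c
  ... | yes a≤c = inj₁ a≤c
  ... | no  a≰c = inj₂ (ℕ.+-cancelˡ-≤ c _ _ (ℕ.≤-trans (ℕ.+-monoˡ-≤ _ (ℕ.<⇒≤ (ℕ.≰⇒> a≰c))) le))

  sign : Sign → ℚ
  sign Sign.+ = 1ℚ
  sign Sign.- = - 1ℚ

  signed : ∀ {n} → Vec A n → Vec Sign n → Measure A
  signed []       []      = []
  signed (p ∷ ps) (σ ∷ χ) = (sign σ , p) ∷ signed ps χ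

  -- `M` counts the pivots, of which `size` are kept as points. A pivot that is left out still
  -- contributes to the form through its coefficient, hence `M` and not `size` in `bound`. The
  -- function `score` is built to count the pivots whose coefficient is near 0, and `positive` keeps
  -- an earlier pivot from being selected again.
  record Selection (Γ : Kernel A) (β : ℚ) (M : ℕ) : Set where
    field
      {size}   : ℕ
      points   : Vec A size
      size≤    : size ℕ.≤ M
      positive : ∀ i → 0ℚ < Γ (lookup points i) (lookup points i)
      injective : ∀ i j → lookup points i ≡ lookup points j → i ≡ j
      score    : Vec Sign size → ℕ
      total    : sumSigns size (λ χ → 8 ℕ.^ score χ) ℕ.≤ 5 ℕ.^ M
      bound    : ∀ χ → ι M * β ≤ quad Γ (signed points χ) + β * ι (score χ)

  -- Cholesky pivoting: a coefficient u of the pivot p contributes at least β to the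
  -- quadratic form unless it is near 0. Given the signs of the later points, at most one of
  -- the choices 0, 1, -1 for the sign of p makes u near 0; hence leaving p out or taking it
  -- multiplies the potential ∑ 8 ^ score by at most 10 in total, by at most 5 in the better case.
  select : ∀ M {xs : List A} {Γ : Kernel A} → IsSymmetric Γ → IsIdempotent xs Γ → ∀ {β} → 0ℚ < β →
    ∑ xs (λ _ → ι 4 * β) + ι M ≤ trace xs Γ → Selection Γ β M
  select zero {Γ = Γ} Γ-sym Γ-idem {β} 0<β _ = record
    { points = [] ; size≤ = ℕ.z≤n ; positive = λ () ; injective = λ () ; score = λ _ → 0
    ; total = ℕ.≤-refl ; bound = λ { [] → ℚ.≤-reflexive (lemma β) } }
    where
    lemma : ∀ β → 0ℚ * β ≡ 0ℚ + β * 0ℚ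
    lemma = solve-∀ ℚ-ring
  select {A = A} (suc M) {xs} {Γ} Γ-sym Γ-idem {β} 0<β large = choose (one-small _ _ both)
    where
    -- The summand `ι (suc M)` of the hypothesis pays for the eliminations, each of which lowers the
    -- trace by 1. What remains keeps the average diagonal entry above `4 β`.
    tr-bound : ∑ xs (λ _ → ι 4 * β) + ι M + 1ℚ ≤ trace xs Γ
    tr-bound = ℚ.≤-trans (ℚ.≤-reflexive (trans (lemma (∑ xs (λ _ → ι 4 * β)) (ι M)) (cong (∑ xs (λ _ → ι 4 * β) +_) (sym (ι-suc M))))) large
      where
      lemma : ∀ a m → a + m + 1ℚ ≡ a + (1ℚ + m)
      lemma = solve-∀ ℚ-ring
    pivot : ∃ λ p → ι 4 * β ≤ Γ p p
    pivot = ∑-pigeonhole xs (λ x → Γ x x) (ι 4 * β) (ℚ.<-≤-trans (ℚ.≤-<-trans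
      (≤-by (ι M) (0≤ι M) refl)
      (subst (_< ∑ xs (λ _ → ι 4 * β) + ι M + 1ℚ) (ℚ.+-identityʳ c) (ℚ.+-monoʳ-< c 0<1))) tr-bound)
      where c = ∑ xs (λ _ → ι 4 * β) + ι M
    p = proj₁ pivot
    4β≤γ : ι 4 * β ≤ Γ p p
    4β≤γ = proj₂ pivot
    0<γ : 0ℚ < Γ p p
    0<γ = ℚ.<-≤-trans (0<* (ι-mono-< {0} {4} ℕ.z<s) 0<β) 4β≤γ
    g = proj₁ (inverse (Γ p p) 0<γ)
    0<g = proj₁ (proj₂ (inverse (Γ p p) 0<γ))
    open Pivot {xs = xs} Γ-sym Γ-idem p g (proj₂ (proj₂ (inverse (Γ p p) 0<γ)))
    0≤β = ℚ.<⇒≤ 0<β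

    rest : Selection Γ' β M
    rest = select M {xs} Γ'-sym Γ'-idem 0<β (+-cancelʳ-≤ 1ℚ (ℚ.≤-trans tr-bound (ℚ.≤-reflexive Γ'-trace)))
    open Selection rest

    u : Vec Sign size → ℚ
    u χ = coefficient (signed points χ)

    positive' : ∀ x → 0ℚ < Γ' x x → 0ℚ < Γ x x
    positive' x 0<Γ' = ℚ.<-≤-trans 0<Γ' (≤-by (g * (Γ p x * Γ p x)) (0≤* (ℚ.<⇒≤ 0<g) (0≤sq (Γ p x))) (sym (split x x)))

    bound' : ∀ χ μ v → quad Γ' μ ≡ quad Γ' (signed points χ) → coefficient μ ≡ v →
      ι (suc M) * β ≤ quad Γ μ + β * ι (score χ ℕ.+ near v)
    bound' χ μ v Γ'≡ refl = begin
        ι (suc M) * β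
          ≡⟨ trans (cong (_* β) (ι-suc M)) (lemma (ι M) β) ⟩
        ι M * β + β
          ≤⟨ ℚ.+-mono-≤ (bound χ) (near-bound v 0≤β 4β≤γ) ⟩
        (quad Γ' (signed points χ) + β * ι (score χ)) + (Γ p p * (v * v) + β * ι (near v))
          ≡⟨ lemma' (quad Γ' (signed points χ)) β (ι (score χ)) (Γ p p * (v * v)) (ι (near v)) ⟩
        quad Γ' (signed points χ) + Γ p p * (v * v) + β * (ι (score χ) + ι (near v))
          ≡⟨ cong₂ (λ a b → a + β * b) (trans (cong (_+ Γ p p * (v * v)) (sym Γ'≡)) (sym (quad-split μ)))
               (sym (ι-+ (score χ) (near v))) ⟩
        quad Γ μ + β * ι (score χ ℕ.+ near v) ∎
      where
      open ℚ.≤-Reasoning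
      lemma : ∀ m β → (1ℚ + m) * β ≡ m * β + β
      lemma = solve-∀ ℚ-ring
      lemma' : ∀ q β s c n → (q + β * s) + (c + β * n) ≡ q + c + β * (s + n)
      lemma' = solve-∀ ℚ-ring

    outScore : Vec Sign size → ℕ
    outScore χ = score χ ℕ.+ near (u χ)

    inScore : Vec Sign (suc size) → ℕ
    inScore (σ ∷ χ) = score χ ℕ.+ near (sign σ + u χ)

    outTotal = sumSigns size (λ χ → 8 ℕ.^ outScore χ)
    inTotal  = sumSigns (suc size) (λ χ → 8 ℕ.^ inScore χ)

    both : outTotal ℕ.+ inTotal ℕ.≤ 5 ℕ.* 5 ℕ.^ M ℕ.+ 5 ℕ.* 5 ℕ.^ M
    both = begin
        outTotal ℕ.+ inTotal
          ≡⟨ trans (cong (outTotal ℕ.+_) (sym (sumSigns-+ size _ _))) (sym (sumSigns-+ size _ _)) ⟩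
        sumSigns size (λ χ → 8 ℕ.^ outScore χ ℕ.+ (8 ℕ.^ inScore (Sign.+ ∷ χ) ℕ.+ 8 ℕ.^ inScore (Sign.- ∷ χ)))
          ≤⟨ sumSigns-mono size step ⟩
        sumSigns size (λ χ → 10 ℕ.* 8 ℕ.^ score χ)
          ≡⟨ sumSigns-* size 10 _ ⟩
        10 ℕ.* sumSigns size (λ χ → 8 ℕ.^ score χ)
          ≤⟨ ℕ.*-monoʳ-≤ 10 total ⟩
        10 ℕ.* 5 ℕ.^ M
          ≡⟨ lemma (5 ℕ.^ M) ⟩
        5 ℕ.* 5 ℕ.^ M ℕ.+ 5 ℕ.* 5 ℕ.^ M ∎
      where
      open ℕ.≤-Reasoning
      lemma : ∀ t → 10 ℕ.* t ≡ 5 ℕ.* t ℕ.+ 5 ℕ.* t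
      lemma = ℕ-solve-∀
      factor : ∀ s a b c → s ℕ.* a ℕ.+ (s ℕ.* b ℕ.+ s ℕ.* c) ≡ (a ℕ.+ (b ℕ.+ c)) ℕ.* s
      factor = ℕ-solve-∀
      step : ∀ χ → 8 ℕ.^ outScore χ ℕ.+ (8 ℕ.^ inScore (Sign.+ ∷ χ) ℕ.+ 8 ℕ.^ inScore (Sign.- ∷ χ))
        ℕ.≤ 10 ℕ.* 8 ℕ.^ score χ
      step χ = begin
        8 ℕ.^ outScore χ ℕ.+ (8 ℕ.^ inScore (Sign.+ ∷ χ) ℕ.+ 8 ℕ.^ inScore (Sign.- ∷ χ))
          ≡⟨ cong₂ ℕ._+_ (ℕ.^-distribˡ-+-* 8 (score χ) _)
               (cong₂ ℕ._+_ (ℕ.^-distribˡ-+-* 8 (score χ) _) (ℕ.^-distribˡ-+-* 8 (score χ) _)) ⟩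
        8 ℕ.^ score χ ℕ.* 8 ℕ.^ near (u χ) ℕ.+
          (8 ℕ.^ score χ ℕ.* 8 ℕ.^ near (1ℚ + u χ) ℕ.+ 8 ℕ.^ score χ ℕ.* 8 ℕ.^ near (- 1ℚ + u χ))
          ≡⟨ factor (8 ℕ.^ score χ) _ _ _ ⟩
        (8 ℕ.^ near (u χ) ℕ.+ (8 ℕ.^ near (1ℚ + u χ) ℕ.+ 8 ℕ.^ near (- 1ℚ + u χ))) ℕ.* 8 ℕ.^ score χ
          ≤⟨ ℕ.*-monoˡ-≤ (8 ℕ.^ score χ) (near-sum (u χ)) ⟩
        10 ℕ.* 8 ℕ.^ score χ ∎

    p-new : ∀ i → lookup points i ≢ p
    p-new i eq = ℚ.<-irrefl (sym (Γ'-pivot p)) (subst (λ x → 0ℚ < Γ' x x) eq (positive i))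

    injective' : ∀ i j → lookup (p ∷ points) i ≡ lookup (p ∷ points) j → i ≡ j
    injective' zero    zero    eq = refl
    injective' zero    (suc j) eq = contradiction (sym eq) (p-new j)
    injective' (suc i) zero    eq = contradiction eq (p-new i)
    injective' (suc i) (suc j) eq = cong suc (injective i j eq)

    choose : outTotal ℕ.≤ 5 ℕ.* 5 ℕ.^ M ⊎ inTotal ℕ.≤ 5 ℕ.* 5 ℕ.^ M → Selection Γ β (suc M)
    choose (inj₁ out≤) = record
      { points = points ; size≤ = ℕ.m≤n⇒m≤1+n size≤
      ; positive = λ i → positive' _ (positive i) ; injective = injective
      ; score = outScore ; total = out≤
      ; bound = λ χ → bound' χ (signed points χ) (u χ) refl refl }
    choose (inj₂ in≤) = record
      { points = p ∷ points ; size≤ = ℕ.s≤s size≤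
      ; positive = λ { zero → 0<γ ; (suc i) → positive' _ (positive i) }
      ; injective = injective'
      ; score = inScore ; total = in≤
      ; bound = λ { (σ ∷ χ) → bound' χ ((sign σ , p) ∷ signed points χ) (sign σ + u χ)
          (quad-pivot (sign σ) (signed points χ)) (coefficient-pivot (sign σ) (signed points χ)) } }

open Selections

-- Bessel's inequality and tensor products of orthogonal projections.

module Tensors where
  open import Data.Rational using (_+_; _*_; _-_; -_; _≤_; _<_)

  private variable
    A B C : Set

  tuples : List A → ∀ n → List (Vec A n)
  tuples xs zero    = [] ∷ []
  tuples xs (suc n) = cartesianProductWith _∷_ xs (tuples xs n)

  length-tuples : ∀ (xs : List A) n → length (tuples xs n) ≡ length xs ℕ.^ n
  length-tuples xs zero    = refl
  length-tuples xs (suc n) = trans (go xs) (cong (length xs ℕ.*_) (length-tuples xs n))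
    where
    go : ∀ ys → length (cartesianProductWith _∷_ ys (tuples xs n)) ≡ length ys ℕ.* length (tuples xs n)
    go []       = refl
    go (y ∷ ys) = trans (length-++ (map (y ∷_) (tuples xs n)))
      (cong₂ ℕ._+_ (length-map (y ∷_) (tuples xs n)) (go ys))

  ∑-tuples : ∀ (xs : List A) n (f : Vec A (suc n) → ℚ) →
    ∑ (tuples xs (suc n)) f ≡ ∑ xs (λ x → ∑ (tuples xs n) (λ v → f (x ∷ v)))
  ∑-tuples xs n f = ∑-cartesianProductWith _∷_ xs (tuples xs n) f

  ∑-tuples₁ : ∀ (xs : List A) (f : Vec A 1 → ℚ) → ∑ (tuples xs 1) f ≡ ∑ xs (λ x → f (x ∷ []))
  ∑-tuples₁ xs f = trans (∑-tuples xs 0 f) (∑-cong xs (λ x → ℚ.+-identityʳ (f (x ∷ []))))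

  ∑-swap₂ : ∀ (xs : List A) (ys : List B) (zs : List C) (f : A → B → C → ℚ) →
    ∑ xs (λ x → ∑ ys (λ y → ∑ zs (f x y))) ≡ ∑ zs (λ z → ∑ xs (λ x → ∑ ys (λ y → f x y z)))
  ∑-swap₂ xs ys zs f = trans (∑-cong xs (λ x → ∑-swap ys zs (f x))) (∑-swap xs zs _)

  -- The sum of `(f - E f)²` is nonnegative, and in its expansion the inner product of `f` and `E f`
  -- equals the squared norm of `E f`.
  bessel : ∀ {xs : List A} {E : Kernel A} → IsSymmetric E → IsIdempotent xs E → (f : A → ℚ) →
    ∑ xs (λ x → ∑ xs (λ y → f x * f y * E x y)) ≤ ∑ xs (λ x → f x * f x)
  bessel {A = A} {xs = xs} {E} E-sym E-idem f = begin
      ∑ xs (λ x → ∑ xs (λ y → f x * f y * E x y))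
        ≡⟨ ∑-cong xs (λ x → trans (∑-cong xs (λ y → ℚ.*-assoc (f x) (f y) (E x y))) (∑-*ˡ xs (f x) _)) ⟩
      ∑ xs (λ x → f x * Ef x)
        ≡⟨ sym (ℚ.+-identityʳ q) ⟩
      q + 0ℚ
        ≤⟨ ℚ.+-monoʳ-≤ q (0≤∑ xs (λ x → 0≤sq (f x - Ef x))) ⟩
      q + ∑ xs (λ x → (f x - Ef x) * (f x - Ef x))
        ≡⟨ cong (q +_) (trans (∑-cong xs (λ x → expand (f x) (Ef x))) (trans (∑-+ xs (λ x → f x * f x) _)
             (cong (∑ xs (λ x → f x * f x) +_) (trans (∑-+ xs _ _)
               (cong₂ _+_ (∑-*ˡ xs (- (1ℚ + 1ℚ)) (λ x → f x * Ef x)) (sym energy)))))) ⟩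
      q + (∑ xs (λ x → f x * f x) + (- (1ℚ + 1ℚ) * q + q))
        ≡⟨ cancel q (∑ xs (λ x → f x * f x)) ⟩
      ∑ xs (λ x → f x * f x) ∎
    where
    open ℚ.≤-Reasoning
    Ef : A → ℚ
    Ef x = ∑ xs (λ y → f y * E x y)
    q = ∑ xs (λ x → f x * Ef x)
    μ : Measure A
    μ = map (λ x → f x , x) xs
    ∫-μ : ∀ h → ∫ μ h ≡ ∑ xs (λ y → f y * h y)
    ∫-μ h = ∑-map xs (λ x → f x , x) (λ a → proj₁ a * h (proj₂ a))
    energy : q ≡ ∑ xs (λ x → Ef x * Ef x)
    energy = trans (sym (trans (∑-map xs _ _) (∑-cong xs (λ x → cong (f x *_) (∑-map xs _ _)))))
      (trans (quad-projection {xs = xs} E-sym E-idem μ) (∑-cong xs (λ r → cong (λ t → t * t) (∫-μ (E r)))))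
    expand : ∀ a b → (a - b) * (a - b) ≡ a * a + (- (1ℚ + 1ℚ) * (a * b) + b * b)
    expand = solve-∀ ℚ-ring
    cancel : ∀ q s → q + (s + (- (1ℚ + 1ℚ) * q + q)) ≡ s
    cancel = solve-∀ ℚ-ring

  -- The matrix product t K tᵀ.
  pullback : List A → (B → A → ℚ) → Kernel A → Kernel B
  pullback xs t K p q = ∑ xs (λ x → ∑ xs (λ y → t p x * t q y * K x y))

  quad-pullback : ∀ (xs : List A) (t : B → A → ℚ) (K : Kernel A) (μ : Measure B) →
    quad (pullback xs t K) μ ≡
      ∑ xs (λ x → ∑ xs (λ y → ∫ μ (λ p → t p x) * ∫ μ (λ p → t p y) * K x y))
  quad-pullback xs t K μ = trans (quad-∑ μ xs _) (∑-cong xs (λ x → trans (quad-∑ μ xs _) (∑-cong xs (λ y →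
    trans (∫-cong μ (λ p → trans (∫-*ʳ μ (K x y) _) (cong (_* K x y) (∫-*ˡ μ (t p x) _))))
      (trans (∫-*ʳ μ (K x y) _) (cong (_* K x y) (∫-*ʳ μ (∫ μ (λ q → t q y)) _)))))))

  slice : (A → ℚ) → ∀ {n} → Measure (Vec A (suc n)) → Measure (Vec A n)
  slice f = map (λ a → proj₁ a * f (head (proj₂ a)) , tail (proj₂ a))

  ∫-slice : ∀ (f : A → ℚ) {n} (μ : Measure (Vec A (suc n))) g →
    ∫ (slice f μ) g ≡ ∫ μ (λ p → f (head p) * g (tail p))
  ∫-slice f μ g = trans (∑-map μ _ _) (∑-cong μ (λ a → ℚ.*-assoc (proj₁ a) _ _))

  -- Writing only the first factor as `K x y = ∑ K r x * K r y` reduces the form to those of `H` on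
  -- the contractions of `μ` with the rows of `K`. Any inequality between forms in the remaining
  -- coordinates can thus be lifted by one coordinate.
  quad-tensor : ∀ {xs : List A} {K : Kernel A} → IsSymmetric K → IsIdempotent xs K →
    ∀ {n} (H : Kernel (Vec A n)) μ →
    quad (λ p q → K (head p) (head q) * H (tail p) (tail q)) μ ≡ ∑ xs (λ r → quad H (slice (K r) μ))
  quad-tensor {xs = xs} {K} K-sym K-idem H μ = begin
      quad (λ p q → K (head p) (head q) * H (tail p) (tail q)) μ
        ≡⟨ quad-cong μ (λ p q → trans (cong (_* H (tail p) (tail q)) (sym (K-idem (head p) (head q))))
             (trans (sym (∑-*ʳ xs _ _)) (∑-cong xs (λ r →
               trans (cong (λ c → c * K r (head q) * H (tail p) (tail q)) (K-sym (head p) r))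
                 (ℚ.*-assoc (K r (head p)) (K r (head q)) _))))) ⟩
      quad (λ p q → ∑ xs (λ r → K r (head p) * (K r (head q) * H (tail p) (tail q)))) μ
        ≡⟨ quad-∑ μ xs _ ⟩
      ∑ xs (λ r → quad (λ p q → K r (head p) * (K r (head q) * H (tail p) (tail q))) μ)
        ≡⟨ ∑-cong xs (λ r → sym (trans (∫-slice (K r) μ _) (∫-cong μ (λ p →
             trans (cong (K r (head p) *_) (∫-slice (K r) μ _)) (sym (∫-*ˡ μ (K r (head p)) _)))))) ⟩
      ∑ xs (λ r → quad H (slice (K r) μ)) ∎
    where open ≡-Reasoning

  record IsOrthogonalFamily (xs : List A) (K : ℕ → Kernel A) : Set where
    field
      symmetric  : ∀ b → IsSymmetric (K b)
      idempotent : ∀ b → IsIdempotent xs (K b)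
      orthogonal : ∀ {a b} → a ≢ b → ∀ x z → ∑ xs (λ y → K a x y * K b y z) ≡ 0ℚ

  -- This preserves the invariant `e * k ≤ n` when an entry `b < k` is taken from `n` and one fewer
  -- entry remains; under it the truncated subtractions in `tensor` are exact.
  levels : ∀ {b k m n} → b ℕ.< k → k ℕ.+ m ℕ.≤ n → m ℕ.≤ n ℕ.∸ b
  levels {b} {k} {m} {n} b<k k+m≤n = ℕ.≤-trans (ℕ.≤-reflexive (sym (ℕ.m+n∸m≡n b m)))
    (ℕ.∸-monoˡ-≤ b (ℕ.≤-trans (ℕ.+-monoˡ-≤ m (ℕ.<⇒≤ b<k)) k+m≤n))

  product-matrix : (A → A → ℚ) → ∀ {n} → Vec A n → Vec A n → ℚ
  product-matrix t []      []      = 1ℚ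
  product-matrix t (p ∷ v) (x ∷ w) = t p x * product-matrix t v w

  0≤^ℚ : ∀ {q} → 0ℚ ≤ q → ∀ n → 0ℚ ≤ q ^ℚ n
  0≤^ℚ 0≤q zero    = ℚ.<⇒≤ 0<1
  0≤^ℚ 0≤q (suc n) = 0≤* 0≤q (0≤^ℚ 0≤q n)

  module _ (k : ℕ) where

    -- The sum of K b₁ ⊗ ⋯ ⊗ K bₑ ⊗ K (n - b₁ - ⋯ - bₑ) over all b₁, …, bₑ < k.
    tensor : (ℕ → Kernel A) → ∀ e → ℕ → Kernel (Vec A (suc e))
    tensor K zero    n p q = K n (head p) (head q)
    tensor K (suc e) n p q = ∑ (upTo k) (λ b → K b (head p) (head q) * tensor K e (n ℕ.∸ b) (tail p) (tail q))

    module _ {xs : List A} {K : ℕ → Kernel A} (orth : IsOrthogonalFamily xs K) where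
      open IsOrthogonalFamily orth

      tensor-symmetric : ∀ e n → IsSymmetric (tensor K e n)
      tensor-symmetric zero    n p q = symmetric n (head p) (head q)
      tensor-symmetric (suc e) n p q = ∑-cong (upTo k) (λ b →
        cong₂ _*_ (symmetric b (head p) (head q)) (tensor-symmetric e (n ℕ.∸ b) (tail p) (tail q)))

      -- Distinct tuples differ in one of the entries below `k`, since these determine the last one.
      -- Orthogonality in a coordinate where they differ removes the mixed products, and what is
      -- left are squares of projections.
      tensor-idempotent : ∀ e n → IsIdempotent (tuples xs (suc e)) (tensor K e n)
      tensor-idempotent zero    n p q = trans (∑-tuples₁ xs _) (idempotent n (head p) (head q))
      tensor-idempotent (suc e) n p q = begin
          ∑ (tuples xs (suc (suc e))) (λ r → tensor K (suc e) n p r * tensor K (suc e) n r q)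
            ≡⟨ ∑-tuples xs (suc e) _ ⟩
          ∑ xs (λ y → ∑ vs (λ w → ∑ bs (λ a → K a x y * H a v w) * ∑ bs (λ b → K b y z * H b w u)))
            ≡⟨ ∑-cong xs (λ y → ∑-cong vs (λ w → trans (sym (∑-×-∑ bs bs _ _))
                 (∑-cong bs (λ a → ∑-cong bs (λ b → regroup (K a x y) (H a v w) (K b y z) (H b w u)))))) ⟩
          ∑ xs (λ y → ∑ vs (λ w → ∑ bs (λ a → ∑ bs (λ b → K a x y * K b y z * (H a v w * H b w u)))))
            ≡⟨ trans (∑-swap₂ xs vs bs _) (∑-cong bs (λ a → trans (∑-swap₂ xs vs bs _)
                 (∑-cong bs (λ b → ∑-×-∑ xs vs _ _)))) ⟩
          ∑ bs (λ a → ∑ bs (λ b → ∑ xs (λ y → K a x y * K b y z) * ∑ vs (λ w → H a v w * H b w u)))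
            ≡⟨ ∑-cong-∈ bs (λ a a∈ → ∑-delta (upTo⁺ k) a∈ _ (λ b b≢a →
                 trans (cong (_* ∑ vs (λ w → H a v w * H b w u)) (orthogonal (λ a≡b → b≢a (sym a≡b)) x z))
                   (ℚ.*-zeroˡ (∑ vs (λ w → H a v w * H b w u))))) ⟩
          ∑ bs (λ a → ∑ xs (λ y → K a x y * K a y z) * ∑ vs (λ w → H a v w * H a w u))
            ≡⟨ ∑-cong bs (λ a → cong₂ _*_ (idempotent a x z) (tensor-idempotent e (n ℕ.∸ a) v u)) ⟩
          tensor K (suc e) n p q ∎
        where
        open ≡-Reasoning
        bs = upTo k
        vs = tuples xs (suc e)
        x = head p ; v = tail p ; z = head q ; u = tail q
        H : ℕ → Kernel (Vec A (suc e))
        H b = tensor K e (n ℕ.∸ b)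
        regroup : ∀ a b c d → (a * b) * (c * d) ≡ a * c * (b * d)
        regroup = solve-∀ ℚ-ring

    -- Traces multiply, so a tuple with sum `n` contributes `4 ^ n`, and there are `k ^ e` tuples.
    -- The bounds on `n` make the subtractions exact and keep every level below `L`.
    trace-tensor : ∀ {xs : List A} {K : ℕ → Kernel A} {L} → (∀ {b} → b ℕ.< L → trace xs (K b) ≡ ι (4 ℕ.^ b)) →
      ∀ e {n} → e ℕ.* k ℕ.≤ n → n ℕ.< L → trace (tuples xs (suc e)) (tensor K e n) ≡ ι (k ℕ.^ e ℕ.* 4 ℕ.^ n)
    trace-tensor {xs = xs} tr zero {n} _ n<L = trans (∑-tuples₁ xs _) (trans (tr n<L) (cong ι (sym (ℕ.*-identityˡ (4 ℕ.^ n)))))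
    trace-tensor {xs = xs} {K} {L} tr (suc e) {n} ek≤n n<L = begin
        ∑ (tuples xs (suc (suc e))) (λ r → tensor K (suc e) n r r)
          ≡⟨ ∑-tuples xs (suc e) _ ⟩
        ∑ xs (λ y → ∑ vs (λ w → ∑ bs (λ b → K b y y * tensor K e (n ℕ.∸ b) w w)))
          ≡⟨ trans (∑-swap₂ xs vs bs _) (∑-cong bs (λ b → ∑-×-∑ xs vs _ _)) ⟩
        ∑ bs (λ b → trace xs (K b) * trace vs (tensor K e (n ℕ.∸ b)))
          ≡⟨ ∑-cong-∈ bs (λ b b∈ → term (∈-upTo⁻ b∈)) ⟩
        ∑ bs (λ _ → ι (k ℕ.^ e ℕ.* 4 ℕ.^ n))
          ≡⟨ trans (∑-const bs _) (trans (cong (λ l → ι l * ι (k ℕ.^ e ℕ.* 4 ℕ.^ n)) (length-upTo k)) (sym (ι-* k _))) ⟩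
        ι (k ℕ.* (k ℕ.^ e ℕ.* 4 ℕ.^ n))
          ≡⟨ cong ι (sym (ℕ.*-assoc k (k ℕ.^ e) (4 ℕ.^ n))) ⟩
        ι (k ℕ.^ suc e ℕ.* 4 ℕ.^ n) ∎
      where
      open ≡-Reasoning
      bs = upTo k
      vs = tuples xs (suc e)
      term : ∀ {b} → b ℕ.< k → trace xs (K b) * trace vs (tensor K e (n ℕ.∸ b)) ≡ ι (k ℕ.^ e ℕ.* 4 ℕ.^ n)
      term {b} b<k = trans
        (cong₂ _*_ (tr (ℕ.≤-<-trans b≤n n<L))
          (trace-tensor {xs = xs} tr e (levels b<k ek≤n) (ℕ.≤-<-trans (ℕ.m∸n≤m n b) n<L)))
        (trans (sym (ι-* (4 ℕ.^ b) _)) (cong ι (trans (regroup (4 ℕ.^ b) (k ℕ.^ e) _)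
          (cong (k ℕ.^ e ℕ.*_) (trans (sym (ℕ.^-distribˡ-+-* 4 b (n ℕ.∸ b))) (cong (4 ℕ.^_) (ℕ.m+[n∸m]≡n b≤n)))))))
        where
        b≤n = ℕ.≤-trans (ℕ.<⇒≤ b<k) (ℕ.≤-trans (ℕ.m≤m+n k (e ℕ.* k)) ek≤n)
        regroup : ∀ a b c → a ℕ.* (b ℕ.* c) ≡ b ℕ.* (a ℕ.* c)
        regroup = ℕ-solve-∀

    pullback-tensor : ∀ {xs : List A} {t : A → A → ℚ} {E K : ℕ → Kernel A} {κ : ℕ → ℚ} →
      (∀ b p q → pullback xs t (E b) p q ≡ κ b * K b p q) → ∀ e n p q →
      pullback (tuples xs (suc e)) (product-matrix t) (tensor E e n) p q ≡ tensor (λ b x y → κ b * K b x y) e n p q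
    pullback-tensor {xs = xs} {t} {E} {K} {κ} pb zero n (p ∷ []) (q ∷ []) = trans (∑-tuples₁ xs _)
      (trans (∑-cong xs (λ x → trans (∑-tuples₁ xs _) (∑-cong xs (λ y →
        cong (_* E n x y) (cong₂ _*_ (ℚ.*-identityʳ (t p x)) (ℚ.*-identityʳ (t q y)))))))
        (pb n p q))
    pullback-tensor {xs = xs} {t} {E} {K} {κ} pb (suc e) n (p ∷ v) (q ∷ w) = begin
        pullback (tuples xs (suc (suc e))) T (tensor E (suc e) n) (p ∷ v) (q ∷ w)
          ≡⟨ trans (∑-tuples xs (suc e) _) (∑-cong xs (λ x → ∑-cong vs (λ r → ∑-tuples xs (suc e) _))) ⟩
        ∑ xs (λ x → ∑ vs (λ r → ∑ xs (λ y → ∑ vs (λ s →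
          t p x * T v r * (t q y * T w s) * ∑ bs (λ b → E b x y * H b r s)))))
          ≡⟨ ∑-cong xs (λ x → ∑-cong vs (λ r → trans
               (∑-cong xs (λ y → ∑-cong vs (λ s → trans (sym (∑-*ˡ bs (t p x * T v r * (t q y * T w s)) _)) (∑-cong bs (λ b →
                 regroup (t p x) (T v r) (t q y) (T w s) (E b x y) (H b r s))))))
               (∑-swap₂ xs vs bs _))) ⟩
        ∑ xs (λ x → ∑ vs (λ r → ∑ bs (λ b → ∑ xs (λ y → ∑ vs (λ s →
          t p x * t q y * E b x y * (T v r * T w s * H b r s))))))
          ≡⟨ trans (∑-swap₂ xs vs bs _) (∑-cong bs (λ b → ∑-cong xs (λ x → ∑-cong vs (λ r → ∑-×-∑ xs vs _ _)))) ⟩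
        ∑ bs (λ b → ∑ xs (λ x → ∑ vs (λ r →
          ∑ xs (λ y → t p x * t q y * E b x y) * ∑ vs (λ s → T v r * T w s * H b r s))))
          ≡⟨ ∑-cong bs (λ b → ∑-×-∑ xs vs _ _) ⟩
        ∑ bs (λ b → pullback xs t (E b) p q * pullback vs T (H b) v w)
          ≡⟨ ∑-cong bs (λ b → cong₂ _*_ (pb b p q) (pullback-tensor {xs = xs} {t} {E} {K} {κ} pb e (n ℕ.∸ b) v w)) ⟩
        tensor (λ b x y → κ b * K b x y) (suc e) n (p ∷ v) (q ∷ w) ∎
      where
      open ≡-Reasoning
      bs = upTo k
      vs = tuples xs (suc e)
      T : ∀ {n} → Vec _ n → Vec _ n → ℚ
      T = product-matrix t
      H : ℕ → Kernel (Vec _ (suc e))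
      H b = tensor E e (n ℕ.∸ b)
      regroup : ∀ a b c d e h → a * b * (c * d) * (e * h) ≡ a * c * e * (b * d * h)
      regroup = solve-∀ ℚ-ring

    module _ {xs : List A} {K : ℕ → Kernel A} (orth : IsOrthogonalFamily xs K)
      {κ : ℕ → ℚ} {ρ θ : ℚ} {L : ℕ} (0≤ρ : 0ℚ ≤ ρ) (0≤θ : 0ℚ ≤ θ)
      (κ-bound : ∀ {b} → b ℕ.< L → ρ * θ ^ℚ b ≤ κ b) where
      open IsOrthogonalFamily orth

      -- The bounds `ρ * θ ^ b ≤ κ b` multiply along a tuple of sum `n` to a factor that is the same
      -- for all tuples. Kernels cannot be compared entrywise, so the comparison is made between
      -- forms, slice by slice, where every summand is nonnegative.
      quad-tensor-weighted : ∀ e {n} → e ℕ.* k ℕ.≤ n → n ℕ.< L → ∀ μ →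
        ρ ^ℚ suc e * θ ^ℚ n * quad (tensor K e n) μ ≤ quad (tensor (λ b x y → κ b * K b x y) e n) μ
      quad-tensor-weighted zero {n} _ n<L μ = begin
          ρ * 1ℚ * θ ^ℚ n * quad (tensor K 0 n) μ
            ≡⟨ cong (λ r → r * θ ^ℚ n * quad (tensor K 0 n) μ) (ℚ.*-identityʳ ρ) ⟩
          ρ * θ ^ℚ n * quad (tensor K 0 n) μ
            ≤⟨ *-monoʳ _ (0≤quad {xs = tuples xs 1} (tensor-symmetric orth 0 n) (tensor-idempotent orth 0 n) μ) (κ-bound n<L) ⟩
          κ n * quad (tensor K 0 n) μ
            ≡⟨ sym (quad-*ˡ μ (κ n) _) ⟩
          quad (tensor (λ b x y → κ b * K b x y) 0 n) μ ∎
        where open ℚ.≤-Reasoning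
      quad-tensor-weighted (suc e) {n} ek≤n n<L μ = begin
          Cₑ * quad (tensor K (suc e) n) μ
            ≡⟨ cong (Cₑ *_) (trans (quad-∑ μ bs _) (∑-cong bs (λ b →
                 quad-tensor {xs = xs} (symmetric b) (idempotent b) (H b) μ))) ⟩
          Cₑ * ∑ bs (λ b → ∑ xs (λ r → quad (H b) (slice (K b r) μ)))
            ≡⟨ trans (sym (∑-*ˡ bs Cₑ _)) (∑-cong bs (λ b → sym (∑-*ˡ xs Cₑ _))) ⟩
          ∑ bs (λ b → ∑ xs (λ r → Cₑ * quad (H b) (slice (K b r) μ)))
            ≤⟨ ∑-mono-∈ bs (λ b b∈ → ∑-mono xs (λ r → term (∈-upTo⁻ b∈) (slice (K b r) μ))) ⟩
          ∑ bs (λ b → ∑ xs (λ r → κ b * quad (Hκ b) (slice (K b r) μ)))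
            ≡⟨ ∑-cong bs (λ b → trans (∑-*ˡ xs (κ b) _) (trans
                 (cong (κ b *_) (sym (quad-tensor {xs = xs} (symmetric b) (idempotent b) (Hκ b) μ)))
                 (sym (quad-*ˡ μ (κ b) _)))) ⟩
          ∑ bs (λ b → quad (λ p q → κ b * (K b (head p) (head q) * Hκ b (tail p) (tail q))) μ)
            ≡⟨ ∑-cong bs (λ b → quad-cong μ (λ p q → sym (ℚ.*-assoc (κ b) (K b (head p) (head q)) _))) ⟩
          ∑ bs (λ b → quad (λ p q → κ b * K b (head p) (head q) * Hκ b (tail p) (tail q)) μ)
            ≡⟨ sym (quad-∑ μ bs _) ⟩
          quad (tensor (λ b x y → κ b * K b x y) (suc e) n) μ ∎
        where
        open ℚ.≤-Reasoning
        bs = upTo k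
        Cₑ = ρ ^ℚ suc (suc e) * θ ^ℚ n
        H Hκ : ℕ → Kernel (Vec A (suc e))
        H b  = tensor K e (n ℕ.∸ b)
        Hκ b = tensor (λ b x y → κ b * K b x y) e (n ℕ.∸ b)
        regroup : ∀ r s t u q → r * s * (t * u) * q ≡ r * t * (s * u * q)
        regroup = solve-∀ ℚ-ring
        term : ∀ {b} → b ℕ.< k → ∀ ν → Cₑ * quad (H b) ν ≤ κ b * quad (Hκ b) ν
        term {b} b<k ν = begin
            ρ * ρ ^ℚ suc e * θ ^ℚ n * quad (H b) ν
              ≡⟨ cong (λ t → ρ * ρ ^ℚ suc e * t * quad (H b) ν)
                   (trans (cong (θ ^ℚ_) (sym (ℕ.m+[n∸m]≡n b≤n))) (^ℚ-homo-* θ b (n ℕ.∸ b))) ⟩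
            ρ * ρ ^ℚ suc e * (θ ^ℚ b * θ ^ℚ (n ℕ.∸ b)) * quad (H b) ν
              ≡⟨ regroup ρ (ρ ^ℚ suc e) (θ ^ℚ b) (θ ^ℚ (n ℕ.∸ b)) (quad (H b) ν) ⟩
            ρ * θ ^ℚ b * (ρ ^ℚ suc e * θ ^ℚ (n ℕ.∸ b) * quad (H b) ν)
              ≤⟨ *-mono-≤ (0≤* 0≤ρ (0≤^ℚ 0≤θ b)) (ℚ.≤-trans (0≤* (0≤* (0≤^ℚ 0≤ρ (suc e)) (0≤^ℚ 0≤θ (n ℕ.∸ b)))
                   (0≤quad {xs = tuples xs (suc e)} (tensor-symmetric orth e _) (tensor-idempotent orth e _) ν)) ih) (κ-bound (ℕ.≤-<-trans b≤n n<L)) ih ⟩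
            κ b * quad (Hκ b) ν ∎
          where
          b≤n = ℕ.≤-trans (ℕ.<⇒≤ b<k) (ℕ.≤-trans (ℕ.m≤m+n k (e ℕ.* k)) ek≤n)
          ih = quad-tensor-weighted e (levels b<k ek≤n) (ℕ.≤-<-trans (ℕ.m∸n≤m n b) n<L) ν

open Tensors

-- Base 4 words and the projections of a profile.

module Words where
  open import Data.Rational using (_+_; _*_; _-_; -_; _≤_; _<_)

  -- A cell of the partition of [0,1] into 4 ^ L intervals, given by its base 4 digits.
  Word : ℕ → Set
  Word = Vec (Fin 4)

  abstract
    digits : List (Fin 4)
    digits = allFin 4

    length-digits : length digits ≡ 4
    length-digits = refl

    digits-unique : Unique digits
    digits-unique = allFin⁺ 4

    ∈-digits : ∀ c → c ∈ digits
    ∈-digits = ∈-allFin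

    ∑-digits : ∀ f → ∑ digits f ≡ f 0F ℚ.+ (f 1F ℚ.+ (f 2F ℚ.+ (f 3F ℚ.+ 0ℚ)))
    ∑-digits f = refl

  words : ∀ L → List (Word L)
  words = tuples digits

  pos : ∀ {L} → Word L → ℕ
  pos []              = 0
  pos {suc L} (c ∷ r) = Fin.toℕ c ℕ.* 4 ℕ.^ L ℕ.+ pos r

  width : ℕ → ℚ
  width L = ι (4 ℕ.^ L)

  position : ∀ {L} → Word L → ℚ
  position r = ι (pos r)

  position-∷ : ∀ {L} c (r : Word L) → position (c ∷ r) ≡ ι (Fin.toℕ c) * width L + position r
  position-∷ {L} c r = trans (ι-+ (Fin.toℕ c ℕ.* 4 ℕ.^ L) (pos r)) (cong (_+ position r) (ι-* (Fin.toℕ c) (4 ℕ.^ L)))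

  δ : Fin 4 → Fin 4 → ℚ
  δ c d = if does (c Fin.≟ d) then 1ℚ else 0ℚ

  δ-refl : ∀ c → δ c c ≡ 1ℚ
  δ-refl c = cong (if_then 1ℚ else 0ℚ) (dec-true (c Fin.≟ c) refl)

  δ-≢ : ∀ {c d} → c ≢ d → δ c d ≡ 0ℚ
  δ-≢ {c} {d} c≢d = cong (if_then 1ℚ else 0ℚ) (dec-false (c Fin.≟ d) c≢d)

  δ-sym : ∀ c d → δ c d ≡ δ d c
  δ-sym c d with c Fin.≟ d
  ... | yes refl = sym (δ-refl c)
  ... | no  c≢d  = sym (δ-≢ (λ d≡c → c≢d (sym d≡c)))

  ∑-δ : ∀ c (f : Fin 4 → ℚ) → ∑ digits (λ d → δ c d * f d) ≡ f c
  ∑-δ c f = trans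
    (∑-delta digits-unique (∈-digits c) (λ d → δ c d * f d)
      (λ d d≢c → trans (cong (_* f d) (δ-≢ (λ c≡d → d≢c (sym c≡d)))) (ℚ.*-zeroˡ (f d))))
    (trans (cong (_* f c) (δ-refl c)) (ℚ.*-identityˡ (f c)))

  ∑-four : ∀ t → ∑ digits (λ _ → t) ≡ ι 4 * t
  ∑-four t = trans (∑-digits (λ _ → t)) (lemma t)
    where
    lemma : ∀ t → t + (t + (t + (t + 0ℚ))) ≡ ι 4 * t
    lemma = solve-∀ ℚ-ring

  ∑-words : ∀ L f → ∑ (words (suc L)) f ≡ ∑ digits (λ c → ∑ (words L) (λ r → f (c ∷ r)))
  ∑-words = ∑-tuples digits

  length-words : ∀ L → length (words L) ≡ 4 ℕ.^ L
  length-words L = trans (length-tuples digits L) (cong (ℕ._^ L) length-digits)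

  -- The projections onto the spans of the translates to the intervals of level b of
  -- one function ψ that is affine on each quarter and orthogonal to all affine functions.
  record Profile : Set where
    field
      const slope : ℕ → Fin 4 → ℚ
      norm⁻¹      : ℕ → ℚ

    ψ : ∀ {L} → Word (suc L) → ℚ
    ψ {L} p = const L (head p) + slope L (head p) * position (tail p)

    norm : ℕ → ℚ
    norm L = ∑ (words (suc L)) (λ p → ψ p * ψ p)

    field
      normalised : ∀ L → norm L * norm⁻¹ L ≡ 1ℚ
      -- The moments vanish already for each fixed place `x` within the quarters, so these are
      -- identities in four terms, without a sum over positions.
      moment₀    : ∀ L x → ∑ digits (λ c → const L c + slope L c * x) ≡ 0ℚ
      moment₁    : ∀ L x → ∑ digits (λ c → (const L c + slope L c * x) * (ι (Fin.toℕ c) * width L + x)) ≡ 0ℚ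

    -- The first `b` digits have to agree, and the rest is compared through `ψ`. For `b < L` there
    -- is one function for each prefix of length `b`, hence rank `4 ^ b`; for `b ≥ L` the kernel is
    -- 0.
    proj : ∀ L → ℕ → Kernel (Word L)
    proj zero    b       p q = 0ℚ
    proj (suc L) zero    p q = ψ p * ψ q * norm⁻¹ L
    proj (suc L) (suc b) p q = δ (head p) (head q) * proj L b (tail p) (tail q)

    proj-sym : ∀ L b → IsSymmetric (proj L b)
    proj-sym zero    b       p q = refl
    proj-sym (suc L) zero    p q = cong (_* norm⁻¹ L) (ℚ.*-comm (ψ p) (ψ q))
    proj-sym (suc L) (suc b) p q = cong₂ _*_ (δ-sym (head p) (head q)) (proj-sym L b (tail p) (tail q))

    -- On a subinterval an affine function is affine with another constant term. Induction thus
    -- descends to the interval that carries `ψ`, where the moment conditions apply.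
    proj-affine : ∀ L b p u v → ∑ (words L) (λ q → proj L b p q * (u + v * position q)) ≡ 0ℚ
    proj-affine zero b p u v = trans (ℚ.+-identityʳ _) (ℚ.*-zeroˡ (u + v * 0ℚ))
    proj-affine (suc L) zero p u v = begin
        ∑ (words (suc L)) (λ q → ψ p * ψ q * norm⁻¹ L * (u + v * position q))
          ≡⟨ trans (∑-words L _) (∑-swap digits (words L) _) ⟩
        ∑ (words L) (λ r → ∑ digits (λ c → ψ p * ψ (c ∷ r) * norm⁻¹ L * (u + v * position (c ∷ r))))
          ≡⟨ ∑-cong (words L) (λ r → trans (∑-cong digits (λ c → trans
               (cong (λ t → ψ p * ψ (c ∷ r) * norm⁻¹ L * (u + v * t)) (position-∷ c r))
               (expand (ψ p) (ψ (c ∷ r)) (norm⁻¹ L) u v (ι (Fin.toℕ c) * width L + position r))))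
               (trans (∑-+ digits _ _) (cong₂ _+_
                 (trans (∑-*ˡ digits (ψ p * norm⁻¹ L * u) (λ c → ψ (c ∷ r))) (cong (ψ p * norm⁻¹ L * u *_) (moment₀ L (position r))))
                 (trans (∑-*ˡ digits (ψ p * norm⁻¹ L * v) (λ c → ψ (c ∷ r) * (ι (Fin.toℕ c) * width L + position r)))
                   (cong (ψ p * norm⁻¹ L * v *_) (moment₁ L (position r))))))) ⟩
        ∑ (words L) (λ r → ψ p * norm⁻¹ L * u * 0ℚ + ψ p * norm⁻¹ L * v * 0ℚ)
          ≡⟨ trans (∑-cong (words L) (λ r → vanish (ψ p * norm⁻¹ L * u) (ψ p * norm⁻¹ L * v))) (∑-zero (words L)) ⟩
        0ℚ ∎
      where
      open ≡-Reasoning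
      expand : ∀ p q g u v x → p * q * g * (u + v * x) ≡ p * g * u * q + p * g * v * (q * x)
      expand = solve-∀ ℚ-ring
      vanish : ∀ a b → a * 0ℚ + b * 0ℚ ≡ 0ℚ
      vanish = solve-∀ ℚ-ring
    proj-affine (suc L) (suc b) p u v = begin
        ∑ (words (suc L)) (λ q → proj (suc L) (suc b) p q * (u + v * position q))
          ≡⟨ ∑-words L _ ⟩
        ∑ digits (λ c → ∑ (words L) (λ r → δ (head p) c * proj L b (tail p) r * (u + v * position (c ∷ r))))
          ≡⟨ ∑-cong digits (λ c → trans (∑-cong (words L) (λ r → trans
               (cong (λ t → δ (head p) c * proj L b (tail p) r * (u + v * t)) (position-∷ c r))
               (expand (δ (head p) c) (proj L b (tail p) r) u v (ι (Fin.toℕ c) * width L) (position r))))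
               (trans (∑-*ˡ (words L) (δ (head p) c) _)
                 (trans (cong (δ (head p) c *_) (proj-affine L b (tail p) (u + v * (ι (Fin.toℕ c) * width L)) v))
                   (ℚ.*-zeroʳ (δ (head p) c))))) ⟩
        ∑ digits (λ c → 0ℚ)
          ≡⟨ ∑-zero digits ⟩
        0ℚ ∎
      where
      open ≡-Reasoning
      expand : ∀ d k u v y x → d * k * (u + v * (y + x)) ≡ d * (k * ((u + v * y) + v * x))
      expand = solve-∀ ℚ-ring

    proj-const : ∀ L b p → ∑ (words L) (λ q → proj L b p q) ≡ 0ℚ
    proj-const L b p = trans (∑-cong (words L) (λ q → lemma (proj L b p q) (position q))) (proj-affine L b p 1ℚ 0ℚ)
      where
      lemma : ∀ k x → k ≡ k * (1ℚ + 0ℚ * x)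
      lemma = solve-∀ ℚ-ring

    private
      compose-zero : ∀ L p q → ∑ (words (suc L)) (λ r → proj (suc L) 0 p r * proj (suc L) 0 r q) ≡ proj (suc L) 0 p q
      compose-zero L p q = trans (∑-cong (words (suc L)) (λ r → regroup (ψ p) (ψ q) (norm⁻¹ L) (ψ r)))
          (trans (∑-*ˡ (words (suc L)) (ψ p * ψ q * norm⁻¹ L * norm⁻¹ L) _)
            (trans (regroup' (ψ p * ψ q * norm⁻¹ L) (norm⁻¹ L) (norm L))
              (trans (cong (ψ p * ψ q * norm⁻¹ L *_) (normalised L)) (ℚ.*-identityʳ _))))
        where
        regroup : ∀ p q g r → p * r * g * (r * q * g) ≡ p * q * g * g * (r * r)
        regroup = solve-∀ ℚ-ring
        regroup' : ∀ a g n → a * g * n ≡ a * (n * g)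
        regroup' = solve-∀ ℚ-ring

      -- The coarser function is affine on each quarter of its interval, while the finer kernel
      -- lives inside the quarters and annihilates affine functions.
      compose-zero-suc : ∀ L b p q → ∑ (words (suc L)) (λ r → proj (suc L) 0 p r * proj (suc L) (suc b) r q) ≡ 0ℚ
      compose-zero-suc L b p q = trans (∑-words L _) (trans (∑-cong digits (λ c →
          trans (∑-cong (words L) (λ r → trans
              (cong (λ t → ψ p * ψ (c ∷ r) * norm⁻¹ L * (δ c (head q) * t)) (proj-sym L b r (tail q)))
              (regroup (ψ p) (ψ (c ∷ r)) (norm⁻¹ L) (δ c (head q)) (proj L b (tail q) r))))
            (trans (∑-*ˡ (words L) (ψ p * norm⁻¹ L * δ c (head q)) _)
              (trans (cong (ψ p * norm⁻¹ L * δ c (head q) *_) (proj-affine L b (tail q) (const L c) (slope L c)))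
                (ℚ.*-zeroʳ (ψ p * norm⁻¹ L * δ c (head q))))))) (∑-zero digits))
        where
        regroup : ∀ p r g d k → p * r * g * (d * k) ≡ p * g * d * (k * r)
        regroup = solve-∀ ℚ-ring

      compose-suc-suc : ∀ L a b p q → ∑ (words (suc L)) (λ r → proj (suc L) (suc a) p r * proj (suc L) (suc b) r q) ≡
        δ (head p) (head q) * ∑ (words L) (λ r → proj L a (tail p) r * proj L b r (tail q))
      compose-suc-suc L a b p q = trans (∑-words L _) (trans (∑-cong digits (λ c →
          trans (∑-cong (words L) (λ r → regroup (δ (head p) c) (proj L a (tail p) r) (δ c (head q)) (proj L b r (tail q))))
            (trans (∑-*ˡ (words L) (δ (head p) c * δ c (head q)) _) (ℚ.*-assoc (δ (head p) c) (δ c (head q)) _))))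
          (∑-δ (head p) (λ c → δ c (head q) * ∑ (words L) (λ r → proj L a (tail p) r * proj L b r (tail q)))))
        where
        regroup : ∀ d k e h → d * k * (e * h) ≡ d * e * (k * h)
        regroup = solve-∀ ℚ-ring

    proj-idem : ∀ L b → IsIdempotent (words L) (proj L b)
    proj-idem zero    b       p q = refl
    proj-idem (suc L) zero    p q = compose-zero L p q
    proj-idem (suc L) (suc b) p q = trans (compose-suc-suc L b b p q)
      (cong (δ (head p) (head q) *_) (proj-idem L b (tail p) (tail q)))

    proj-orth : ∀ L {a b} → a ≢ b → ∀ p q → ∑ (words L) (λ r → proj L a p r * proj L b r q) ≡ 0ℚ
    proj-orth zero    a≢b p q = refl
    proj-orth (suc L) {zero}  {zero}  a≢b p q = contradiction refl a≢b
    proj-orth (suc L) {zero}  {suc b} a≢b p q = compose-zero-suc L b p q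
    proj-orth (suc L) {suc a} {zero}  a≢b p q = trans (∑-cong (words (suc L)) (λ r → trans
      (ℚ.*-comm (proj (suc L) (suc a) p r) (proj (suc L) 0 r q))
      (cong₂ _*_ (proj-sym (suc L) 0 r q) (proj-sym (suc L) (suc a) p r)))) (compose-zero-suc L a q p)
    proj-orth (suc L) {suc a} {suc b} a≢b p q = trans (compose-suc-suc L a b p q)
      (trans (cong (δ (head p) (head q) *_) (proj-orth L (λ a≡b → a≢b (cong suc a≡b)) (tail p) (tail q)))
        (ℚ.*-zeroʳ (δ (head p) (head q))))

    isOrthogonalFamily : ∀ L → IsOrthogonalFamily (words L) (proj L)
    isOrthogonalFamily L = record
      { symmetric = proj-sym L ; idempotent = proj-idem L ; orthogonal = proj-orth L }

    trace-proj : ∀ L {b} → b ℕ.< L → trace (words L) (proj L b) ≡ ι (4 ℕ.^ b)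
    trace-proj (suc L) {zero}  _ = trans (∑-*ʳ (words (suc L)) (norm⁻¹ L) _) (normalised L)
    trace-proj (suc L) {suc b} (ℕ.s≤s b<L) = trans (∑-words L _) (trans
      (∑-cong digits (λ c → trans (∑-*ˡ (words L) (δ c c) _)
        (trans (cong₂ _*_ (δ-refl c) (trace-proj L b<L)) (ℚ.*-identityˡ (ι (4 ℕ.^ b))))))
      (trans (∑-four (ι (4 ℕ.^ b))) (sym (ι-* 4 (4 ℕ.^ b)))))

open Words

-- The third difference profile, its tail sums and the pullback of projections.

module Profiles where
  open import Data.Rational using (_+_; _*_; _-_; -_; _≤_; _<_)

  -- The third difference, which annihilates quadratic and a fortiori affine functions.
  jump : Fin 4 → ℚ
  jump 0F = - 1ℚ
  jump 1F = ι 3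
  jump 2F = - ι 3
  jump 3F = 1ℚ

  -- offset c is the sum of jump d over d ≥ c, as the tail sums of the step function with
  -- values jump on the quarters are offset c * width - jump c * position.
  offset : Fin 4 → ℚ
  offset 0F = 0ℚ
  offset 1F = 1ℚ
  offset 2F = - ι 2
  offset 3F = 1ℚ

  0<width : ∀ L → 0ℚ < width L
  0<width L = ι-mono-< (ℕ.m^n>0 4 L)

  -- Here 20 is `1² + 3² + 3² + 1²`, counted once for each of the `width L` places in a quarter.
  step-norm⁻¹ : ∀ L → ∃ λ g → 0ℚ < g × ι 20 * width L * g ≡ 1ℚ
  step-norm⁻¹ L = inverse (ι 20 * width L) (0<* (ι-mono-< {0} {20} ℕ.z<s) (0<width L))

  ∑-words-const : ∀ L c → ∑ (words L) (λ _ → c) ≡ width L * c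
  ∑-words-const L c = trans (∑-const (words L) c) (cong (λ l → ι l * c) (length-words L))

  stepProfile : Profile
  stepProfile = record
    { const = λ _ → jump ; slope = λ _ _ → 0ℚ ; norm⁻¹ = λ L → proj₁ (step-norm⁻¹ L)
    ; normalised = λ L → trans (cong (_* proj₁ (step-norm⁻¹ L)) (norm≡ L)) (proj₂ (proj₂ (step-norm⁻¹ L)))
    ; moment₀ = λ L x → trans (∑-digits _) (m₀ x)
    ; moment₁ = λ L x → trans (∑-digits _) (m₁ (width L) x) }
    where
    m₀ : ∀ x → - 1ℚ + 0ℚ * x + (ι 3 + 0ℚ * x + (- ι 3 + 0ℚ * x + (1ℚ + 0ℚ * x + 0ℚ))) ≡ 0ℚ
    m₀ = solve-∀ ℚ-ring
    m₁ : ∀ w x → (- 1ℚ + 0ℚ * x) * (ι 0 * w + x) + ((ι 3 + 0ℚ * x) * (ι 1 * w + x) +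
      ((- ι 3 + 0ℚ * x) * (ι 2 * w + x) + ((1ℚ + 0ℚ * x) * (ι 3 * w + x) + 0ℚ))) ≡ 0ℚ
    m₁ = solve-∀ ℚ-ring
    m₂ : ∀ x → (- 1ℚ + 0ℚ * x) * (- 1ℚ + 0ℚ * x) + ((ι 3 + 0ℚ * x) * (ι 3 + 0ℚ * x) +
      ((- ι 3 + 0ℚ * x) * (- ι 3 + 0ℚ * x) + ((1ℚ + 0ℚ * x) * (1ℚ + 0ℚ * x) + 0ℚ))) ≡ ι 20
    m₂ = solve-∀ ℚ-ring
    norm≡ : ∀ L → ∑ (words (suc L)) (λ p → (jump (head p) + 0ℚ * position (tail p)) * (jump (head p) + 0ℚ * position (tail p)))
      ≡ ι 20 * width L
    norm≡ L = trans (∑-words L _) (trans (∑-swap digits (words L) (λ c r → (jump c + 0ℚ * position r) * (jump c + 0ℚ * position r)))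
      (trans (∑-cong (words L) (λ r → trans (∑-digits _) (m₂ (position r))))
        (trans (∑-words-const L (ι 20)) (ℚ.*-comm (width L) (ι 20)))))

  tail-sum : ∀ {L} → Word (suc L) → ℚ
  tail-sum {L} p = offset (head p) * width L + - jump (head p) * position (tail p)

  tail-norm : ℕ → ℚ
  tail-norm L = ∑ (words (suc L)) (λ p → tail-sum p * tail-sum p)

  -- At a fixed place `x` within the quarters, with `w` their width, the four squares add up to
  -- `w² + 5 (2 x - w)²`.
  tail-norm≥ : ∀ L → width L * (width L * width L) ≤ tail-norm L
  tail-norm≥ L = begin
      width L * (width L * width L)
        ≡⟨ sym (∑-words-const L (width L * width L)) ⟩
      ∑ (words L) (λ _ → width L * width L)
        ≤⟨ ∑-mono (words L) (λ r → ≤-by (ι 5 * ((ι 2 * position r - width L) * (ι 2 * position r - width L)))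
             (0≤* (0≤ι 5) (0≤sq (ι 2 * position r - width L))) (square (width L) (position r))) ⟩
      ∑ (words L) (λ r → f₀ r 0F + (f₀ r 1F + (f₀ r 2F + (f₀ r 3F + 0ℚ))))
        ≡⟨ ∑-cong (words L) (λ r → sym (∑-digits (f₀ r))) ⟩
      ∑ (words L) (λ r → ∑ digits (f₀ r))
        ≡⟨ sym (trans (∑-words L _) (∑-swap digits (words L) (λ c r → f₀ r c))) ⟩
      tail-norm L ∎
    where
    open ℚ.≤-Reasoning
    f₀ : Word L → Fin 4 → ℚ
    f₀ r c = tail-sum (c ∷ r) * tail-sum (c ∷ r)
    square : ∀ w x → w * w + ι 5 * ((ι 2 * x - w) * (ι 2 * x - w)) ≡
      (0ℚ * w + - (- 1ℚ) * x) * (0ℚ * w + - (- 1ℚ) * x) + ((1ℚ * w + - ι 3 * x) * (1ℚ * w + - ι 3 * x) +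
      ((- ι 2 * w + - (- ι 3) * x) * (- ι 2 * w + - (- ι 3) * x) + ((1ℚ * w + - 1ℚ * x) * (1ℚ * w + - 1ℚ * x) + 0ℚ)))
    square = solve-∀ ℚ-ring

  tail-norm⁻¹ : ∀ L → ∃ λ g → 0ℚ < g × tail-norm L * g ≡ 1ℚ
  tail-norm⁻¹ L = inverse (tail-norm L) (ℚ.<-≤-trans (0<* (0<width L) (0<* (0<width L) (0<width L))) (tail-norm≥ L))

  tailProfile : Profile
  tailProfile = record
    { const = λ L c → offset c * width L ; slope = λ _ c → - jump c ; norm⁻¹ = λ L → proj₁ (tail-norm⁻¹ L)
    ; normalised = λ L → proj₂ (proj₂ (tail-norm⁻¹ L))
    ; moment₀ = λ L x → trans (∑-digits _) (m₀ (width L) x)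
    ; moment₁ = λ L x → trans (∑-digits _) (m₁ (width L) x) }
    where
    m₀ : ∀ w x → 0ℚ * w + - (- 1ℚ) * x + (1ℚ * w + - ι 3 * x + (- ι 2 * w + - (- ι 3) * x + (1ℚ * w + - 1ℚ * x + 0ℚ))) ≡ 0ℚ
    m₀ = solve-∀ ℚ-ring
    m₁ : ∀ w x → (0ℚ * w + - (- 1ℚ) * x) * (ι 0 * w + x) + ((1ℚ * w + - ι 3 * x) * (ι 1 * w + x) +
      ((- ι 2 * w + - (- ι 3) * x) * (ι 2 * w + x) + ((1ℚ * w + - 1ℚ * x) * (ι 3 * w + x) + 0ℚ))) ≡ 0ℚ
    m₁ = solve-∀ ℚ-ring

  module Step = Profile stepProfile
  module Tail = Profile tailProfile

  lt : Fin 4 → Fin 4 → ℚ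
  lt c d = if does (c Fin.<? d) then 1ℚ else 0ℚ

  -- The indicator function of pos p ≤ pos x.
  le : ∀ {L} → Word L → Word L → ℚ
  le []      []      = 1ℚ
  le (c ∷ p) (d ∷ x) = lt c d + δ c d * le p x

  ∑-le-step : ∀ {L} (u : Fin 4 → ℚ) c (p : Word L) → ∑ (words (suc L)) (λ x → le (c ∷ p) x * u (head x)) ≡
    ∑ digits (λ d → lt c d * u d) * width L + u c * ∑ (words L) (le p)
  ∑-le-step {L} u c p = begin
      ∑ (words (suc L)) (λ x → le (c ∷ p) x * u (head x))
        ≡⟨ ∑-words L _ ⟩
      ∑ digits (λ d → ∑ (words L) (λ x → (lt c d + δ c d * le p x) * u d))
        ≡⟨ ∑-cong digits (λ d → trans (∑-cong (words L) (λ x → expand (lt c d) (δ c d) (le p x) (u d)))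
             (trans (∑-+ (words L) (λ _ → lt c d * u d) _) (cong₂ _+_
               (trans (∑-words-const L (lt c d * u d)) (ℚ.*-comm (width L) (lt c d * u d)))
               (trans (∑-*ˡ (words L) (δ c d * u d) (le p)) (ℚ.*-assoc (δ c d) (u d) _))))) ⟩
      ∑ digits (λ d → lt c d * u d * width L + δ c d * (u d * ∑ (words L) (le p)))
        ≡⟨ trans (∑-+ digits _ _) (cong₂ _+_ (∑-*ʳ digits (width L) (λ d → lt c d * u d))
             (∑-δ c (λ d → u d * ∑ (words L) (le p)))) ⟩
      ∑ digits (λ d → lt c d * u d) * width L + u c * ∑ (words L) (le p) ∎
    where
    open ≡-Reasoning
    expand : ∀ l d t u → (l + d * t) * u ≡ l * u + d * u * t
    expand = solve-∀ ℚ-ring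

  ∑-le : ∀ {L} (p : Word L) → ∑ (words L) (le p) ≡ width L - position p
  ∑-le []              = refl
  ∑-le {suc L} (c ∷ p) = begin
      ∑ (words (suc L)) (le (c ∷ p))
        ≡⟨ trans (∑-cong (words (suc L)) (λ x → sym (ℚ.*-identityʳ (le (c ∷ p) x)))) (∑-le-step (λ _ → 1ℚ) c p) ⟩
      ∑ digits (λ d → lt c d * 1ℚ) * width L + 1ℚ * ∑ (words L) (le p)
        ≡⟨ cong₂ (λ s t → s * width L + 1ℚ * t) (trans (∑-digits _) (count c)) (∑-le p) ⟩
      (ι 3 - ι (Fin.toℕ c)) * width L + 1ℚ * (width L - position p)
        ≡⟨ collect (ι (Fin.toℕ c)) (width L) (position p) ⟩
      ι 4 * width L - (ι (Fin.toℕ c) * width L + position p)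
        ≡⟨ cong₂ _-_ (sym (ι-* 4 (4 ℕ.^ L))) (sym (position-∷ c p)) ⟩
      width (suc L) - position (c ∷ p) ∎
    where
    open ≡-Reasoning
    count : ∀ c → lt c 0F * 1ℚ + (lt c 1F * 1ℚ + (lt c 2F * 1ℚ + (lt c 3F * 1ℚ + 0ℚ))) ≡ ι 3 - ι (Fin.toℕ c)
    count 0F = refl
    count 1F = refl
    count 2F = refl
    count 3F = refl
    collect : ∀ c w x → (ι 3 - c) * w + 1ℚ * (w - x) ≡ ι 4 * w - (c * w + x)
    collect = solve-∀ ℚ-ring

  -- The quarters to the right of that of `p` contribute `offset c - jump c` times the width, and
  -- the quarter of `p` contributes `jump c` for each place that is not before `p`.
  ∑-le-jump : ∀ {L} (p : Word (suc L)) → ∑ (words (suc L)) (λ x → le p x * Step.ψ x) ≡ Tail.ψ p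
  ∑-le-jump {L} (c ∷ p) = begin
      ∑ (words (suc L)) (λ x → le (c ∷ p) x * Step.ψ x)
        ≡⟨ trans (∑-cong (words (suc L)) (λ x → cong (le (c ∷ p) x *_) (drop (jump (head x)) (position (tail x)))))
             (∑-le-step jump c p) ⟩
      ∑ digits (λ d → lt c d * jump d) * width L + jump c * ∑ (words L) (le p)
        ≡⟨ cong₂ (λ s t → s * width L + jump c * t) (trans (∑-digits _) (tails c)) (∑-le p) ⟩
      (offset c - jump c) * width L + jump c * (width L - position p)
        ≡⟨ collect (offset c) (jump c) (width L) (position p) ⟩
      Tail.ψ (c ∷ p) ∎
    where
    open ≡-Reasoning
    drop : ∀ j x → j + 0ℚ * x ≡ j
    drop = solve-∀ ℚ-ring
    tails : ∀ c → lt c 0F * jump 0F + (lt c 1F * jump 1F + (lt c 2F * jump 2F + (lt c 3F * jump 3F + 0ℚ))) ≡ offset c - jump c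
    tails 0F = refl
    tails 1F = refl
    tails 2F = refl
    tails 3F = refl
    collect : ∀ o j w x → (o - j) * w + j * (w - x) ≡ o * w + - j * x
    collect = solve-∀ ℚ-ring

  -- On a block with another leading digit than that of the point, `le` is constant and is cancelled
  -- by the sum 0 of `f`. This keeps the pullback of a projection block diagonal.
  ∑-le-block : ∀ {L} c d (p : Word L) f → ∑ (words L) f ≡ 0ℚ →
    ∑ (words L) (λ x → le (c ∷ p) (d ∷ x) * f x) ≡ δ c d * ∑ (words L) (λ x → le p x * f x)
  ∑-le-block {L} c d p f ∑f≡0 = begin
      ∑ (words L) (λ x → (lt c d + δ c d * le p x) * f x)
        ≡⟨ ∑-cong (words L) (λ x → expand (lt c d) (δ c d) (le p x) (f x)) ⟩
      ∑ (words L) (λ x → lt c d * f x + δ c d * (le p x * f x))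
        ≡⟨ trans (∑-+ (words L) _ _) (cong₂ _+_
             (trans (∑-*ˡ (words L) (lt c d) f) (trans (cong (lt c d *_) ∑f≡0) (ℚ.*-zeroʳ (lt c d))))
             (∑-*ˡ (words L) (δ c d) _)) ⟩
      0ℚ + δ c d * ∑ (words L) (λ x → le p x * f x)
        ≡⟨ ℚ.+-identityˡ _ ⟩
      δ c d * ∑ (words L) (λ x → le p x * f x) ∎
    where
    open ≡-Reasoning
    expand : ∀ l d t u → (l + d * t) * u ≡ l * u + d * (t * u)
    expand = solve-∀ ℚ-ring

  ratio : ℕ → ℕ → ℚ
  ratio zero    b       = 0ℚ
  ratio (suc L) zero    = tail-norm L * Step.norm⁻¹ L
  ratio (suc L) (suc b) = ratio L b

  private
    row : ∀ L b → Word L → Word L → ℚ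
    row L b q x = ∑ (words L) (λ y → le q y * Step.proj L b x y)

    pullback-row : ∀ L b p q → pullback (words L) le (Step.proj L b) p q ≡ ∑ (words L) (λ x → le p x * row L b q x)
    pullback-row L b p q = ∑-cong (words L) (λ x → trans
      (∑-cong (words L) (λ y → ℚ.*-assoc (le p x) (le q y) (Step.proj L b x y))) (∑-*ˡ (words L) (le p x) _))

    ∑-row : ∀ L b q → ∑ (words L) (row L b q) ≡ 0ℚ
    ∑-row L b q = trans (∑-swap (words L) (words L) _) (trans
      (∑-cong (words L) (λ y → trans (∑-*ˡ (words L) (le q y) _) (trans
        (cong (le q y *_) (trans (∑-cong (words L) (λ x → Step.proj-sym L b x y)) (Step.proj-const L b y)))
        (ℚ.*-zeroʳ (le q y))))) (∑-zero (words L)))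

    row-suc : ∀ L b c q d r → row (suc L) (suc b) (c ∷ q) (d ∷ r) ≡ δ c d * row L b q r
    row-suc L b c q d r = begin
        ∑ (words (suc L)) (λ y → le (c ∷ q) y * (δ d (head y) * Step.proj L b r (tail y)))
          ≡⟨ ∑-words L _ ⟩
        ∑ digits (λ d' → ∑ (words L) (λ y → le (c ∷ q) (d' ∷ y) * (δ d d' * Step.proj L b r y)))
          ≡⟨ ∑-cong digits (λ d' → trans (∑-cong (words L) (λ y → regroup (le (c ∷ q) (d' ∷ y)) (δ d d') (Step.proj L b r y)))
               (∑-*ˡ (words L) (δ d d') _)) ⟩
        ∑ digits (λ d' → δ d d' * ∑ (words L) (λ y → le (c ∷ q) (d' ∷ y) * Step.proj L b r y))
          ≡⟨ ∑-δ d (λ d' → ∑ (words L) (λ y → le (c ∷ q) (d' ∷ y) * Step.proj L b r y)) ⟩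
        ∑ (words L) (λ y → le (c ∷ q) (d ∷ y) * Step.proj L b r y)
          ≡⟨ ∑-le-block c d q _ (Step.proj-const L b r) ⟩
        δ c d * row L b q r ∎
      where
      open ≡-Reasoning
      regroup : ∀ t d e → t * (d * e) ≡ d * (t * e)
      regroup = solve-∀ ℚ-ring

  -- With `T` the matrix `le`, `T ψ` is the tail sum by `∑-le-jump`, so dividing `T ψ ψᵀ Tᵀ` by the
  -- squared norm of `ψ` gives the projection onto the tail sum times the quotient of the two
  -- squared norms. For later levels both factors `T` act inside one block.
  pullback-step : ∀ L b p q → pullback (words L) le (Step.proj L b) p q ≡ ratio L b * Tail.proj L b p q
  pullback-step zero b [] [] = refl
  pullback-step (suc L) zero p q = begin
      ∑ ws (λ x → ∑ ws (λ y → le p x * le q y * (Step.ψ x * Step.ψ y * g)))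
        ≡⟨ ∑-cong ws (λ x → ∑-cong ws (λ y → regroup (le p x) (le q y) (Step.ψ x) (Step.ψ y) g)) ⟩
      ∑ ws (λ x → ∑ ws (λ y → le p x * Step.ψ x * (le q y * Step.ψ y * g)))
        ≡⟨ ∑-×-∑ ws ws _ _ ⟩
      ∑ ws (λ x → le p x * Step.ψ x) * ∑ ws (λ y → le q y * Step.ψ y * g)
        ≡⟨ cong₂ _*_ (∑-le-jump p) (trans (∑-*ʳ ws g _) (cong (_* g) (∑-le-jump q))) ⟩
      Tail.ψ p * (Tail.ψ q * g)
        ≡⟨ sym (ℚ.*-identityʳ _) ⟩
      Tail.ψ p * (Tail.ψ q * g) * 1ℚ
        ≡⟨ cong (Tail.ψ p * (Tail.ψ q * g) *_) (sym (Tail.normalised L)) ⟩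
      Tail.ψ p * (Tail.ψ q * g) * (tail-norm L * Tail.norm⁻¹ L)
        ≡⟨ regroup' (Tail.ψ p) (Tail.ψ q) g (tail-norm L) (Tail.norm⁻¹ L) ⟩
      tail-norm L * g * (Tail.ψ p * Tail.ψ q * Tail.norm⁻¹ L) ∎
    where
    open ≡-Reasoning
    ws = words (suc L)
    g = Step.norm⁻¹ L
    regroup : ∀ s t x y g → s * t * (x * y * g) ≡ s * x * (t * y * g)
    regroup = solve-∀ ℚ-ring
    regroup' : ∀ p q g n m → p * (q * g) * (n * m) ≡ n * g * (p * q * m)
    regroup' = solve-∀ ℚ-ring
  pullback-step (suc L) (suc b) (c ∷ p) (d ∷ q) = begin
      pullback (words (suc L)) le (Step.proj (suc L) (suc b)) (c ∷ p) (d ∷ q)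
        ≡⟨ trans (pullback-row (suc L) (suc b) (c ∷ p) (d ∷ q)) (∑-words L _) ⟩
      ∑ digits (λ c' → ∑ (words L) (λ x → le (c ∷ p) (c' ∷ x) * row (suc L) (suc b) (d ∷ q) (c' ∷ x)))
        ≡⟨ ∑-cong digits (λ c' → trans (∑-cong (words L) (λ x → trans
             (cong (le (c ∷ p) (c' ∷ x) *_) (row-suc L b d q c' x))
             (regroup (le (c ∷ p) (c' ∷ x)) (δ d c') (row L b q x)))) (∑-*ˡ (words L) (δ d c') _)) ⟩
      ∑ digits (λ c' → δ d c' * ∑ (words L) (λ x → le (c ∷ p) (c' ∷ x) * row L b q x))
        ≡⟨ ∑-δ d (λ c' → ∑ (words L) (λ x → le (c ∷ p) (c' ∷ x) * row L b q x)) ⟩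
      ∑ (words L) (λ x → le (c ∷ p) (d ∷ x) * row L b q x)
        ≡⟨ ∑-le-block c d p _ (∑-row L b q) ⟩
      δ c d * ∑ (words L) (λ x → le p x * row L b q x)
        ≡⟨ cong (δ c d *_) (trans (sym (pullback-row L b p q)) (pullback-step L b p q)) ⟩
      δ c d * (ratio L b * Tail.proj L b p q)
        ≡⟨ regroup (δ c d) (ratio L b) (Tail.proj L b p q) ⟩
      ratio L b * (δ c d * Tail.proj L b p q) ∎
    where
    open ≡-Reasoning
    regroup : ∀ t d e → t * (d * e) ≡ d * (t * e)
    regroup = solve-∀ ℚ-ring

  1/16 1/320 : ℚ
  1/16  = ℤ.1ℤ ℚ./ 16
  1/320 = ℤ.1ℤ ℚ./ 320

  0≤1/16 : 0ℚ ≤ 1/16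
  0≤1/16 = ℚ.nonNegative⁻¹ 1/16

  0≤1/320 : 0ℚ ≤ 1/320
  0≤1/320 = ℚ.nonNegative⁻¹ 1/320

  width² : ∀ L → width L * width L ≡ ι (16 ℕ.^ L)
  width² zero    = refl
  width² (suc L) = trans (cong (λ w → w * w) (ι-* 4 (4 ℕ.^ L))) (trans (regroup (width L))
      (trans (cong (ι 16 *_) (width² L)) (sym (ι-* 16 (16 ℕ.^ L)))))
    where
    regroup : ∀ w → ι 4 * w * (ι 4 * w) ≡ ι 16 * (w * w)
    regroup = solve-∀ ℚ-ring

  -- If `w = 4 ^ (L - b - 1)` is the width of a quarter, the quotient of the squared norms is at
  -- least `w³ / (20 w) = w² / 20 = 16 ^ (L - b) / 320`.
  ratio-bound : ∀ L {b} → b ℕ.< L → ι (16 ℕ.^ L) * 1/320 * 1/16 ^ℚ b ≤ ratio L b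
  ratio-bound (suc L) {zero} _ = begin
      ι (16 ℕ.^ suc L) * 1/320 * 1ℚ
        ≡⟨ cong (λ t → t * 1/320 * 1ℚ) (trans (ι-* 16 (16 ℕ.^ L)) (cong (ι 16 *_) (sym (width² L)))) ⟩
      ι 16 * (w * w) * 1/320 * 1ℚ
        ≡⟨ cong (ι 16 * (w * w) * 1/320 *_) (sym (proj₂ (proj₂ (step-norm⁻¹ L)))) ⟩
      ι 16 * (w * w) * 1/320 * (ι 20 * w * g)
        ≡⟨ regroup w g ⟩
      w * (w * w) * g
        ≤⟨ *-monoʳ g (ℚ.<⇒≤ (proj₁ (proj₂ (step-norm⁻¹ L)))) (tail-norm≥ L) ⟩
      tail-norm L * g ∎
    where
    open ℚ.≤-Reasoning
    w = width L
    g = Step.norm⁻¹ L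
    regroup : ∀ w g → ι 16 * (w * w) * 1/320 * (ι 20 * w * g) ≡ w * (w * w) * g
    regroup = solve-∀ ℚ-ring
  ratio-bound (suc L) {suc b} (ℕ.s≤s b<L) = ℚ.≤-trans (ℚ.≤-reflexive (trans
      (cong (λ t → t * 1/320 * (1/16 * 1/16 ^ℚ b)) (ι-* 16 (16 ℕ.^ L)))
      (regroup (ι (16 ℕ.^ L)) (1/16 ^ℚ b)))) (ratio-bound L b<L)
    where
    regroup : ∀ w t → ι 16 * w * 1/320 * (1/16 * t) ≡ w * 1/320 * t
    regroup = solve-∀ ℚ-ring

open Profiles

-- Choice of the parameters and the lower bound for the energy.

module Colorings where
  open import Data.Rational using (_+_; _*_; _-_; -_; _≤_; _<_)

  ι-^ : ∀ a n → ι a ^ℚ n ≡ ι (a ℕ.^ n)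
  ι-^ a zero    = refl
  ι-^ a (suc n) = trans (cong (ι a *_) (ι-^ a n)) (sym (ι-* a (a ℕ.^ n)))

  1^ℚ : ∀ n → 1ℚ ^ℚ n ≡ 1ℚ
  1^ℚ zero    = refl
  1^ℚ (suc n) = trans (ℚ.*-identityˡ (1ℚ ^ℚ n)) (1^ℚ n)

  -- As `5 ^ 5 = 3125 ≤ 4096 = 8 ^ 4`, a signing with more than four fifths of its pivots near 0
  -- would exceed the whole potential.
  score-bound : ∀ s M → 8 ℕ.^ s ℕ.≤ 5 ℕ.^ M → s ℕ.* 5 ℕ.≤ 4 ℕ.* M
  score-bound s M le with s ℕ.* 5 ℕ.≤? 4 ℕ.* M
  ... | yes ≤ = ≤
  ... | no  ≰ = contradiction (ℕ.^-monoʳ-< 8 (ℕ.s≤s (ℕ.s≤s ℕ.z≤n)) (ℕ.≰⇒> ≰)) (ℕ.≤⇒≯ (begin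
      8 ℕ.^ (s ℕ.* 5)   ≡⟨ sym (ℕ.^-*-assoc 8 s 5) ⟩
      (8 ℕ.^ s) ℕ.^ 5   ≤⟨ ℕ.^-monoˡ-≤ 5 le ⟩
      (5 ℕ.^ M) ℕ.^ 5   ≡⟨ trans (ℕ.^-*-assoc 5 M 5) (trans (cong (5 ℕ.^_) (ℕ.*-comm M 5)) (sym (ℕ.^-*-assoc 5 5 M))) ⟩
      3125 ℕ.^ M        ≤⟨ ℕ.^-monoˡ-≤ M (ℕ.m≤m+n 3125 971) ⟩
      4096 ℕ.^ M        ≡⟨ ℕ.^-*-assoc 8 4 M ⟩
      8 ℕ.^ (4 ℕ.* M)   ∎))
    where open ℕ.≤-Reasoning

  module Construction (e k : ℕ) (0<k : 0 ℕ.< k) where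

    -- `top` is the prescribed sum of the levels, and `depth` exceeds it so that every level fits.
    -- The extra 1 in `top` gives a factor 4, by which `size` is exactly half the trace
    -- `k ^ e * 4 ^ top` of `Γ`.
    depth top size : ℕ
    top   = suc (e ℕ.* k)
    depth = suc top
    size  = 2 ℕ.* (k ℕ.^ e ℕ.* 4 ℕ.^ (e ℕ.* k))

    grid : List (Vec (Word depth) (suc e))
    grid = tuples (words depth) (suc e)

    discrepancy : Measure (Vec (Word depth) (suc e)) → Vec (Word depth) (suc e) → ℚ
    discrepancy μ x = ∫ μ (λ p → product-matrix le p x)

    Γ : Kernel (Vec (Word depth) (suc e))
    Γ = tensor k (Tail.proj depth) e top

    σ : ℚ
    σ = (ι (16 ℕ.^ depth) * 1/320) ^ℚ suc e * 1/16 ^ℚ top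

    discrepancy≥ : ∀ μ → σ * quad Γ μ ≤ ∑ grid (λ x → discrepancy μ x * discrepancy μ x)
    discrepancy≥ μ = begin
        σ * quad Γ μ
          ≤⟨ quad-tensor-weighted k (Tail.isOrthogonalFamily depth) {κ = ratio depth}
               (0≤* (0≤ι (16 ℕ.^ depth)) 0≤1/320) 0≤1/16 (ratio-bound depth) e (ℕ.n≤1+n (e ℕ.* k)) ℕ.≤-refl μ ⟩
        quad (tensor k (λ b x y → ratio depth b * Tail.proj depth b x y) e top) μ
          ≡⟨ sym (quad-cong μ (pullback-tensor k {xs = words depth} {le} {Step.proj depth} {Tail.proj depth} {ratio depth}
               (pullback-step depth) e top)) ⟩
        quad (pullback grid (product-matrix le) (tensor k (Step.proj depth) e top)) μ
          ≡⟨ quad-pullback grid (product-matrix le) (tensor k (Step.proj depth) e top) μ ⟩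
        ∑ grid (λ x → ∑ grid (λ y → discrepancy μ x * discrepancy μ y * tensor k (Step.proj depth) e top x y))
          ≤⟨ bessel {xs = grid} (tensor-symmetric k (Step.isOrthogonalFamily depth) e top)
               (tensor-idempotent k (Step.isOrthogonalFamily depth) e top) (discrepancy μ) ⟩
        ∑ grid (λ x → discrepancy μ x * discrepancy μ x) ∎
      where open ℚ.≤-Reasoning

    0<size : 0 ℕ.< size
    0<size = ℕ.*-mono-≤ {1} {2} (ℕ.s≤s ℕ.z≤n) (ℕ.*-mono-≤ {1} (ℕ.m^n>0 k {{ℕ.>-nonZero 0<k}} e) (ℕ.m^n>0 4 (e ℕ.* k)))

    V : ℚ
    V = ι (length grid)

    length-grid : length grid ≡ (4 ℕ.^ depth) ℕ.^ suc e
    length-grid = trans (length-tuples (words depth) (suc e)) (cong (ℕ._^ suc e) (length-words depth))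

    0<V : 0ℚ < V
    0<V = ι-mono-< (subst (0 ℕ.<_) (sym length-grid)
      (ℕ.m^n>0 (4 ℕ.^ depth) {{ℕ.>-nonZero (ℕ.m^n>0 4 depth)}} (suc e)))

    σ-value : σ * (ι (320 ℕ.^ suc e) * ι (16 ℕ.^ top)) ≡ V * V
    σ-value = begin
        ρ ^ℚ suc e * 1/16 ^ℚ top * (ι (320 ℕ.^ suc e) * ι (16 ℕ.^ top))
          ≡⟨ cong₂ (λ a b → ρ ^ℚ suc e * 1/16 ^ℚ top * (a * b)) (sym (ι-^ 320 (suc e))) (sym (ι-^ 16 top)) ⟩
        ρ ^ℚ suc e * 1/16 ^ℚ top * (ι 320 ^ℚ suc e * ι 16 ^ℚ top)
          ≡⟨ regroup (ρ ^ℚ suc e) (1/16 ^ℚ top) (ι 320 ^ℚ suc e) (ι 16 ^ℚ top) ⟩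
        ρ ^ℚ suc e * ι 320 ^ℚ suc e * (1/16 ^ℚ top * ι 16 ^ℚ top)
          ≡⟨ cong₂ _*_ (sym (^ℚ-distrib-* ρ (ι 320) (suc e))) (sym (^ℚ-distrib-* 1/16 (ι 16) top)) ⟩
        (ρ * ι 320) ^ℚ suc e * 1ℚ ^ℚ top
          ≡⟨ cong₂ (λ a b → a ^ℚ suc e * b) (trans (cancel (ι (16 ℕ.^ depth))) (sym (width² depth))) (1^ℚ top) ⟩
        (width depth * width depth) ^ℚ suc e * 1ℚ
          ≡⟨ trans (ℚ.*-identityʳ _) (^ℚ-distrib-* (width depth) (width depth) (suc e)) ⟩
        width depth ^ℚ suc e * width depth ^ℚ suc e
          ≡⟨ cong (λ t → t * t) (trans (ι-^ (4 ℕ.^ depth) (suc e)) (cong ι (sym length-grid))) ⟩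
        V * V ∎
      where
      open ≡-Reasoning
      ρ = ι (16 ℕ.^ depth) * 1/320
      regroup : ∀ a b c d → a * b * (c * d) ≡ a * c * (b * d)
      regroup = solve-∀ ℚ-ring
      cancel : ∀ w → w * 1/320 * ι 320 ≡ w
      cancel = solve-∀ ℚ-ring

    private
      V⁻¹ = proj₁ (inverse V 0<V)
      VV⁻¹≡1 = proj₂ (proj₂ (inverse V 0<V))

    -- Chosen so that `V * 4 β = size`: one half of the trace guarantees pivots of at least `4 β`,
    -- the other half pays for `size` eliminations.
    β : ℚ
    β = ι size * V⁻¹ * (ℤ.1ℤ ℚ./ 4)

    0<β : 0ℚ < β
    0<β = 0<* (0<* (ι-mono-< 0<size) (proj₁ (proj₂ (inverse V 0<V)))) (ℚ.positive⁻¹ (ℤ.1ℤ ℚ./ 4))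

    4Vβ : V * (ι 4 * β) ≡ ι size
    4Vβ = trans (regroup V (ι size) V⁻¹) (trans (cong (ι size *_) VV⁻¹≡1) (ℚ.*-identityʳ (ι size)))
      where
      regroup : ∀ v s g → v * (ι 4 * (s * g * (ℤ.1ℤ ℚ./ 4))) ≡ s * (v * g)
      regroup = solve-∀ ℚ-ring

    2size : size ℕ.+ size ≡ k ℕ.^ e ℕ.* 4 ℕ.^ top
    2size = regroup (k ℕ.^ e) (4 ℕ.^ (e ℕ.* k))
      where
      regroup : ∀ a b → 2 ℕ.* (a ℕ.* b) ℕ.+ 2 ℕ.* (a ℕ.* b) ≡ a ℕ.* (4 ℕ.* b)
      regroup = ℕ-solve-∀

    selection : Selection Γ β size
    selection = select size {grid} (tensor-symmetric k (Tail.isOrthogonalFamily depth) e top)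
      (tensor-idempotent k (Tail.isOrthogonalFamily depth) e top) 0<β (ℚ.≤-reflexive (begin
        ∑ grid (λ _ → ι 4 * β) + ι size
          ≡⟨ cong (_+ ι size) (trans (∑-const grid (ι 4 * β)) 4Vβ) ⟩
        ι size + ι size
          ≡⟨ trans (sym (ι-+ size size)) (cong ι 2size) ⟩
        ι (k ℕ.^ e ℕ.* 4 ℕ.^ top)
          ≡⟨ sym (trace-tensor k {xs = words depth} (Tail.trace-proj depth) e (ℕ.n≤1+n (e ℕ.* k)) ℕ.≤-refl) ⟩
        trace grid Γ ∎))
      where open ≡-Reasoning

    open Selection selection using (points; size≤; injective) renaming (size to count) public

    -- At most four fifths of the pivots have a coefficient near 0, by `score-bound`; each of the
    -- others contributes `β`.
    quad≥ : ∀ χ → ι size * β ≤ ι 5 * quad Γ (signed points χ)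
    quad≥ χ = +-cancelʳ-≤ (ι 4 * (ι size * β)) (begin
        m * β + ι 4 * (m * β)
          ≡⟨ five (m * β) ⟩
        ι 5 * (m * β)
          ≤⟨ *-monoˡ (ι 5) (0≤ι 5) (Selection.bound selection χ) ⟩
        ι 5 * (q + β * ι s)
          ≡⟨ expand q β (ι s) ⟩
        ι 5 * q + β * (ι s * ι 5)
          ≤⟨ ℚ.+-monoʳ-≤ (ι 5 * q) (*-monoˡ β (ℚ.<⇒≤ 0<β) (subst₂ _≤_ (ι-* s 5) (ι-* 4 size) (ι-mono-≤ s≤))) ⟩
        ι 5 * q + β * (ι 4 * m)
          ≡⟨ cong (ι 5 * q +_) (regroup β (ι 4) m) ⟩
        ι 5 * q + ι 4 * (m * β) ∎)
      where
      open ℚ.≤-Reasoning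
      m = ι size
      q = quad Γ (signed points χ)
      s = Selection.score selection χ
      s≤ : s ℕ.* 5 ℕ.≤ 4 ℕ.* size
      s≤ = score-bound s size (ℕ.≤-trans (term≤sumSigns count (λ χ → 8 ℕ.^ Selection.score selection χ) χ) (Selection.total selection))
      five : ∀ t → t + ι 4 * t ≡ ι 5 * t
      five = solve-∀ ℚ-ring
      expand : ∀ q b s → ι 5 * (q + b * s) ≡ ι 5 * q + b * (s * ι 5)
      expand = solve-∀ ℚ-ring
      regroup : ∀ b c m → b * (c * m) ≡ c * (m * b)
      regroup = solve-∀ ℚ-ring

    -- Here `σ = V² / (320 ^ (e + 1) * 16 ^ top)`, and the form is at least
    -- `size * β / 5 = size² / (20 V)` with `size = k ^ e * 4 ^ top / 2`. The powers of 16 cancel,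
    -- and the factor 80 is `20 * 4`.
    energy≥ : ∀ χ → let D = discrepancy (signed points χ) in
      ι (k ℕ.^ e) * ι (k ℕ.^ e) * V ≤ ι (80 ℕ.* 320 ℕ.^ suc e) * ∑ grid (λ x → D x * D x)
    energy≥ χ = ℚ.*-cancelʳ-≤-pos (V * P) {{ℚ.positive (0<* 0<V (ι-mono-< (ℕ.m^n>0 16 top)))}} (begin
        κ * κ * V * (V * P)
          ≡⟨ cong (λ t → κ * κ * V * (V * t)) (sym (width² top)) ⟩
        κ * κ * V * (V * (width top * width top))
          ≡⟨ regroup₁ κ V (width top) ⟩
        κ * width top * (κ * width top) * (V * V)
          ≡⟨ cong (λ t → t * t * (V * V)) 2m ⟩
        (m + m) * (m + m) * (V * V)
          ≡⟨ cong (λ t → (m + m) * (t + t) * (V * V)) (sym 4Vβ) ⟩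
        (m + m) * (V * (ι 4 * β) + V * (ι 4 * β)) * (V * V)
          ≡⟨ regroup₂ m V β ⟩
        ι 16 * (V * (V * V)) * (m * β)
          ≤⟨ *-monoˡ (ι 16 * (V * (V * V))) (0≤* (0≤ι 16) (0≤* 0≤V (0≤* 0≤V 0≤V))) (quad≥ χ) ⟩
        ι 16 * (V * (V * V)) * (ι 5 * q)
          ≡⟨ cong (λ t → ι 16 * (V * t) * (ι 5 * q)) (sym σ-value) ⟩
        ι 16 * (V * (σ * (R * P))) * (ι 5 * q)
          ≡⟨ regroup₃ V σ R P q ⟩
        ι 80 * R * (V * P) * (σ * q)
          ≤⟨ *-monoˡ (ι 80 * R * (V * P)) (0≤* (0≤* (0≤ι 80) (0≤ι (320 ℕ.^ suc e))) (0≤* 0≤V (0≤ι (16 ℕ.^ top))))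
               (discrepancy≥ (signed points χ)) ⟩
        ι 80 * R * (V * P) * S
          ≡⟨ regroup₄ (ι 80) R (V * P) S ⟩
        ι 80 * R * S * (V * P)
          ≡⟨ cong (λ t → t * S * (V * P)) (sym (ι-* 80 (320 ℕ.^ suc e))) ⟩
        ι (80 ℕ.* 320 ℕ.^ suc e) * S * (V * P) ∎)
      where
      open ℚ.≤-Reasoning
      κ = ι (k ℕ.^ e)
      P = ι (16 ℕ.^ top)
      R = ι (320 ℕ.^ suc e)
      m = ι size
      q = quad Γ (signed points χ)
      S = ∑ grid (λ x → discrepancy (signed points χ) x * discrepancy (signed points χ) x)
      0≤V = ℚ.<⇒≤ 0<V
      2m : κ * width top ≡ m + m
      2m = trans (sym (ι-* (k ℕ.^ e) (4 ℕ.^ top))) (trans (cong ι (sym 2size)) (ι-+ size size))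
      regroup₁ : ∀ k v w → k * k * v * (v * (w * w)) ≡ k * w * (k * w) * (v * v)
      regroup₁ = solve-∀ ℚ-ring
      regroup₂ : ∀ m v b → (m + m) * (v * (ι 4 * b) + v * (ι 4 * b)) * (v * v) ≡ ι 16 * (v * (v * v)) * (m * b)
      regroup₂ = solve-∀ ℚ-ring
      regroup₃ : ∀ v s r p q → ι 16 * (v * (s * (r * p))) * (ι 5 * q) ≡ ι 80 * r * (v * p) * (s * q)
      regroup₃ = solve-∀ ℚ-ring
      regroup₄ : ∀ a r v s → a * r * v * s ≡ a * r * s * v
      regroup₄ = solve-∀ ℚ-ring

open Colorings

open import Defs

-- Square roots by bisection and bounds for the logarithm.

module Reals where

  abs-upper : ∀ {x y ε} → ℚ.∣ x ℚ.- y ∣ ℚ.< ε → x ℚ.≤ y ℚ.+ ε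
  abs-upper {x} {y} {ε} lt = begin
      x                       ≡⟨ lemma x y ⟩
      y ℚ.+ (x ℚ.- y)         ≤⟨ ℚ.+-monoʳ-≤ y (ℚ.≤-trans (p≤∣p∣ (x ℚ.- y)) (ℚ.<⇒≤ lt)) ⟩
      y ℚ.+ ε                 ∎
    where
    open ℚ.≤-Reasoning
    lemma : ∀ x y → x ≡ y ℚ.+ (x ℚ.- y)
    lemma = solve-∀ ℚ-ring
    p≤∣p∣ : ∀ p → p ℚ.≤ ℚ.∣ p ∣
    p≤∣p∣ p with ℚ.≤-total 0ℚ p
    ... | inj₁ 0≤p = ℚ.≤-reflexive (sym (ℚ.0≤p⇒∣p∣≡p 0≤p))
    ... | inj₂ p≤0 = ℚ.≤-trans p≤0 (ℚ.0≤∣p∣ p)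

  abs-lower : ∀ {x y ε} → ℚ.∣ x ℚ.- y ∣ ℚ.< ε → y ℚ.≤ x ℚ.+ ε
  abs-lower {x} {y} {ε} lt = abs-upper (subst (ℚ._< ε) (trans (sym (ℚ.∣-p∣≡∣p∣ (x ℚ.- y))) (cong ℚ.∣_∣ (lemma x y))) lt)
    where
    lemma : ∀ x y → ℚ.- (x ℚ.- y) ≡ y ℚ.- x
    lemma = solve-∀ ℚ-ring

  abs-between : ∀ {x y g} → x ℚ.≤ y ℚ.+ g → y ℚ.≤ x ℚ.+ g → ℚ.∣ x ℚ.- y ∣ ℚ.≤ g
  abs-between {x} {y} {g} x≤ y≤ with ℚ.∣p∣≡p∨∣p∣≡-p (x ℚ.- y)
  ... | inj₁ eq = subst (ℚ._≤ g) (sym eq) (≤-by (y ℚ.+ g ℚ.- x) (p-q≥0 x≤) (lemma x y g))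
    where
    lemma : ∀ x y g → x ℚ.- y ℚ.+ (y ℚ.+ g ℚ.- x) ≡ g
    lemma = solve-∀ ℚ-ring
  ... | inj₂ eq = subst (ℚ._≤ g) (sym eq) (≤-by (x ℚ.+ g ℚ.- y) (p-q≥0 y≤) (lemma x y g))
    where
    lemma : ∀ x y g → ℚ.- (x ℚ.- y) ℚ.+ (x ℚ.+ g ℚ.- y) ≡ g
    lemma = solve-∀ ℚ-ring

  archimedean : ∀ p → ∃ λ K → p ℚ.< ι K
  archimedean p@(ℚ.mkℚ i d _) = suc ℤ.∣ i ∣ , ℚ.toℚᵘ-cancel-< (ℚᵘ.<-respʳ-≃ (ℚᵘ.≃-sym (toℚᵘ-ι (suc ℤ.∣ i ∣)))
      (ℚᵘ.*<* (subst (ℤ._< ℤ.+ suc ℤ.∣ i ∣ ℤ.* ℤ.+ suc d) (sym (ℤ.*-identityʳ i)) (bound i))))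
    where
    bound : ∀ i → i ℤ.< ℤ.+ suc ℤ.∣ i ∣ ℤ.* ℤ.+ suc d
    bound (ℤ.+ n)      = subst (ℤ.+ n ℤ.<_) (ℤ.pos-* (suc n) (suc d)) (ℤ.+<+ (ℕ.m≤m*n (suc n) (suc d)))
    bound (ℤ.-[1+ n ]) = ℤ.-<+

  ½^-decay : ∀ n → ½ ^ℚ n ℚ.* ι (suc n) ℚ.≤ 1ℚ
  ½^-decay zero    = ℚ.≤-refl
  ½^-decay (suc n) = begin
      ½ ℚ.* ½ ^ℚ n ℚ.* ι (suc (suc n))                  ≡⟨ cong (½ ℚ.* ½ ^ℚ n ℚ.*_) (ι-suc (suc n)) ⟩
      ½ ℚ.* ½ ^ℚ n ℚ.* (1ℚ ℚ.+ ι (suc n))               ≡⟨ lemma (½ ^ℚ n) (ι (suc n)) ⟩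
      ½ ℚ.* (½ ^ℚ n ℚ.* 1ℚ ℚ.+ ½ ^ℚ n ℚ.* ι (suc n))
        ≤⟨ *-monoˡ ½ 0≤½ (ℚ.+-mono-≤ (ℚ.≤-trans (*-monoˡ (½ ^ℚ n) (0≤^ℚ 0≤½ n) (ι-mono-≤ (ℕ.s≤s (ℕ.z≤n {n})))) (½^-decay n)) (½^-decay n)) ⟩
      ½ ℚ.* (1ℚ ℚ.+ 1ℚ)                                 ≡⟨⟩
      1ℚ                                                ∎
    where
    open ℚ.≤-Reasoning
    0≤½ = ℚ.nonNegative⁻¹ ½
    lemma : ∀ h n → ½ ℚ.* h ℚ.* (1ℚ ℚ.+ n) ≡ ½ ℚ.* (h ℚ.* 1ℚ ℚ.+ h ℚ.* n)
    lemma = solve-∀ ℚ-ring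

  ½^-vanishes : ∀ c ε → 0ℚ ℚ.≤ c → 0ℚ ℚ.< ε → ∃ λ N → ∀ n → N ℕ.≤ n → c ℚ.* ½ ^ℚ n ℚ.< ε
  ½^-vanishes c ε 0≤c 0<ε = K , λ n K≤n → begin-strict
      c ℚ.* ½ ^ℚ n                          ≡⟨ trans (sym (ℚ.*-identityʳ _)) (trans (cong (c ℚ.* ½ ^ℚ n ℚ.*_) (sym ηε)) (regroup c (½ ^ℚ n) ε η)) ⟩
      c ℚ.* η ℚ.* (½ ^ℚ n ℚ.* ε)            <⟨ ℚ.*-monoˡ-<-pos (½ ^ℚ n ℚ.* ε) {{ℚ.positive (0<* (0<½^ n) 0<ε)}} cη<K ⟩
      ι K ℚ.* (½ ^ℚ n ℚ.* ε)                ≤⟨ *-monoʳ (½ ^ℚ n ℚ.* ε) (ℚ.<⇒≤ (0<* (0<½^ n) 0<ε)) (ι-mono-≤ (ℕ.m≤n⇒m≤1+n K≤n)) ⟩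
      ι (suc n) ℚ.* (½ ^ℚ n ℚ.* ε)          ≡⟨ regroup' (ι (suc n)) (½ ^ℚ n) ε ⟩
      ½ ^ℚ n ℚ.* ι (suc n) ℚ.* ε            ≤⟨ *-monoʳ ε (ℚ.<⇒≤ 0<ε) (½^-decay n) ⟩
      1ℚ ℚ.* ε                              ≡⟨ ℚ.*-identityˡ ε ⟩
      ε                                     ∎
    where
    open ℚ.≤-Reasoning
    η = proj₁ (inverse ε 0<ε)
    ηε : ε ℚ.* η ≡ 1ℚ
    ηε = proj₂ (proj₂ (inverse ε 0<ε))
    K = proj₁ (archimedean (c ℚ.* η))
    cη<K = proj₂ (archimedean (c ℚ.* η))
    0<½^ : ∀ n → 0ℚ ℚ.< ½ ^ℚ n
    0<½^ zero    = 0<1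
    0<½^ (suc n) = 0<* (ℚ.positive⁻¹ ½) (0<½^ n)
    regroup : ∀ c h e η → c ℚ.* h ℚ.* (e ℚ.* η) ≡ c ℚ.* η ℚ.* (h ℚ.* e)
    regroup = solve-∀ ℚ-ring
    regroup' : ∀ n h e → n ℚ.* (h ℚ.* e) ≡ h ℚ.* n ℚ.* e
    regroup' = solve-∀ ℚ-ring

  module SquareRoot (q : ℚ) (0≤q : 0ℚ ℚ.≤ q) where
    -- Bisection starts from `[0, 1 + q]`, as `q ≤ (1 + q)²`. All comparisons are between rationals,
    -- and the root stays between `low k` and `low k + gap k`.
    B = 1ℚ ℚ.+ q

    0≤B : 0ℚ ℚ.≤ B
    0≤B = 0≤+ (ℚ.<⇒≤ 0<1) 0≤q

    gap : ℕ → ℚ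
    gap k = B ℚ.* ½ ^ℚ k

    0≤gap : ∀ k → 0ℚ ℚ.≤ gap k
    0≤gap k = 0≤* 0≤B (0≤^ℚ (ℚ.nonNegative⁻¹ ½) k)

    gap-suc : ∀ k → gap (suc k) ℚ.+ gap (suc k) ≡ gap k
    gap-suc k = lemma B (½ ^ℚ k)
      where
      lemma : ∀ b h → b ℚ.* (½ ℚ.* h) ℚ.+ b ℚ.* (½ ℚ.* h) ≡ b ℚ.* h
      lemma = solve-∀ ℚ-ring

    refine : ∀ l g → Dec ((l ℚ.+ g) ℚ.* (l ℚ.+ g) ℚ.≤ q) → ℚ
    refine l g (yes _) = l ℚ.+ g
    refine l g (no _)  = l

    low : ℕ → ℚ
    low zero    = 0ℚ
    low (suc k) = refine (low k) (gap (suc k)) ((low k ℚ.+ gap (suc k)) ℚ.* (low k ℚ.+ gap (suc k)) ℚ.≤? q)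

    low-step : ∀ k → low k ℚ.≤ low (suc k)
    low-step k = go ((low k ℚ.+ gap (suc k)) ℚ.* (low k ℚ.+ gap (suc k)) ℚ.≤? q)
      where
      go : ∀ d → low k ℚ.≤ refine (low k) (gap (suc k)) d
      go (yes _) = ≤-by (gap (suc k)) (0≤gap (suc k)) refl
      go (no _)  = ℚ.≤-refl

    0≤low : ∀ k → 0ℚ ℚ.≤ low k
    0≤low zero    = ℚ.≤-refl
    0≤low (suc k) = ℚ.≤-trans (0≤low k) (low-step k)

    low² : ∀ k → low k ℚ.* low k ℚ.≤ q
    low² zero    = 0≤q
    low² (suc k) = go ((low k ℚ.+ gap (suc k)) ℚ.* (low k ℚ.+ gap (suc k)) ℚ.≤? q)
      where
      go : ∀ d → refine (low k) (gap (suc k)) d ℚ.* refine (low k) (gap (suc k)) d ℚ.≤ q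
      go (yes ≤q) = ≤q
      go (no _)   = low² k

    private
      +-halves : ∀ k → low k ℚ.+ gap (suc k) ℚ.+ gap (suc k) ≡ low k ℚ.+ gap k
      +-halves k = trans (ℚ.+-assoc (low k) (gap (suc k)) (gap (suc k))) (cong (low k ℚ.+_) (gap-suc k))

    high-step : ∀ k → low (suc k) ℚ.+ gap (suc k) ℚ.≤ low k ℚ.+ gap k
    high-step k = go ((low k ℚ.+ gap (suc k)) ℚ.* (low k ℚ.+ gap (suc k)) ℚ.≤? q)
      where
      go : ∀ d → refine (low k) (gap (suc k)) d ℚ.+ gap (suc k) ℚ.≤ low k ℚ.+ gap k
      go (yes _) = ℚ.≤-reflexive (+-halves k)
      go (no _)  = ≤-by (gap (suc k)) (0≤gap (suc k)) (+-halves k)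

    high² : ∀ k → q ℚ.≤ (low k ℚ.+ gap k) ℚ.* (low k ℚ.+ gap k)
    high² zero    = ≤-by (1ℚ ℚ.+ q ℚ.+ q ℚ.* q) (0≤+ 0≤B (0≤sq q)) (lemma q)
      where
      lemma : ∀ q → q ℚ.+ (1ℚ ℚ.+ q ℚ.+ q ℚ.* q) ≡ (0ℚ ℚ.+ (1ℚ ℚ.+ q) ℚ.* 1ℚ) ℚ.* (0ℚ ℚ.+ (1ℚ ℚ.+ q) ℚ.* 1ℚ)
      lemma = solve-∀ ℚ-ring
    high² (suc k) = go ((low k ℚ.+ gap (suc k)) ℚ.* (low k ℚ.+ gap (suc k)) ℚ.≤? q)
      where
      go : ∀ d → q ℚ.≤ (refine (low k) (gap (suc k)) d ℚ.+ gap (suc k)) ℚ.* (refine (low k) (gap (suc k)) d ℚ.+ gap (suc k))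
      go (yes _) = subst (λ t → q ℚ.≤ t ℚ.* t) (sym (+-halves k)) (high² k)
      go (no ≰q) = ℚ.<⇒≤ (ℚ.≰⇒> ≰q)

    low-ascend : ∀ {K k} → K ℕ.≤′ k → low K ℚ.≤ low k
    low-ascend ℕ.≤′-refl                = ℚ.≤-refl
    low-ascend {k = suc k} (ℕ.≤′-step p) = ℚ.≤-trans (low-ascend p) (low-step k)

    high-descend : ∀ {K k} → K ℕ.≤′ k → low k ℚ.+ gap k ℚ.≤ low K ℚ.+ gap K
    high-descend ℕ.≤′-refl                = ℚ.≤-refl
    high-descend {k = suc k} (ℕ.≤′-step p) = ℚ.≤-trans (high-step k) (high-descend p)

    low≤ : ∀ {K k} → K ℕ.≤ k → low k ℚ.≤ low K ℚ.+ gap K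
    low≤ {K} {k} K≤k = ℚ.≤-trans (≤-by (gap k) (0≤gap k) refl) (high-descend (ℕ.≤⇒≤′ K≤k))

    low-cauchy : IsCauchy low
    low-cauchy ε 0<ε = K , λ m n m≥ n≥ → ℚ.≤-<-trans
        (abs-between {low m} {low n} {gap K} (close m n m≥ n≥) (close n m n≥ m≥)) (proj₂ vanish K ℕ.≤-refl)
      where
      vanish = ½^-vanishes B ε 0≤B 0<ε
      K = proj₁ vanish
      close : ∀ m n → K ℕ.≤ m → K ℕ.≤ n → low m ℚ.≤ low n ℚ.+ gap K
      close m n m≥ n≥ = ℚ.≤-trans (low≤ m≥) (ℚ.+-monoˡ-≤ (gap K) (low-ascend (ℕ.≤⇒≤′ n≥)))

    sqrt : ℝ
    sqrt = mkℝ low low-cauchy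

    sqrt-isRoot : ∀ a → (∀ n → seq a n ≡ q) → IsRoot 2 a sqrt
    sqrt-isRoot a a≡q = (λ ε 0<ε → 0 , λ n _ → 0≤+ (0≤low n) (ℚ.<⇒≤ 0<ε)) , λ ε 0<ε →
      -- The squares of the two ends of the bracket differ by `(2 low + gap) gap`, which is at most
      -- `3 B gap`.
      let vanish = ½^-vanishes (ι 3 ℚ.* B ℚ.* B) ε (0≤* (0≤* (0≤ι 3) 0≤B) 0≤B) 0<ε in
      proj₁ vanish , λ n n≥ → ℚ.≤-<-trans (abs-between {low n ℚ.* (low n ℚ.* 1ℚ)} {seq a n} {ι 3 ℚ.* B ℚ.* gap n}
        (subst₂ (λ s t → s ℚ.≤ t ℚ.+ ι 3 ℚ.* B ℚ.* gap n) (cong (low n ℚ.*_) (sym (ℚ.*-identityʳ (low n)))) (sym (a≡q n))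
          (ℚ.≤-trans (low² n) (≤-by (ι 3 ℚ.* B ℚ.* gap n) (0≤* (0≤* (0≤ι 3) 0≤B) (0≤gap n)) refl)))
        (subst₂ (λ s t → t ℚ.≤ s ℚ.+ ι 3 ℚ.* B ℚ.* gap n) (cong (low n ℚ.*_) (sym (ℚ.*-identityʳ (low n)))) (sym (a≡q n))
          (q≤ n)))
        (subst (ℚ._< ε) (ℚ.*-assoc (ι 3 ℚ.* B) B (½ ^ℚ n)) (proj₂ vanish n n≥))
      where
      open ℚ.≤-Reasoning
      expand : ∀ l g → (l ℚ.+ g) ℚ.* (l ℚ.+ g) ≡ l ℚ.* l ℚ.+ (l ℚ.+ (l ℚ.+ g)) ℚ.* g
      expand = solve-∀ ℚ-ring
      three : ∀ b → b ℚ.+ (b ℚ.+ b) ≡ ι 3 ℚ.* b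
      three = solve-∀ ℚ-ring
      high≤B : ∀ n → low n ℚ.+ gap n ℚ.≤ B
      high≤B n = ℚ.≤-trans (high-descend {0} {n} (ℕ.≤⇒≤′ ℕ.z≤n)) (ℚ.≤-reflexive (trans (ℚ.+-identityˡ (B ℚ.* 1ℚ)) (ℚ.*-identityʳ B)))
      low≤B : ∀ n → low n ℚ.≤ B
      low≤B n = ℚ.≤-trans (≤-by (gap n) (0≤gap n) refl) (high≤B n)
      q≤ : ∀ n → q ℚ.≤ low n ℚ.* low n ℚ.+ ι 3 ℚ.* B ℚ.* gap n
      q≤ n = begin
        q                                                               ≤⟨ high² n ⟩
        (low n ℚ.+ gap n) ℚ.* (low n ℚ.+ gap n)                         ≡⟨ expand (low n) (gap n) ⟩
        low n ℚ.* low n ℚ.+ (low n ℚ.+ (low n ℚ.+ gap n)) ℚ.* gap n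
          ≤⟨ ℚ.+-monoʳ-≤ (low n ℚ.* low n) (*-monoʳ (gap n) (0≤gap n)
               (ℚ.≤-trans (ℚ.+-mono-≤ (low≤B n) (ℚ.≤-trans (high≤B n) (≤-by B 0≤B refl))) (ℚ.≤-reflexive (three B)))) ⟩
        low n ℚ.* low n ℚ.+ ι 3 ℚ.* B ℚ.* gap n ∎

    sqrt≥ : ∀ x {r} → (∀ n → seq x n ℚ.≤ r) → r ℚ.* r ℚ.≤ q → x ≤ sqrt
    sqrt≥ x {r} x≤r r²≤q ε 0<ε = let K , small = ½^-vanishes B ε 0≤B 0<ε in K , λ n n≥ →
      ℚ.≤-trans (x≤r n) (ℚ.≤-trans (sq-cancel-≤ (0≤+ (0≤low n) (0≤gap n)) (ℚ.≤-trans r²≤q (high² n)))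
        (ℚ.+-monoʳ-≤ (low n) (ℚ.<⇒≤ (small n n≥))))

    -- This serves the minimality of the discrepancy, where the root `v` and the inverse `u` are
    -- arbitrary reals, known only up to `_≈_`. Let `t = ε / 4`. An error `t²` in the square of `v`
    -- and an error `η` in the inverse, small enough that `η * q' ≤ t²`, give
    -- `low² ≤ v² + 2 t² ≤ (v + 4 t)²`, the last step by `v + t ≥ 0`.
    sqrt≤ : ∀ {q'} u v W S → q ℚ.≤ q' → (∀ n → seq W n ≡ 1ℚ) → (∀ n → seq S n ≡ q') →
      IsInverse W u → IsRoot 2 (u * S) v → sqrt ≤ v
    sqrt≤ {q'} u v W S q≤q' W≡1 S≡q' uW≈1 (0≤v , v²≈) ε 0<ε =
      let N₁ , h₁ = 0≤v t 0<t
          N₂ , h₂ = v²≈ (t ℚ.* t) 0<tt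
          N₃ , h₃ = uW≈1 η 0<η
      in (N₁ ℕ.⊔ N₂) ℕ.⊔ N₃ , λ n n≥ →
        let n≥₁₂ = ℕ.m⊔n≤o⇒m≤o (N₁ ℕ.⊔ N₂) N₃ n≥
        in bound (seq u n) (seq v n) n (h₁ n (ℕ.m⊔n≤o⇒m≤o N₁ N₂ n≥₁₂))
          (subst (λ s → seq u n ℚ.* s ℚ.≤ seq v n ℚ.* (seq v n ℚ.* 1ℚ) ℚ.+ t ℚ.* t) (S≡q' n)
            (abs-lower {seq v n ℚ.* (seq v n ℚ.* 1ℚ)} (h₂ n (ℕ.m⊔n≤o⇒n≤o N₁ N₂ n≥₁₂))))
          (subst (λ s → 1ℚ ℚ.≤ seq u n ℚ.* s ℚ.+ η) (W≡1 n)
            (abs-lower {seq u n ℚ.* seq W n} (h₃ n (ℕ.m⊔n≤o⇒n≤o (N₁ ℕ.⊔ N₂) N₃ n≥))))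
      where
      t = ℤ.1ℤ ℚ./ 4 ℚ.* ε
      0<t : 0ℚ ℚ.< t
      0<t = 0<* (ℚ.positive⁻¹ (ℤ.1ℤ ℚ./ 4)) 0<ε
      0<tt = 0<* 0<t 0<t
      0≤q' = ℚ.≤-trans 0≤q q≤q'
      0<B' : 0ℚ ℚ.< 1ℚ ℚ.+ q'
      0<B' = ℚ.<-≤-trans 0<1 (≤-by q' 0≤q' refl)
      g = proj₁ (inverse (1ℚ ℚ.+ q') 0<B')
      η = t ℚ.* t ℚ.* g
      0<η : 0ℚ ℚ.< η
      0<η = 0<* 0<tt (proj₁ (proj₂ (inverse (1ℚ ℚ.+ q') 0<B')))
      ηq'≤ : η ℚ.* q' ℚ.≤ t ℚ.* t
      ηq'≤ = ≤-by η (ℚ.<⇒≤ 0<η) (trans (factor η q') (trans (regroup (t ℚ.* t) g (1ℚ ℚ.+ q'))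
          (trans (cong (t ℚ.* t ℚ.*_) (proj₂ (proj₂ (inverse (1ℚ ℚ.+ q') 0<B')))) (ℚ.*-identityʳ (t ℚ.* t)))))
        where
        factor : ∀ η q → η ℚ.* q ℚ.+ η ≡ η ℚ.* (1ℚ ℚ.+ q)
        factor = solve-∀ ℚ-ring
        regroup : ∀ a g b → a ℚ.* g ℚ.* b ≡ a ℚ.* (b ℚ.* g)
        regroup = solve-∀ ℚ-ring
      bound : ∀ u v n → 0ℚ ℚ.≤ v ℚ.+ t → u ℚ.* q' ℚ.≤ v ℚ.* (v ℚ.* 1ℚ) ℚ.+ t ℚ.* t → 1ℚ ℚ.≤ u ℚ.* 1ℚ ℚ.+ η →
        low n ℚ.≤ v ℚ.+ ε
      bound u v n v+t≥0 uq'≤ 1≤ = subst (λ e → low n ℚ.≤ v ℚ.+ e) (four ε) (sq-cancel-≤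
          (ℚ.≤-trans v+t≥0 (≤-by (ι 3 ℚ.* t) (0≤* (0≤ι 3) (ℚ.<⇒≤ 0<t)) (split v t)))
          (begin
            low n ℚ.* low n
              ≤⟨ ℚ.≤-trans (low² n) q≤q' ⟩
            q'
              ≡⟨ sym (ℚ.*-identityˡ q') ⟩
            1ℚ ℚ.* q'
              ≤⟨ *-monoʳ q' 0≤q' 1≤ ⟩
            (u ℚ.* 1ℚ ℚ.+ η) ℚ.* q'
              ≡⟨ expand u η q' ⟩
            u ℚ.* q' ℚ.+ η ℚ.* q'
              ≤⟨ ℚ.+-mono-≤ uq'≤ ηq'≤ ⟩
            v ℚ.* (v ℚ.* 1ℚ) ℚ.+ t ℚ.* t ℚ.+ t ℚ.* t
              ≤⟨ ≤-by (ι 8 ℚ.* (t ℚ.* (v ℚ.+ t)) ℚ.+ ι 6 ℚ.* (t ℚ.* t))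
                   (0≤+ (0≤* (0≤ι 8) (0≤* (ℚ.<⇒≤ 0<t) v+t≥0)) (0≤* (0≤ι 6) (ℚ.<⇒≤ 0<tt))) (complete v t) ⟩
            (v ℚ.+ ι 4 ℚ.* t) ℚ.* (v ℚ.+ ι 4 ℚ.* t) ∎))
        where
        open ℚ.≤-Reasoning
        four : ∀ ε → ι 4 ℚ.* (ℤ.1ℤ ℚ./ 4 ℚ.* ε) ≡ ε
        four = solve-∀ ℚ-ring
        split : ∀ v t → v ℚ.+ t ℚ.+ ι 3 ℚ.* t ≡ v ℚ.+ ι 4 ℚ.* t
        split = solve-∀ ℚ-ring
        expand : ∀ u η q → (u ℚ.* 1ℚ ℚ.+ η) ℚ.* q ≡ u ℚ.* q ℚ.+ η ℚ.* q
        expand = solve-∀ ℚ-ring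
        complete : ∀ v t → v ℚ.* (v ℚ.* 1ℚ) ℚ.+ t ℚ.* t ℚ.+ t ℚ.* t ℚ.+ (ι 8 ℚ.* (t ℚ.* (v ℚ.+ t)) ℚ.+ ι 6 ℚ.* (t ℚ.* t)) ≡
          (v ℚ.+ ι 4 ℚ.* t) ℚ.* (v ℚ.+ ι 4 ℚ.* t)
        complete = solve-∀ ℚ-ring

  1/suc : ∀ j → ℤ.1ℤ ℚ./ suc j ℚ.* ι (suc j) ≡ 1ℚ
  1/suc j = ℚ.toℚᵘ-injective (ℚᵘ.≃-trans (ℚ.toℚᵘ-homo-* (ℤ.1ℤ ℚ./ suc j) (ι (suc j)))
    (ℚᵘ.≃-trans (ℚᵘ.*-cong (ℚ.toℚᵘ-fromℚᵘ (ℚᵘ.mkℚᵘ ℤ.1ℤ j)) (toℚᵘ-ι (suc j)))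
      (ℚᵘ.*≡* (trans (ℤ.*-identityʳ (ℤ.1ℤ ℤ.* ℤ.+ suc j)) (cong (λ n → ℤ.1ℤ ℤ.* ℤ.+ n) (sym (ℕ.*-identityʳ (suc j))))))))

  0≤1/suc : ∀ j → 0ℚ ℚ.≤ ℤ.1ℤ ℚ./ suc j
  0≤1/suc j = ℚ.nonNegative⁻¹ (ℤ.1ℤ ℚ./ suc j) {{ℚ.normalize-nonNeg 1 (suc j)}}

  sumℚ-+ : ∀ a b f → sumℚ (a ℕ.+ b) f ≡ sumℚ a f ℚ.+ sumℚ b (λ i → f (a ℕ.+ i))
  sumℚ-+ a zero    f = trans (cong (λ m → sumℚ m f) (ℕ.+-identityʳ a)) (sym (ℚ.+-identityʳ (sumℚ a f)))
  sumℚ-+ a (suc b) f = trans (cong (λ m → sumℚ m f) (ℕ.+-suc a b))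
    (trans (cong (ℚ._+ f (a ℕ.+ b)) (sumℚ-+ a b f)) (ℚ.+-assoc (sumℚ a f) _ (f (a ℕ.+ b))))

  sumℚ-≤ : ∀ m f c → (∀ i → f i ℚ.≤ c) → sumℚ m f ℚ.≤ ι m ℚ.* c
  sumℚ-≤ zero    f c f≤c = ℚ.≤-reflexive (sym (ℚ.*-zeroˡ c))
  sumℚ-≤ (suc m) f c f≤c = ℚ.≤-trans (ℚ.+-mono-≤ (sumℚ-≤ m f c f≤c) (f≤c m))
      (ℚ.≤-reflexive (trans (lemma (ι m) c) (cong (ℚ._* c) (sym (ι-suc m)))))
    where
    lemma : ∀ m c → m ℚ.* c ℚ.+ c ≡ (1ℚ ℚ.+ m) ℚ.* c
    lemma = solve-∀ ℚ-ring

  0≤sumℚ : ∀ m f → (∀ i → 0ℚ ℚ.≤ f i) → 0ℚ ℚ.≤ sumℚ m f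
  0≤sumℚ zero    f 0≤f = ℚ.≤-refl
  0≤sumℚ (suc m) f 0≤f = 0≤+ (0≤sumℚ m f 0≤f) (0≤f m)

  harmonic : ℕ → ℕ → ℚ
  harmonic N i = ℤ.1ℤ ℚ./ suc (N ℕ.+ i)

  harmonic-short : ∀ N m → 0 ℕ.< N → m ℕ.≤ N → sumℚ m (harmonic N) ℚ.≤ 1ℚ
  harmonic-short (suc N) m _ m≤N = ℚ.≤-trans (sumℚ-≤ m (harmonic (suc N)) r term)
      (ℚ.≤-trans (*-monoʳ r (0≤1/suc N) (ι-mono-≤ m≤N)) (ℚ.≤-reflexive (trans (ℚ.*-comm (ι (suc N)) r) (1/suc N))))
    where
    r = ℤ.1ℤ ℚ./ suc N
    term : ∀ i → harmonic (suc N) i ℚ.≤ r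
    term i = begin
        t                         ≡⟨ trans (sym (ℚ.*-identityʳ t)) (cong (t ℚ.*_) (sym (1/suc N))) ⟩
        t ℚ.* (r ℚ.* ι (suc N))   ≤⟨ *-monoˡ t (0≤1/suc (suc N ℕ.+ i)) (*-monoˡ r (0≤1/suc N)
                                       (ι-mono-≤ (ℕ.≤-trans (ℕ.m≤m+n (suc N) i) (ℕ.n≤1+n _)))) ⟩
        t ℚ.* (r ℚ.* ι (suc (suc N ℕ.+ i)))   ≡⟨ regroup t r (ι (suc (suc N ℕ.+ i))) ⟩
        r ℚ.* (t ℚ.* ι (suc (suc N ℕ.+ i)))   ≡⟨ trans (cong (r ℚ.*_) (1/suc (suc N ℕ.+ i))) (ℚ.*-identityʳ r) ⟩
        r                         ∎
      where
      open ℚ.≤-Reasoning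
      t = harmonic (suc N) i
      regroup : ∀ t r n → t ℚ.* (r ℚ.* n) ≡ r ℚ.* (t ℚ.* n)
      regroup = solve-∀ ℚ-ring

  -- Each of the ℓ dyadic blocks [N 2ⁱ, N 2ⁱ⁺¹) contributes at most 1.
  harmonic-bound : ∀ ℓ N m → 0 ℕ.< N → N ℕ.+ m ℕ.≤ N ℕ.* 2 ℕ.^ ℓ → sumℚ m (harmonic N) ℚ.≤ ι ℓ
  harmonic-bound zero    N m 0<N le = ℚ.≤-reflexive (cong (λ m → sumℚ m (harmonic N))
    (ℕ.n≤0⇒n≡0 (ℕ.+-cancelˡ-≤ N m 0 (ℕ.≤-trans le (ℕ.≤-reflexive (trans (ℕ.*-identityʳ N) (sym (ℕ.+-identityʳ N))))))))
  harmonic-bound (suc ℓ) N m 0<N le with ℕ.≤-total m N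
  ... | inj₁ m≤N = ℚ.≤-trans (harmonic-short N m 0<N m≤N) (ι-mono-≤ {1} {suc ℓ} (ℕ.s≤s ℕ.z≤n))
  ... | inj₂ N≤m = begin
      sumℚ m (harmonic N)
        ≡⟨ trans (cong (λ m → sumℚ m (harmonic N)) (sym (ℕ.m+[n∸m]≡n N≤m))) (sumℚ-+ N (m ℕ.∸ N) (harmonic N)) ⟩
      sumℚ N (harmonic N) ℚ.+ sumℚ (m ℕ.∸ N) (λ i → harmonic N (N ℕ.+ i))
        ≤⟨ ℚ.+-mono-≤ (harmonic-short N N 0<N ℕ.≤-refl) (ℚ.≤-trans (ℚ.≤-reflexive (sumℚ-cong (m ℕ.∸ N)
             (λ i → cong (λ j → ℤ.1ℤ ℚ./ suc j) (sym (ℕ.+-assoc N N i)))))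
             (harmonic-bound ℓ (N ℕ.+ N) (m ℕ.∸ N) (ℕ.≤-trans 0<N (ℕ.m≤m+n N N)) rest)) ⟩
      1ℚ ℚ.+ ι ℓ
        ≡⟨ sym (ι-suc ℓ) ⟩
      ι (suc ℓ) ∎
    where
    open ℚ.≤-Reasoning
    sumℚ-cong : ∀ m {f g} → (∀ i → f i ≡ g i) → sumℚ m f ≡ sumℚ m g
    sumℚ-cong zero    eq = refl
    sumℚ-cong (suc m) eq = cong₂ ℚ._+_ (sumℚ-cong m eq) (eq m)
    double : ∀ N p → N ℕ.* (2 ℕ.* p) ≡ (N ℕ.+ N) ℕ.* p
    double = ℕ-solve-∀
    rest : N ℕ.+ N ℕ.+ (m ℕ.∸ N) ℕ.≤ (N ℕ.+ N) ℕ.* 2 ℕ.^ ℓ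
    rest = subst₂ ℕ._≤_ (trans (cong (N ℕ.+_) (sym (ℕ.m+[n∸m]≡n N≤m))) (sym (ℕ.+-assoc N N (m ℕ.∸ N))))
      (double N (2 ℕ.^ ℓ)) le

  0≤logSum : ∀ n k → 0ℚ ℚ.≤ logSum n k
  0≤logSum n k = 0≤sumℚ ((n ℕ.∸ 1) ℕ.* 2 ℕ.^ k) _ (λ i → 0≤1/suc (2 ℕ.^ k ℕ.+ i))

  -- The Riemann sum of mesh `2⁻ᵏ` is the stretch of the harmonic series from `2 ^ k` to
  -- `n * 2 ^ k`, which lies in `ℓ` dyadic blocks.
  logSum≤ : ∀ {n} ℓ → n ℕ.≤ 2 ℕ.^ ℓ → ∀ k → logSum n k ℚ.≤ ι ℓ
  logSum≤ {zero}  ℓ n≤ k = 0≤ι ℓ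
  logSum≤ {suc n} ℓ n≤ k = harmonic-bound ℓ (2 ℕ.^ k) (n ℕ.* 2 ℕ.^ k) (ℕ.m^n>0 2 k)
    (ℕ.≤-trans (ℕ.*-monoˡ-≤ (2 ℕ.^ k) n≤) (ℕ.≤-reflexive (ℕ.*-comm (2 ℕ.^ ℓ) (2 ℕ.^ k))))

  seq-^-bound : ∀ x {b} n → 0ℚ ℚ.≤ b → 0ℚ ℚ.≤ seq x n → seq x n ℚ.≤ b → ∀ e → seq (x ^ e) n ℚ.≤ b ^ℚ e
  seq-^-bound x n 0≤b 0≤x x≤b zero    = ℚ.≤-refl
  seq-^-bound x n 0≤b 0≤x x≤b (suc e) = *-mono-≤ 0≤x (0≤^ℚ 0≤b e) x≤b (seq-^-bound x n 0≤b 0≤x x≤b e)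

open Reals

-- The order of words and the indicator of an anchored box.

module WordOrder where

  pos<4^ : ∀ {L} (p : Word L) → pos p ℕ.< 4 ℕ.^ L
  pos<4^ []              = ℕ.s≤s ℕ.z≤n
  pos<4^ {suc L} (c ∷ p) = ℕ.<-≤-trans (ℕ.+-monoʳ-< (Fin.toℕ c ℕ.* 4 ℕ.^ L) (pos<4^ p))
    (ℕ.≤-trans (ℕ.≤-reflexive (ℕ.+-comm _ (4 ℕ.^ L))) (ℕ.*-monoˡ-≤ (4 ℕ.^ L) (Fin.toℕ<n c)))

  pos-<-head : ∀ {L c d} (p x : Word L) → c Fin.< d → pos (c ∷ p) ℕ.< pos (d ∷ x)
  pos-<-head {L} {c} {d} p x c<d = ℕ.<-≤-trans (ℕ.+-monoʳ-< (Fin.toℕ c ℕ.* 4 ℕ.^ L) (pos<4^ p))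
    (ℕ.≤-trans (ℕ.≤-reflexive (ℕ.+-comm _ (4 ℕ.^ L))) (ℕ.≤-trans (ℕ.*-monoˡ-≤ (4 ℕ.^ L) c<d) (ℕ.m≤m+n _ (pos x))))

  pos-injective : ∀ {L} (p x : Word L) → pos p ≡ pos x → p ≡ x
  pos-injective []      []      _  = refl
  pos-injective {suc L} (c ∷ p) (d ∷ x) eq with Fin.<-cmp c d
  ... | tri< c<d _ _    = contradiction eq (ℕ.<⇒≢ (pos-<-head p x c<d))
  ... | tri≈ _ refl _   = cong (c ∷_) (pos-injective p x (ℕ.+-cancelˡ-≡ (Fin.toℕ c ℕ.* 4 ℕ.^ L) _ _ eq))
  ... | tri> _ _ d<c    = contradiction (sym eq) (ℕ.<⇒≢ (pos-<-head x p d<c))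

  fromPos : ∀ L j → j ℕ.< 4 ℕ.^ L → ∃ λ (p : Word L) → pos p ≡ j
  fromPos zero    zero _ = [] , refl
  fromPos zero    (suc j) (ℕ.s≤s ())
  fromPos (suc L) j j<  = Fin.fromℕ< q<4 ∷ proj₁ rec , (begin
      Fin.toℕ (Fin.fromℕ< q<4) ℕ.* 4 ℕ.^ L ℕ.+ pos (proj₁ rec)
        ≡⟨ cong₂ (λ a b → a ℕ.* 4 ℕ.^ L ℕ.+ b) (Fin.toℕ-fromℕ< q<4) (proj₂ rec) ⟩
      j / 4 ℕ.^ L ℕ.* 4 ℕ.^ L ℕ.+ j % 4 ℕ.^ L
        ≡⟨ ℕ.+-comm _ (j % 4 ℕ.^ L) ⟩
      j % 4 ℕ.^ L ℕ.+ j / 4 ℕ.^ L ℕ.* 4 ℕ.^ L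
        ≡⟨ sym (m≡m%n+[m/n]*n j (4 ℕ.^ L)) ⟩
      j ∎)
    where
    open ≡-Reasoning
    instance
      4^L≢0 : ℕ.NonZero (4 ℕ.^ L)
      4^L≢0 = ℕ.m^n≢0 4 L
    q<4 : j / 4 ℕ.^ L ℕ.< 4
    q<4 = m<n*o⇒m/o<n j<
    rec = fromPos L (j % 4 ℕ.^ L) (m%n<n j (4 ℕ.^ L))

  private
    lt-yes : ∀ {c d} → c Fin.< d → lt c d ≡ 1ℚ
    lt-yes {c} {d} c<d = cong (if_then 1ℚ else 0ℚ) (dec-true (c Fin.<? d) c<d)

    lt-no : ∀ {c d} → ¬ (c Fin.< d) → lt c d ≡ 0ℚ
    lt-no {c} {d} c≮d = cong (if_then 1ℚ else 0ℚ) (dec-false (c Fin.<? d) c≮d)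

  le-yes : ∀ {L} (p x : Word L) → pos p ℕ.≤ pos x → le p x ≡ 1ℚ
  le-yes []      []      _  = refl
  le-yes {suc L} (c ∷ p) (d ∷ x) p≤x with Fin.<-cmp c d
  ... | tri< c<d c≢d _  = trans (cong₂ (λ a b → a ℚ.+ b ℚ.* le p x) (lt-yes c<d) (δ-≢ c≢d)) (lemma (le p x))
    where
    lemma : ∀ t → 1ℚ ℚ.+ 0ℚ ℚ.* t ≡ 1ℚ
    lemma = solve-∀ ℚ-ring
  ... | tri≈ c≮c refl _ = trans (cong₂ (λ a b → a ℚ.+ b ℚ.* le p x) (lt-no c≮c) (δ-refl c))
      (cong (λ t → 0ℚ ℚ.+ 1ℚ ℚ.* t) (le-yes p x (ℕ.+-cancelˡ-≤ (Fin.toℕ c ℕ.* 4 ℕ.^ L) _ _ p≤x)))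
  ... | tri> _ _ d<c    = contradiction p≤x (ℕ.<⇒≱ (pos-<-head x p d<c))

  le-no : ∀ {L} (p x : Word L) → ¬ (pos p ℕ.≤ pos x) → le p x ≡ 0ℚ
  le-no []      []      p≰x = contradiction ℕ.z≤n p≰x
  le-no {suc L} (c ∷ p) (d ∷ x) p≰x with Fin.<-cmp c d
  ... | tri< c<d _ _    = contradiction (ℕ.<⇒≤ (pos-<-head p x c<d)) p≰x
  ... | tri≈ c≮c refl _ = trans (cong₂ (λ a b → a ℚ.+ b ℚ.* le p x) (lt-no c≮c) (δ-refl c))
      (cong (λ t → 0ℚ ℚ.+ 1ℚ ℚ.* t) (le-no p x (λ p≤x → p≰x (ℕ.+-monoʳ-≤ (Fin.toℕ c ℕ.* 4 ℕ.^ L) p≤x))))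
  ... | tri> c≮d c≢d _  = trans (cong₂ (λ a b → a ℚ.+ b ℚ.* le p x) (lt-no c≮d) (δ-≢ c≢d)) (lemma (le p x))
    where
    lemma : ∀ t → 0ℚ ℚ.+ 0ℚ ℚ.* t ≡ 0ℚ
    lemma = solve-∀ ℚ-ring

  Below : ∀ {L d} → Vec (Word L) d → Vec (Word L) d → Set
  Below p x = ∀ i → pos (lookup p i) ℕ.≤ pos (lookup x i)

  below? : ∀ {L d} (p x : Vec (Word L) d) → Dec (Below p x)
  below? p x = Fin.all? (λ i → pos (lookup p i) ℕ.≤? pos (lookup x i))

  product-yes : ∀ {L d} (p x : Vec (Word L) d) → Below p x → product-matrix le p x ≡ 1ℚ
  product-yes []      []      _   = refl
  product-yes (p ∷ v) (x ∷ w) p≤x = cong₂ ℚ._*_ (le-yes p x (p≤x zero)) (product-yes v w (λ i → p≤x (suc i)))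

  product-no : ∀ {L d} (p x : Vec (Word L) d) → ¬ Below p x → product-matrix le p x ≡ 0ℚ
  product-no []      []      p≰x = contradiction (λ ()) p≰x
  product-no (p ∷ v) (x ∷ w) p≰x with pos p ℕ.≤? pos x
  ... | yes p≤x = trans (cong (le p x ℚ.*_) (product-no v w (λ v≤w → p≰x λ { zero → p≤x ; (suc i) → v≤w i })))
                    (ℚ.*-zeroʳ (le p x))
  ... | no  p≰x = trans (cong (ℚ._* product-matrix le v w) (le-no p x p≰x)) (ℚ.*-zeroˡ (product-matrix le v w))

  product-matrix-le : ∀ {L d} (p x : Vec (Word L) d) → product-matrix le p x ≡ (if does (below? p x) then 1ℚ else 0ℚ)
  product-matrix-le p x = go (below? p x)
    where
    go : (d : Dec (Below p x)) → product-matrix le p x ≡ (if does d then 1ℚ else 0ℚ)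
    go (yes p≤x) = product-yes p x p≤x
    go (no  p≰x) = product-no p x p≰x

  ∈-tuples : ∀ {A : Set} {xs : List A} → (∀ x → x ∈ xs) → ∀ {n} (v : Vec A n) → v ∈ tuples xs n
  ∈-tuples all []      = here refl
  ∈-tuples all (x ∷ v) = ∈-cartesianProductWith⁺ _∷_ (all x) (∈-tuples all v)

  ∈-words : ∀ {L} (p : Word L) → p ∈ words L
  ∈-words = ∈-tuples ∈-digits

open WordOrder

-- Comparison of reals with rationals.

module RealOrder where

  half-pos : ∀ {ε} → 0ℚ ℚ.< ε → 0ℚ ℚ.< ½ ℚ.* ε
  half-pos = 0<* (ℚ.positive⁻¹ ½)

  half+half : ∀ x ε → x ℚ.+ ½ ℚ.* ε ℚ.+ ½ ℚ.* ε ≡ x ℚ.+ ε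
  half+half = solve-∀ ℚ-ring

  ≤ℝ-trans : ∀ x y z → x ≤ y → y ≤ z → x ≤ z
  ≤ℝ-trans x y z x≤y y≤z ε 0<ε =
    let M , h = x≤y (½ ℚ.* ε) (half-pos 0<ε)
        N , k = y≤z (½ ℚ.* ε) (half-pos 0<ε)
    in M ℕ.⊔ N , λ n n≥ → ℚ.≤-trans (h n (ℕ.m⊔n≤o⇒m≤o M N n≥))
      (ℚ.≤-trans (ℚ.+-monoˡ-≤ (½ ℚ.* ε) (k n (ℕ.m⊔n≤o⇒n≤o M N n≥))) (ℚ.≤-reflexive (half+half (seq z n) ε)))

  ≤ℝ-pointwise : ∀ x y → (∀ n → seq x n ℚ.≤ seq y n) → x ≤ y
  ≤ℝ-pointwise x y x≤y ε 0<ε = 0 , λ n _ → ℚ.≤-trans (x≤y n) (≤-by ε (ℚ.<⇒≤ 0<ε) refl)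

  fromℚ-mono-≤ : ∀ p q → p ℚ.≤ q → fromℚ p ≤ fromℚ q
  fromℚ-mono-≤ p q p≤q = ≤ℝ-pointwise (fromℚ p) (fromℚ q) (λ _ → p≤q)

  ≤-closed : ∀ {p q} → (∀ ε → 0ℚ ℚ.< ε → p ℚ.≤ q ℚ.+ ε) → p ℚ.≤ q
  ≤-closed {p} {q} h with p ℚ.≤? q
  ... | yes p≤q = p≤q
  ... | no  p≰q = contradiction (ℚ.≤-<-trans (h (½ ℚ.* (p ℚ.- q)) 0<ε) mid<p) (ℚ.<-irrefl refl)
    where
    0<p-q : 0ℚ ℚ.< p ℚ.- q
    0<p-q = subst (ℚ._< p ℚ.- q) (ℚ.+-inverseʳ q) (ℚ.+-monoˡ-< (ℚ.- q) (ℚ.≰⇒> p≰q))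
    0<ε = half-pos 0<p-q
    lemma : ∀ p q → q ℚ.+ ½ ℚ.* (p ℚ.- q) ℚ.+ ½ ℚ.* (p ℚ.- q) ≡ p
    lemma = solve-∀ ℚ-ring
    mid<p : q ℚ.+ ½ ℚ.* (p ℚ.- q) ℚ.< p
    mid<p = subst₂ ℚ._<_ (ℚ.+-identityʳ _) (lemma p q) (ℚ.+-monoʳ-< (q ℚ.+ ½ ℚ.* (p ℚ.- q)) 0<ε)

  fromℚ-cancel-≤ : ∀ p q → fromℚ p ≤ fromℚ q → p ℚ.≤ q
  fromℚ-cancel-≤ p q p≤q = ≤-closed (λ ε 0<ε → let N , h = p≤q ε 0<ε in h N ℕ.≤-refl)

  fromℚ-injective : ∀ p q → fromℚ p ≈ fromℚ q → p ≡ q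
  fromℚ-injective p q p≈q = ℚ.≤-antisym
    (≤-closed (λ ε 0<ε → let N , h = p≈q ε 0<ε in abs-upper {p} {q} (h N ℕ.≤-refl)))
    (≤-closed (λ ε 0<ε → let N , h = p≈q ε 0<ε in abs-lower {p} {q} (h N ℕ.≤-refl)))

  -- A term of `x` from which on the sequence moves by less than `ε / 2` can be compared with
  -- `q + ε / 2`: if it is larger, then `q ≤ x` after all; otherwise later terms stay below `q + ε`.
  ≰⇒≥ : ∀ q x → ¬ (fromℚ q ≤ x) → x ≤ fromℚ q
  ≰⇒≥ q x q≰x ε 0<ε = let N , h = cauchy x (½ ℚ.* ε) (half-pos 0<ε) in N , λ n n≥ →
    go N h n n≥ (seq x N ℚ.≤? q ℚ.+ ½ ℚ.* ε)
    where
    go : ∀ N → (∀ m n → N ℕ.≤ m → N ℕ.≤ n → ℚ.∣ seq x m ℚ.- seq x n ∣ ℚ.< ½ ℚ.* ε) →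
      ∀ n → N ℕ.≤ n → Dec (seq x N ℚ.≤ q ℚ.+ ½ ℚ.* ε) → seq x n ℚ.≤ q ℚ.+ ε
    go N h n n≥ (yes xN≤) = ℚ.≤-trans (abs-upper {seq x n} {seq x N} (h n N n≥ ℕ.≤-refl))
      (ℚ.≤-trans (ℚ.+-monoˡ-≤ (½ ℚ.* ε) xN≤) (ℚ.≤-reflexive (half+half q ε)))
    go N h n n≥ (no xN≰) = contradiction (λ ε' 0<ε' → N , λ m m≥ → ℚ.≤-trans {q} {seq x m}
        (+-cancelʳ-≤ (½ ℚ.* ε) (ℚ.≤-trans (ℚ.<⇒≤ (ℚ.≰⇒> xN≰)) (abs-upper {seq x N} {seq x m} (h N m ℕ.≤-refl m≥))))
        (≤-by ε' (ℚ.<⇒≤ 0<ε') refl)) q≰x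

open RealOrder

-- Covers by fattened grid cells and outer measure.

module Covers (L e : ℕ) where

  private d = suc e

  mesh : ℚ
  mesh = proj₁ (inverse (width L) (0<width L))

  0<mesh : 0ℚ ℚ.< mesh
  0<mesh = proj₁ (proj₂ (inverse (width L) (0<width L)))

  width*mesh : width L ℚ.* mesh ≡ 1ℚ
  width*mesh = proj₂ (proj₂ (inverse (width L) (0<width L)))

  mesh≤1 : mesh ℚ.≤ 1ℚ
  mesh≤1 = ℚ.≤-trans (ℚ.≤-reflexive (sym (ℚ.*-identityˡ mesh)))
    (ℚ.≤-trans (*-monoʳ mesh (ℚ.<⇒≤ 0<mesh) (ι-mono-≤ (ℕ.m^n>0 4 L))) (ℚ.≤-reflexive width*mesh))

  private
    distrib : ∀ j m → (1ℚ ℚ.+ j) ℚ.* m ≡ j ℚ.* m ℚ.+ m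
    distrib = solve-∀ ℚ-ring

  abstract
    corner : ℕ → ℚ
    corner j = ι j ℚ.* mesh

    corner-mono : ∀ {i j} → i ℕ.≤ j → corner i ℚ.≤ corner j
    corner-mono i≤j = *-monoʳ mesh (ℚ.<⇒≤ 0<mesh) (ι-mono-≤ i≤j)

    corner-cancel : ∀ {i j} → corner i ℚ.≤ corner j → i ℕ.≤ j
    corner-cancel i≤j = ι-cancel-≤ (ℚ.*-cancelʳ-≤-pos mesh {{ℚ.positive 0<mesh}} i≤j)

    corner-suc : ∀ j → corner (suc j) ≡ corner j ℚ.+ mesh
    corner-suc j = trans (cong (ℚ._* mesh) (ι-suc j)) (distrib (ι j) mesh)

    corner-zero : corner 0 ≡ 0ℚ
    corner-zero = ℚ.*-zeroˡ mesh

    corner-top : corner (4 ℕ.^ L) ≡ 1ℚ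
    corner-top = width*mesh

  0≤corner : ∀ j → 0ℚ ℚ.≤ corner j
  0≤corner j = ℚ.≤-trans (ℚ.≤-reflexive (sym corner-zero)) (corner-mono ℕ.z≤n)

  corner≤1 : ∀ {j} → j ℕ.≤ 4 ℕ.^ L → corner j ℚ.≤ 1ℚ
  corner≤1 j≤ = ℚ.≤-trans (corner-mono j≤) (ℚ.≤-reflexive corner-top)

  GridCell : Set
  GridCell = Vec (Word L) d

  Inside : Point d → GridCell → Set
  Inside x g = ∀ i → fromℚ (corner (pos (lookup g i))) ≤ x i × x i ≤ fromℚ (corner (suc (pos (lookup g i))))

  fatBox : ∀ η → 0ℚ ℚ.≤ η → GridCell → Box d
  fatBox η 0≤η g = record
    { lower = λ i → fromℚ (corner (pos (lookup g i)) ℚ.- η)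
    ; upper = λ i → fromℚ (corner (suc (pos (lookup g i))) ℚ.+ η)
    ; lower≤upper = λ i → fromℚ-mono-≤ (corner (pos (lookup g i)) ℚ.- η) (corner (suc (pos (lookup g i))) ℚ.+ η) (ℚ.≤-trans
        (≤-by η 0≤η (lemma (corner (pos (lookup g i))) η))
        (ℚ.≤-trans (corner-mono (ℕ.n≤1+n (pos (lookup g i)))) (≤-by η 0≤η refl))) }
    where
    lemma : ∀ c η → c ℚ.- η ℚ.+ η ≡ c
    lemma = solve-∀ ℚ-ring

  -- A single point, of volume 0 because the dimension is positive; it pads a finite cover to an
  -- infinite sequence.
  emptyBox : Box d
  emptyBox = record { lower = λ _ → 0ℝ ; upper = λ _ → 0ℝ ; lower≤upper = λ _ → fromℚ-mono-≤ 0ℚ 0ℚ ℚ.≤-refl }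

  seq-product : ∀ {n} (f : Fin n → ℝ) c j → (∀ i → seq (f i) j ≡ c) → seq (product f) j ≡ c ^ℚ n
  seq-product {zero}  f c j eq = refl
  seq-product {suc n} f c j eq = cong₂ ℚ._*_ (eq zero) (seq-product (λ i → f (suc i)) c j (λ i → eq (suc i)))

  abstract
    volumeℚ : Box d → ℕ → ℚ
    volumeℚ B j = seq (volume B) j

    volumeℚ≡ : ∀ (B : Box d) c j → (∀ i → seq (upper B i) j ℚ.- seq (lower B i) j ≡ c) → volumeℚ B j ≡ c ^ℚ d
    volumeℚ≡ B c j eq = seq-product (λ i → upper B i - lower B i) c j eq

    partialSum-volume : ∀ (B : ℕ → Box d) N j → seq (partialSum (λ k → volume (B k)) N) j ≡ sumℚ N (λ k → volumeℚ (B k) j)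
    partialSum-volume B zero    j = refl
    partialSum-volume B (suc N) j = cong (ℚ._+ seq (volume (B N)) j) (partialSum-volume B N j)

  volume-fatBox : ∀ η 0≤η g j → volumeℚ (fatBox η 0≤η g) j ≡ (mesh ℚ.+ (η ℚ.+ η)) ^ℚ d
  volume-fatBox η 0≤η g j = volumeℚ≡ (fatBox η 0≤η g) (mesh ℚ.+ (η ℚ.+ η)) j (λ i → trans
      (cong (λ c → c ℚ.+ η ℚ.- (corner (pos (lookup g i)) ℚ.- η)) (corner-suc (pos (lookup g i))))
      (lemma (corner (pos (lookup g i))) mesh η))
    where
    lemma : ∀ c m η → c ℚ.+ m ℚ.+ η ℚ.- (c ℚ.- η) ≡ m ℚ.+ (η ℚ.+ η)
    lemma = solve-∀ ℚ-ring

  volume-emptyBox : ∀ j → volumeℚ emptyBox j ≡ 0ℚ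
  volume-emptyBox j = trans (volumeℚ≡ emptyBox 0ℚ j (λ _ → refl)) (ℚ.*-zeroˡ (0ℚ ^ℚ e))

  boxes : List (Box d) → ℕ → Box d
  boxes []       k       = emptyBox
  boxes (B ∷ Bs) zero    = B
  boxes (B ∷ Bs) (suc k) = boxes Bs k

  sum-boxes : ∀ Bs {V} j → 0ℚ ℚ.≤ V → All (λ B → volumeℚ B j ≡ V) Bs → ∀ N →
    sumℚ N (λ k → volumeℚ (boxes Bs k) j) ℚ.≤ ι (length Bs) ℚ.* V
  sum-boxes Bs {V} j 0≤V eqs zero = 0≤* (0≤ι (length Bs)) 0≤V
  sum-boxes [] {V} j 0≤V [] (suc N) = ℚ.≤-trans
    (ℚ.+-mono-≤ (sum-boxes [] {V} j 0≤V [] N) (ℚ.≤-reflexive (volume-emptyBox j))) (ℚ.≤-reflexive (ℚ.+-identityʳ (0ℚ ℚ.* V)))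
  sum-boxes (B ∷ Bs) {V} j 0≤V (eq ∷ eqs) (suc N) = begin
      sumℚ (suc N) (λ k → volumeℚ (boxes (B ∷ Bs) k) j)
        ≡⟨ sumℚ-+ 1 N (λ k → volumeℚ (boxes (B ∷ Bs) k) j) ⟩
      0ℚ ℚ.+ volumeℚ B j ℚ.+ sumℚ N (λ k → volumeℚ (boxes Bs k) j)
        ≤⟨ ℚ.+-mono-≤ (ℚ.≤-reflexive (trans (ℚ.+-identityˡ (volumeℚ B j)) eq)) (sum-boxes Bs j 0≤V eqs N) ⟩
      V ℚ.+ ι (length Bs) ℚ.* V
        ≡⟨ trans (lemma V (ι (length Bs))) (cong (ℚ._* V) (sym (ι-suc (length Bs)))) ⟩
      ι (suc (length Bs)) ℚ.* V ∎
    where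
    open ℚ.≤-Reasoning
    lemma : ∀ V l → V ℚ.+ l ℚ.* V ≡ (1ℚ ℚ.+ l) ℚ.* V
    lemma = solve-∀ ℚ-ring

  -- The factor `3 ^ n` carries the induction, since `1 + 2 * 3 ^ n ≤ 3 ^ (n + 1)`.
  power-growth : ∀ {a t} → 0ℚ ℚ.≤ a → a ℚ.≤ 1ℚ → 0ℚ ℚ.≤ t → t ℚ.≤ 1ℚ → ∀ n →
    (a ℚ.+ t) ^ℚ n ℚ.≤ a ^ℚ n ℚ.+ ι (3 ℕ.^ n) ℚ.* t
  power-growth {a} {t} 0≤a a≤1 0≤t t≤1 zero = ≤-by (1ℚ ℚ.* t) (0≤* (ℚ.<⇒≤ 0<1) 0≤t) refl
  power-growth {a} {t} 0≤a a≤1 0≤t t≤1 (suc n) = begin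
      (a ℚ.+ t) ℚ.* (a ℚ.+ t) ^ℚ n
        ≤⟨ *-monoˡ (a ℚ.+ t) (0≤+ 0≤a 0≤t) (power-growth 0≤a a≤1 0≤t t≤1 n) ⟩
      (a ℚ.+ t) ℚ.* (a ^ℚ n ℚ.+ T ℚ.* t)
        ≡⟨ expand a t (a ^ℚ n) T ⟩
      a ℚ.* a ^ℚ n ℚ.+ (a ^ℚ n ℚ.+ (a ℚ.+ t) ℚ.* T) ℚ.* t
        ≤⟨ ℚ.+-monoʳ-≤ (a ℚ.* a ^ℚ n) (*-monoʳ t 0≤t (ℚ.+-mono-≤ (power≤1 n)
             (*-monoʳ T (0≤ι (3 ℕ.^ n)) (ℚ.+-mono-≤ a≤1 t≤1)))) ⟩
      a ℚ.* a ^ℚ n ℚ.+ (1ℚ ℚ.+ (1ℚ ℚ.+ 1ℚ) ℚ.* T) ℚ.* t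
        ≤⟨ ℚ.+-monoʳ-≤ (a ℚ.* a ^ℚ n) (*-monoʳ t 0≤t (ℚ.≤-trans
             (ℚ.+-monoˡ-≤ ((1ℚ ℚ.+ 1ℚ) ℚ.* T) (ι-mono-≤ (ℕ.m^n>0 3 n))) (ℚ.≤-reflexive (three T)))) ⟩
      a ℚ.* a ^ℚ n ℚ.+ ι 3 ℚ.* T ℚ.* t
        ≡⟨ cong (λ s → a ℚ.* a ^ℚ n ℚ.+ s ℚ.* t) (sym (ι-* 3 (3 ℕ.^ n))) ⟩
      a ^ℚ suc n ℚ.+ ι (3 ℕ.^ suc n) ℚ.* t ∎
    where
    open ℚ.≤-Reasoning
    T = ι (3 ℕ.^ n)
    expand : ∀ a t A T → (a ℚ.+ t) ℚ.* (A ℚ.+ T ℚ.* t) ≡ a ℚ.* A ℚ.+ (A ℚ.+ (a ℚ.+ t) ℚ.* T) ℚ.* t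
    expand = solve-∀ ℚ-ring
    three : ∀ T → T ℚ.+ (1ℚ ℚ.+ 1ℚ) ℚ.* T ≡ ι 3 ℚ.* T
    three = solve-∀ ℚ-ring
    power≤1 : ∀ n → a ^ℚ n ℚ.≤ 1ℚ
    power≤1 zero    = ℚ.≤-refl
    power≤1 (suc n) = *-mono-≤ 0≤a (ℚ.<⇒≤ 0<1) a≤1 (power≤1 n)

  fattening : ∀ l ε → 0ℚ ℚ.< ε → ∃ λ ζ → 0ℚ ℚ.< ζ ×
    ι l ℚ.* (mesh ℚ.+ (ι 3 ℚ.* ζ ℚ.+ ι 3 ℚ.* ζ)) ^ℚ d ℚ.≤ ι l ℚ.* mesh ^ℚ d ℚ.+ ε
  fattening l ε 0<ε = ζ , 0<* (ℚ.positive⁻¹ (ℤ.1ℤ ℚ./ 6)) 0<t , (begin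
      ι l ℚ.* (mesh ℚ.+ (ι 3 ℚ.* ζ ℚ.+ ι 3 ℚ.* ζ)) ^ℚ d
        ≡⟨ cong (λ s → ι l ℚ.* (mesh ℚ.+ s) ^ℚ d) (six t) ⟩
      ι l ℚ.* (mesh ℚ.+ t) ^ℚ d
        ≤⟨ *-monoˡ (ι l) (0≤ι l) (power-growth (ℚ.<⇒≤ 0<mesh) mesh≤1 (ℚ.<⇒≤ 0<t) t≤1 d) ⟩
      ι l ℚ.* (mesh ^ℚ d ℚ.+ ι (3 ℕ.^ d) ℚ.* t)
        ≡⟨ expand (ι l) (mesh ^ℚ d) (ι (3 ℕ.^ d)) t ⟩
      ι l ℚ.* mesh ^ℚ d ℚ.+ ι l ℚ.* ι (3 ℕ.^ d) ℚ.* t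
        ≤⟨ ℚ.+-monoʳ-≤ (ι l ℚ.* mesh ^ℚ d) (ℚ.≤-trans (*-monoʳ {ι l ℚ.* ι (3 ℕ.^ d)} {c} t (ℚ.<⇒≤ 0<t) (≤-by 1ℚ (ℚ.<⇒≤ 0<1) refl)) ct≤ε) ⟩
      ι l ℚ.* mesh ^ℚ d ℚ.+ ε ∎)
    where
    open ℚ.≤-Reasoning
    -- The summand 1 makes `c` at least 1 even for `l = 0`. Together with the minimum of `ε` and 1
    -- it yields `t ≤ 1`, which `power-growth` requires.
    c = ι l ℚ.* ι (3 ℕ.^ d) ℚ.+ 1ℚ
    0≤c-1 : 0ℚ ℚ.≤ ι l ℚ.* ι (3 ℕ.^ d)
    0≤c-1 = 0≤* (0≤ι l) (0≤ι (3 ℕ.^ d))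
    1≤c : 1ℚ ℚ.≤ c
    1≤c = ≤-by (ι l ℚ.* ι (3 ℕ.^ d)) 0≤c-1 (ℚ.+-comm 1ℚ (ι l ℚ.* ι (3 ℕ.^ d)))
    0<c = ℚ.<-≤-trans 0<1 1≤c
    g = proj₁ (inverse c 0<c)
    0<g = proj₁ (proj₂ (inverse c 0<c))
    cg≡1 = proj₂ (proj₂ (inverse c 0<c))
    ε₁ = ε ℚ.⊓ 1ℚ
    0<ε₁ : 0ℚ ℚ.< ε₁
    0<ε₁ with ℚ.⊓-sel ε 1ℚ
    ... | inj₁ eq = subst (0ℚ ℚ.<_) (sym eq) 0<ε
    ... | inj₂ eq = subst (0ℚ ℚ.<_) (sym eq) 0<1
    t = ε₁ ℚ.* g
    0<t : 0ℚ ℚ.< t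
    0<t = 0<* 0<ε₁ 0<g
    regroup : ∀ c e g → c ℚ.* (e ℚ.* g) ≡ e ℚ.* (c ℚ.* g)
    regroup = solve-∀ ℚ-ring
    ct≡ : c ℚ.* t ≡ ε₁
    ct≡ = trans (regroup c ε₁ g) (trans (cong (ε₁ ℚ.*_) cg≡1) (ℚ.*-identityʳ ε₁))
    ct≤ε : c ℚ.* t ℚ.≤ ε
    ct≤ε = ℚ.≤-trans (ℚ.≤-reflexive ct≡) (ℚ.p⊓q≤p ε 1ℚ)
    t≤1 : t ℚ.≤ 1ℚ
    t≤1 = ℚ.≤-trans (ℚ.≤-reflexive (sym (ℚ.*-identityˡ t))) (ℚ.≤-trans (*-monoʳ t (ℚ.<⇒≤ 0<t) 1≤c)
      (ℚ.≤-trans (ℚ.≤-reflexive ct≡) (ℚ.p⊓q≤q ε 1ℚ)))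
    ζ = ℤ.1ℤ ℚ./ 6 ℚ.* t
    six : ∀ t → ι 3 ℚ.* (ℤ.1ℤ ℚ./ 6 ℚ.* t) ℚ.+ ι 3 ℚ.* (ℤ.1ℤ ℚ./ 6 ℚ.* t) ≡ t
    six = solve-∀ ℚ-ring
    expand : ∀ l m T t → l ℚ.* (m ℚ.+ T ℚ.* t) ≡ l ℚ.* m ℚ.+ l ℚ.* T ℚ.* t
    expand = solve-∀ ℚ-ring

  -- Which cell contains a real point is undecidable, but which fattened cells contain a
  -- rational approximation of the point is decidable.
  locate : ∀ ζ (0<ζ : 0ℚ ℚ.< ζ) (0≤η : 0ℚ ℚ.≤ ι 3 ℚ.* ζ) (gs : List GridCell) (x : Point d) →
    ¬ ¬ Any (Inside x) gs → Any (λ g → x ∈ᴮ fatBox (ι 3 ℚ.* ζ) 0≤η g) gs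
  locate ζ 0<ζ 0≤η gs x ¬¬inside = Any.map (λ {g} → near⇒fat {g}) (decidable-stable (any? nearCell? gs)
    (λ ¬near → ¬¬inside (λ inside → ¬near (Any.map (λ {g} → inside⇒near {g}) inside))))
    where
    N : Fin d → ℕ
    N i = proj₁ (cauchy (x i) ζ 0<ζ)
    y : Fin d → ℚ
    y i = seq (x i) (N i)
    close : ∀ i n → N i ℕ.≤ n → ℚ.∣ y i ℚ.- seq (x i) n ∣ ℚ.< ζ
    close i n n≥ = proj₂ (cauchy (x i) ζ 0<ζ) (N i) n ℕ.≤-refl n≥
    -- The comparison of reals and the approximation of `x` cost `ζ` each, hence `2 ζ` here;
    -- returning from the approximation to `x` costs another `ζ`, hence the margin `3 ζ` of the
    -- boxes.
    Near : GridCell → Set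
    Near g = ∀ i → corner (pos (lookup g i)) ℚ.≤ y i ℚ.+ (ζ ℚ.+ ζ) × y i ℚ.≤ corner (suc (pos (lookup g i))) ℚ.+ (ζ ℚ.+ ζ)
    nearCell? : ∀ g → Dec (Near g)
    nearCell? g = Fin.all? (λ i → (_ ℚ.≤? _) ×-dec (_ ℚ.≤? _))
    inside⇒near : ∀ {g} → Inside x g → Near g
    inside⇒near {g} inside i =
      (let M , h = proj₁ (inside i) ζ 0<ζ ; n = M ℕ.⊔ N i in begin
        corner (pos (lookup g i))          ≤⟨ h n (ℕ.m≤m⊔n M (N i)) ⟩
        seq (x i) n ℚ.+ ζ                  ≤⟨ ℚ.+-monoˡ-≤ ζ (abs-lower {y i} {seq (x i) n} (close i n (ℕ.m≤n⊔m M (N i)))) ⟩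
        y i ℚ.+ ζ ℚ.+ ζ                    ≡⟨ ℚ.+-assoc (y i) ζ ζ ⟩
        y i ℚ.+ (ζ ℚ.+ ζ)                  ∎) ,
      (let M , h = proj₂ (inside i) ζ 0<ζ ; n = M ℕ.⊔ N i ; c = corner (suc (pos (lookup g i))) in begin
        y i                                ≤⟨ abs-upper {y i} {seq (x i) n} (close i n (ℕ.m≤n⊔m M (N i))) ⟩
        seq (x i) n ℚ.+ ζ                  ≤⟨ ℚ.+-monoˡ-≤ ζ (h n (ℕ.m≤m⊔n M (N i))) ⟩
        c ℚ.+ ζ ℚ.+ ζ                      ≡⟨ ℚ.+-assoc c ζ ζ ⟩
        c ℚ.+ (ζ ℚ.+ ζ)                    ∎)
      where open ℚ.≤-Reasoning
    near⇒fat : ∀ {g} → Near g → x ∈ᴮ fatBox (ι 3 ℚ.* ζ) 0≤η g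
    near⇒fat {g} near i =
      (λ ε 0<ε → N i , λ n n≥ → begin
        c ℚ.- ι 3 ℚ.* ζ                                  ≤⟨ ℚ.+-monoˡ-≤ (ℚ.- (ι 3 ℚ.* ζ)) (proj₁ (near i)) ⟩
        y i ℚ.+ (ζ ℚ.+ ζ) ℚ.- ι 3 ℚ.* ζ                  ≤⟨ ℚ.+-monoˡ-≤ (ℚ.- (ι 3 ℚ.* ζ)) (ℚ.+-monoˡ-≤ (ζ ℚ.+ ζ)
                                                              (abs-upper {y i} {seq (x i) n} (close i n n≥))) ⟩
        seq (x i) n ℚ.+ ζ ℚ.+ (ζ ℚ.+ ζ) ℚ.- ι 3 ℚ.* ζ    ≡⟨ cancel (seq (x i) n) ζ ⟩
        seq (x i) n                                      ≤⟨ ≤-by ε (ℚ.<⇒≤ 0<ε) refl ⟩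
        seq (x i) n ℚ.+ ε                                ∎) ,
      (λ ε 0<ε → N i , λ n n≥ → begin
        seq (x i) n                                      ≤⟨ abs-lower {y i} {seq (x i) n} (close i n n≥) ⟩
        y i ℚ.+ ζ                                        ≤⟨ ℚ.+-monoˡ-≤ ζ (proj₂ (near i)) ⟩
        c' ℚ.+ (ζ ℚ.+ ζ) ℚ.+ ζ                           ≡⟨ collect c' ζ ⟩
        c' ℚ.+ ι 3 ℚ.* ζ                                 ≤⟨ ≤-by ε (ℚ.<⇒≤ 0<ε) refl ⟩
        c' ℚ.+ ι 3 ℚ.* ζ ℚ.+ ε                           ∎)
      where
      open ℚ.≤-Reasoning
      c = corner (pos (lookup g i))
      c' = corner (suc (pos (lookup g i)))
      cancel : ∀ x ζ → x ℚ.+ ζ ℚ.+ (ζ ℚ.+ ζ) ℚ.- ι 3 ℚ.* ζ ≡ x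
      cancel = solve-∀ ℚ-ring
      collect : ∀ x ζ → x ℚ.+ (ζ ℚ.+ ζ) ℚ.+ ζ ≡ x ℚ.+ ι 3 ℚ.* ζ
      collect = solve-∀ ℚ-ring

  -- A real point is known to lie in one of the cells only up to double negation. Fattening the
  -- cells turns this into an explicit index, and the additional volume is at most the rational `ε₀`
  -- that witnesses `0 < ε`.
  outerMeasure-cells : ∀ {S : Point d → Set} (gs : List GridCell) r →
    (∀ x → S x → ¬ ¬ Any (Inside x) gs) → (∀ n → ι (length gs) ℚ.* mesh ^ℚ d ℚ.≤ seq r n) → OuterMeasure≤ S r
  outerMeasure-cells gs r inside r≥ ε (ε₀ , 0<ε₀ , N₀ , ε≥) =
    boxes Bs , (λ x Sx → index x gs (locate ζ 0<ζ 0≤η gs x (inside x Sx))) ,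
    λ N ε' 0<ε' → N₀ , λ n n≥ → begin
      seq (partialSum (λ k → volume (boxes Bs k)) N) n
        ≡⟨ partialSum-volume (boxes Bs) N n ⟩
      sumℚ N (λ k → volumeℚ (boxes Bs k) n)
        ≤⟨ sum-boxes Bs n (0≤^ℚ (0≤+ (ℚ.<⇒≤ 0<mesh) (0≤+ 0≤η 0≤η)) d) (volumes n gs) N ⟩
      ι (length Bs) ℚ.* (mesh ℚ.+ (ι 3 ℚ.* ζ ℚ.+ ι 3 ℚ.* ζ)) ^ℚ d
        ≡⟨ cong (λ l → ι l ℚ.* (mesh ℚ.+ (ι 3 ℚ.* ζ ℚ.+ ι 3 ℚ.* ζ)) ^ℚ d) (length-map (fatBox (ι 3 ℚ.* ζ) 0≤η) gs) ⟩
      ι (length gs) ℚ.* (mesh ℚ.+ (ι 3 ℚ.* ζ ℚ.+ ι 3 ℚ.* ζ)) ^ℚ d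
        ≤⟨ proj₂ (proj₂ fat) ⟩
      ι (length gs) ℚ.* mesh ^ℚ d ℚ.+ ε₀
        ≤⟨ ℚ.+-mono-≤ (r≥ n) (ℚ.≤-trans (ℚ.≤-reflexive (sym (ℚ.+-identityˡ ε₀))) (ε≥ n n≥)) ⟩
      seq r n ℚ.+ seq ε n
        ≤⟨ ≤-by ε' (ℚ.<⇒≤ 0<ε') refl ⟩
      seq r n ℚ.+ seq ε n ℚ.+ ε' ∎
    where
    open ℚ.≤-Reasoning
    fat = fattening (length gs) ε₀ 0<ε₀
    ζ = proj₁ fat
    0<ζ = proj₁ (proj₂ fat)
    0≤η : 0ℚ ℚ.≤ ι 3 ℚ.* ζ
    0≤η = 0≤* (0≤ι 3) (ℚ.<⇒≤ 0<ζ)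
    Bs = map (fatBox (ι 3 ℚ.* ζ) 0≤η) gs
    volumes : ∀ n gs → All (λ B → volumeℚ B n ≡ (mesh ℚ.+ (ι 3 ℚ.* ζ ℚ.+ ι 3 ℚ.* ζ)) ^ℚ d) (map (fatBox (ι 3 ℚ.* ζ) 0≤η) gs)
    volumes n []       = []
    volumes n (g ∷ gs) = volume-fatBox (ι 3 ℚ.* ζ) 0≤η g n ∷ volumes n gs
    index : ∀ x gs → Any (λ g → x ∈ᴮ fatBox (ι 3 ℚ.* ζ) 0≤η g) gs →
      ∃ λ k → x ∈ᴮ boxes (map (fatBox (ι 3 ℚ.* ζ) 0≤η) gs) k
    index x (g ∷ gs) (here x∈)  = 0 , x∈
    index x (g ∷ gs) (there x∈) = let k , x∈B = index x gs x∈ in suc k , x∈B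

-- The half-open grid cell of a real point, up to double negation.

module Slots (L e : ℕ) where
  open Covers L e

  -- Closed cells overlap in their faces, where the anchored boxes of different cells differ. The
  -- maximality clause makes the slot half-open, except that the last one contains 1, so that it
  -- determines which grid corners are at most `x`.
  InSlot : ℝ → Word L → Set
  InSlot x p = fromℚ (corner (pos p)) ≤ x × x ≤ fromℚ (corner (suc (pos p))) ×
    (∀ j → j ℕ.< 4 ℕ.^ L → fromℚ (corner j) ≤ x → j ℕ.≤ pos p)

  -- Whether a corner is at most a real is undecidable, so the search uses excluded middle under a
  -- double negation. The conclusions drawn from it later are decidable, so the double negation can
  -- be removed from them.
  ¬¬-largest : (P : ℕ → Set) → P 0 → ∀ n → ¬ ¬ ∃ λ j → j ℕ.≤ n × P j × (∀ i → i ℕ.≤ n → P i → i ℕ.≤ j)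
  ¬¬-largest P P₀ zero    ¬ex = ¬ex (0 , ℕ.z≤n , P₀ , λ i i≤0 _ → i≤0)
  ¬¬-largest P P₀ (suc n) ¬ex = ¬¬-excluded-middle λ
    { (yes p) → ¬ex (suc n , ℕ.≤-refl , p , λ i i≤ _ → i≤)
    ; (no ¬p) → ¬¬-largest P P₀ n λ (j , j≤n , Pj , max) → ¬ex (j , ℕ.m≤n⇒m≤1+n j≤n , Pj , λ i i≤ Pi →
        max i (ℕ.s≤s⁻¹ (ℕ.≤∧≢⇒< i≤ (λ i≡ → ¬p (subst P i≡ Pi)))) Pi) }

  ¬¬-slot : ∀ x → 0ℝ ≤ x → x ≤ 1ℝ → ¬ ¬ ∃ (InSlot x)
  ¬¬-slot x 0≤x x≤1 ¬ex = ¬¬-largest (λ j → fromℚ (corner j) ≤ x)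
      (≤ℝ-trans (fromℚ (corner 0)) 0ℝ x (fromℚ-mono-≤ (corner 0) 0ℚ (ℚ.≤-reflexive corner-zero)) 0≤x) top found
    where
    top = ℕ.pred (4 ℕ.^ L)
    suc-top : suc top ≡ 4 ℕ.^ L
    suc-top = ℕ.suc-pred (4 ℕ.^ L) {{ℕ.m^n≢0 4 L}}
    found : ¬ (∃ λ j → j ℕ.≤ top × fromℚ (corner j) ≤ x × (∀ i → i ℕ.≤ top → fromℚ (corner i) ≤ x → i ℕ.≤ j))
    found (j , j≤top , j≤x , max) = ¬ex (proj₁ word , subst Slot (sym (proj₂ word)) (j≤x , x≤ , λ i i< → max i (ℕ.s≤s⁻¹ (ℕ.≤-trans i< (ℕ.≤-reflexive (sym suc-top))))))
      where
      Slot : ℕ → Set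
      Slot j = fromℚ (corner j) ≤ x × x ≤ fromℚ (corner (suc j)) × (∀ i → i ℕ.< 4 ℕ.^ L → fromℚ (corner i) ≤ x → i ℕ.≤ j)
      word = fromPos L j (ℕ.≤-trans (ℕ.s≤s j≤top) (ℕ.≤-reflexive suc-top))
      x≤ : x ≤ fromℚ (corner (suc j))
      x≤ with suc j ℕ.≤? top
      ... | yes j<top = ≰⇒≥ (corner (suc j)) x (λ le → ℕ.1+n≰n (max (suc j) j<top le))
      ... | no  j≮top = ≤ℝ-trans x 1ℝ (fromℚ (corner (suc j))) x≤1 (fromℚ-mono-≤ 1ℚ (corner (suc j)) (ℚ.≤-trans
              (ℚ.≤-reflexive (sym corner-top)) (corner-mono (ℕ.≤-trans (ℕ.≤-reflexive (sym suc-top)) (ℕ.≰⇒> j≮top)))))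

  ¬¬-slots : ∀ {d} (x : Point d) → UnitCube x → ¬ ¬ ∃ λ (g : Vec (Word L) d) → ∀ i → InSlot (x i) (lookup g i)
  ¬¬-slots {zero}  x x∈ ¬ex = ¬ex ([] , λ ())
  ¬¬-slots {suc d} x x∈ ¬ex = ¬¬-slot (x zero) (proj₁ (x∈ zero)) (proj₂ (x∈ zero)) λ (p , slot) →
    ¬¬-slots (λ i → x (suc i)) (λ i → x∈ (suc i)) λ (g , slots) →
      ¬ex (p ∷ g , λ { zero → slot ; (suc i) → slots i })

-- The anchored set system of grid points, its weights and its discrepancy.

module AnchoredSystem (L e : ℕ) {n : ℕ} (ps : Vec (Vec (Word L) (suc e)) n)
  (ps-distinct : ∀ u v → lookup ps u ≡ lookup ps v → u ≡ v) where
  open Covers L e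
  open Slots L e

  private d = suc e

  allCells : List GridCell
  allCells = tuples (words L) d

  coordinates : GridCell → Point d
  coordinates g i = fromℚ (corner (pos (lookup g i)))

  coordinates∈cube : ∀ g → UnitCube (coordinates g)
  coordinates∈cube g i = fromℚ-mono-≤ 0ℚ (corner (pos (lookup g i))) (0≤corner (pos (lookup g i))) ,
    fromℚ-mono-≤ (corner (pos (lookup g i))) 1ℚ (corner≤1 (ℕ.<⇒≤ (pos<4^ (lookup g i))))

  coordinates-inSlot : ∀ g i → InSlot (coordinates g i) (lookup g i)
  coordinates-inSlot g i = fromℚ-mono-≤ c c ℚ.≤-refl ,
    fromℚ-mono-≤ c (corner (suc (pos (lookup g i)))) (corner-mono (ℕ.n≤1+n (pos (lookup g i)))) ,
    λ j _ j≤ → corner-cancel {j} {pos (lookup g i)} (fromℚ-cancel-≤ (corner j) c j≤)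
    where c = corner (pos (lookup g i))

  P : PointSet d n
  P = record
    { point    = λ v → coordinates (lookup ps v)
    ; inCube   = λ v → coordinates∈cube (lookup ps v)
    ; distinct = λ u v eq → ps-distinct u v (lookup-ext (lookup ps u) (lookup ps v) (λ i →
        pos-injective (lookup (lookup ps u) i) (lookup (lookup ps v) i)
          (corner-injective (fromℚ-injective (corner (pos (lookup (lookup ps u) i))) (corner (pos (lookup (lookup ps v) i))) (eq i))))) }
    where
    corner-injective : ∀ {i j} → corner i ≡ corner j → i ≡ j
    corner-injective {i} {j} eq = ℕ.≤-antisym (corner-cancel {i} {j} (ℚ.≤-reflexive eq)) (corner-cancel {j} {i} (ℚ.≤-reflexive (sym eq)))
    lookup-ext : ∀ {A : Set} {m} (v w : Vec A m) → (∀ i → lookup v i ≡ lookup w i) → v ≡ w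
    lookup-ext []      []      eq = refl
    lookup-ext (x ∷ v) (y ∷ w) eq = cong₂ _∷_ (eq zero) (lookup-ext v w (λ i → eq (suc i)))

  -- This is `A(x) ∩ P` for every `x` in the slots of `g`: all points of `P` are lower corners of
  -- grid cells, so the intersection is constant on a half-open cell.
  shadow : GridCell → Subset n
  shadow g = Vec.tabulate (λ v → does (below? (lookup ps v) g))

  lookup-shadow : ∀ g v → lookup (shadow g) v ≡ does (below? (lookup ps v) g)
  lookup-shadow g v = Vec.lookup∘tabulate _ v

  ∈-shadow⁺ : ∀ {g v} → Below (lookup ps v) g → v Subset.∈ shadow g
  ∈-shadow⁺ {g} {v} below = Vec.lookup⇒[]= v (shadow g) (trans (lookup-shadow g v) (dec-true (below? (lookup ps v) g) below))

  ∈-shadow⁻ : ∀ {g v} → v Subset.∈ shadow g → Below (lookup ps v) g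
  ∈-shadow⁻ {g} {v} v∈ = decidable-stable (below? (lookup ps v) g) (λ ¬below →
    true≢false (trans (sym (Vec.[]=⇒lookup v∈)) (trans (lookup-shadow g v) (dec-false (below? (lookup ps v) g) ¬below))))
    where
    true≢false : true ≢ false
    true≢false ()

  module _ {x : Point d} {g : GridCell} (slots : ∀ i → InSlot (x i) (lookup g i)) where

    anchored⁺ : ∀ {v} → Below (lookup ps v) g → Anchored x (point P v)
    anchored⁺ {v} below i = proj₁ (inCube P v i) ,
      ≤ℝ-trans (point P v i) (coordinates g i) (x i) (fromℚ-mono-≤ (corner (pos (lookup (lookup ps v) i))) (corner (pos (lookup g i))) (corner-mono (below i))) (proj₁ (slots i))

    anchored⁻ : ∀ {v} → Anchored x (point P v) → Below (lookup ps v) g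
    anchored⁻ {v} anchored i = proj₂ (proj₂ (slots i)) (pos (lookup (lookup ps v) i)) (pos<4^ (lookup (lookup ps v) i)) (proj₂ (anchored i))

    cell-shadow : UnitCube x → Cell P (shadow g) x
    cell-shadow x∈ = x∈ , λ v → mk⇔ (λ v∈ → anchored⁺ {v} (∈-shadow⁻ {g} v∈)) (λ a → ∈-shadow⁺ {g} (anchored⁻ {v} a))

    cell⇒shadow : ∀ {F} → Cell P F x → shadow g ≡ F
    cell⇒shadow (_ , F⇔) = Subset.⊆-antisym
      (λ {v} v∈ → Equivalence.from (F⇔ v) (anchored⁺ {v} (∈-shadow⁻ {g} v∈)))
      (λ {v} v∈ → ∈-shadow⁺ {g} (anchored⁻ {v} (Equivalence.to (F⇔ v) v∈)))

    slots⇒inside : Inside x g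
    slots⇒inside i = proj₁ (slots i) , proj₁ (proj₂ (slots i))

  _≟ˢ_ : (F G : Subset n) → Dec (F ≡ G)
  _≟ˢ_ = Vec.≡-dec Bool._≟_

  system : SetSystem n
  system = record
    { members = deduplicate _≟ˢ_ (map shadow allCells) ; unique = deduplicate-! _≟ˢ_ (map shadow allCells) }

  ∈-allCells : ∀ g → g ∈ allCells
  ∈-allCells = ∈-tuples ∈-words

  shadow∈system : ∀ g → shadow g ∈ˢ system
  shadow∈system g = ∈-deduplicate⁺ _≟ˢ_ (∈-map⁺ shadow (∈-allCells g))

  isAnchoredSystem : IsAnchoredSystem P system
  isAnchoredSystem F = mk⇔
    (λ F∈ → let g , _ , F≡ = ∈-map⁻ shadow (∈-deduplicate⁻ _≟ˢ_ (map shadow allCells) F∈) in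
      coordinates g , subst (λ F → Cell P F (coordinates g)) (sym F≡)
        (cell-shadow {coordinates g} {g} (coordinates-inSlot g) (coordinates∈cube g)))
    -- Membership in a finite list of subsets is decidable, so the slots of `x` may be used under a
    -- double negation.
    (λ (x , cell) → decidable-stable (any? (F ≟ˢ_) (members system)) (λ F∉ →
      ¬¬-slots x (proj₁ cell) (λ (g , slots) →
        F∉ (subst (_∈ˢ system) (cell⇒shadow {x} {g} slots cell) (shadow∈system g)))))

  cells : Subset n → List GridCell
  cells F = filter (λ g → shadow g ≟ˢ F) allCells

  others : Subset n → List GridCell
  others F = filter (λ g → ¬? (shadow g ≟ˢ F)) allCells

  cellVolume : ℚ
  cellVolume = mesh ^ℚ d

  weightℚ : Subset n → ℚ
  weightℚ F = ι (length (cells F)) ℚ.* cellVolume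

  weight : Subset n → ℝ
  weight F = fromℚ (weightℚ F)

  length-filter-∷ : ∀ {A : Set} {Q : A → Set} (Q? : ∀ x → Dec (Q x)) x xs →
    length (filter Q? (x ∷ xs)) ≡ indicator (Q? x) ℕ.+ length (filter Q? xs)
  length-filter-∷ Q? x xs with does (Q? x)
  ... | true  = refl
  ... | false = refl

  length-filters : ∀ {A : Set} {Q : A → Set} (Q? : ∀ x → Dec (Q x)) xs →
    length (filter Q? xs) ℕ.+ length (filter (λ x → ¬? (Q? x)) xs) ≡ length xs
  length-filters Q? []       = refl
  length-filters Q? (x ∷ xs) with does (Q? x)
  ... | true  = cong suc (length-filters Q? xs)
  ... | false = trans (ℕ.+-suc (length (filter Q? xs)) _) (cong suc (length-filters Q? xs))

  total-volume : ι (length allCells) ℚ.* cellVolume ≡ 1ℚ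
  total-volume = begin
      ι (length allCells) ℚ.* mesh ^ℚ d
        ≡⟨ cong (λ l → ι l ℚ.* mesh ^ℚ d) (trans (length-tuples (words L) d) (cong (ℕ._^ d) (length-words L))) ⟩
      ι ((4 ℕ.^ L) ℕ.^ d) ℚ.* mesh ^ℚ d
        ≡⟨ cong (ℚ._* mesh ^ℚ d) (sym (ι-^ (4 ℕ.^ L) d)) ⟩
      width L ^ℚ d ℚ.* mesh ^ℚ d
        ≡⟨ sym (^ℚ-distrib-* (width L) mesh d) ⟩
      (width L ℚ.* mesh) ^ℚ d
        ≡⟨ trans (cong (_^ℚ d) width*mesh) (1^ℚ d) ⟩
      1ℚ ∎
    where open ≡-Reasoning

  ¬¬-inside : ∀ {Q : GridCell → Set} (Q? : ∀ g → Dec (Q g)) (x : Point d) → UnitCube x →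
    (∀ {g} → (∀ i → InSlot (x i) (lookup g i)) → Q g) → ¬ ¬ Any (Inside x) (filter Q? allCells)
  ¬¬-inside Q? x x∈ slots⇒Q ¬any = ¬¬-slots x x∈ (λ (g , slots) →
    ¬any (lose (∈-filter⁺ Q? (∈-allCells g) (slots⇒Q slots)) (slots⇒inside {x} {g} slots)))

  -- The grid cells with shadow `F` cover the set, the other grid cells cover its complement in the
  -- cube, and the two volumes add up to 1.
  isCellMeasure : IsCellMeasure P system weight
  isCellMeasure F _ =
    outerMeasure-cells (cells F) (weight F)
      (λ x cell → ¬¬-inside (λ g → shadow g ≟ˢ F) x (proj₁ cell) (λ {g} slots → cell⇒shadow {x} {g} slots cell))
      (λ _ → ℚ.≤-refl) ,
    outerMeasure-cells (others F) (1ℝ - weight F)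
      (λ x (x∈ , ¬cell) → ¬¬-inside (λ g → ¬? (shadow g ≟ˢ F)) x x∈ (λ {g} slots shadow≡ →
        ¬cell (subst (λ F → Cell P F x) shadow≡ (cell-shadow {x} {g} slots x∈))))
      (λ _ → ℚ.≤-reflexive (trans (lemma (ι (length (cells F))) (ι (length (others F))) cellVolume)
        (cong (ℚ._- weightℚ F) (trans (cong (ℚ._* cellVolume) (trans (sym (ι-+ (length (cells F)) (length (others F)))) (cong ι (length-filters (λ g → shadow g ≟ˢ F) allCells)))) total-volume))))
    where
    lemma : ∀ a b v → b ℚ.* v ≡ (a ℚ.+ b) ℚ.* v ℚ.- a ℚ.* v
    lemma = solve-∀ ℚ-ring

  -- Grouping the grid cells by their shadows turns the weighted mean over the set system into the
  -- plain mean over the grid, for which the energy is estimated.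
  sum-system : ∀ (h : Subset n → ℚ) →
    ∑ (members system) (λ F → weightℚ F ℚ.* h F) ≡ cellVolume ℚ.* ∑ allCells (λ g → h (shadow g))
  sum-system h = begin
      ∑ (members system) (λ F → weightℚ F ℚ.* h F)
        ≡⟨ ∑-cong (members system) (λ F → trans (cong (λ l → l ℚ.* cellVolume ℚ.* h F) (length-cells F)) (regroup F)) ⟩
      ∑ (members system) (λ F → cellVolume ℚ.* ∑ allCells (λ g → δˢ (shadow g) F ℚ.* h F))
        ≡⟨ trans (∑-*ˡ (members system) cellVolume _) (cong (cellVolume ℚ.*_) (∑-swap (members system) allCells _)) ⟩
      cellVolume ℚ.* ∑ allCells (λ g → ∑ (members system) (λ F → δˢ (shadow g) F ℚ.* h F))
        ≡⟨ cong (cellVolume ℚ.*_) (∑-cong allCells (λ g → trans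
             (∑-delta (unique system) (shadow∈system g) (λ F → δˢ (shadow g) F ℚ.* h F) (λ F F≢ →
               trans (cong (λ b → ι (if b then 1 else 0) ℚ.* h F) (dec-false (shadow g ≟ˢ F) (λ eq → F≢ (sym eq)))) (ℚ.*-zeroˡ (h F))))
             (trans (cong (λ b → ι (if b then 1 else 0) ℚ.* h (shadow g)) (dec-true (shadow g ≟ˢ shadow g) refl)) (ℚ.*-identityˡ (h (shadow g)))))) ⟩
      cellVolume ℚ.* ∑ allCells (λ g → h (shadow g)) ∎
    where
    open ≡-Reasoning
    δˢ : Subset n → Subset n → ℚ
    δˢ F G = ι (indicator (F ≟ˢ G))
    length-cells : ∀ F → ι (length (cells F)) ≡ ∑ allCells (λ g → δˢ (shadow g) F)
    length-cells F = go allCells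
      where
      go : ∀ gs → ι (length (filter (λ g → shadow g ≟ˢ F) gs)) ≡ ∑ gs (λ g → δˢ (shadow g) F)
      go []       = refl
      go (g ∷ gs) = trans (cong ι (length-filter-∷ (λ g → shadow g ≟ˢ F) g gs))
        (trans (ι-+ (indicator (shadow g ≟ˢ F)) (length (filter (λ g → shadow g ≟ˢ F) gs))) (cong (δˢ (shadow g) F ℚ.+_) (go gs)))
    swap : ∀ s v h → s ℚ.* v ℚ.* h ≡ v ℚ.* (s ℚ.* h)
    swap = solve-∀ ℚ-ring
    regroup : ∀ F → ∑ allCells (λ g → δˢ (shadow g) F) ℚ.* cellVolume ℚ.* h F ≡
      cellVolume ℚ.* ∑ allCells (λ g → δˢ (shadow g) F ℚ.* h F)
    regroup F = trans (swap (∑ allCells (λ g → δˢ (shadow g) F)) cellVolume (h F))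
      (cong (cellVolume ℚ.*_) (sym (∑-*ʳ allCells (h F) (λ g → δˢ (shadow g) F))))

  seq-sumOver : ∀ (f : Subset n → ℝ) j → seq (sumOver system f) j ≡ ∑ (members system) (λ F → seq (f F) j)
  seq-sumOver f j = go (members system)
    where
    go : ∀ Fs → seq (List.foldr _+_ 0ℝ (List.map f Fs)) j ≡ ∑ Fs (λ F → seq (f F) j)
    go []       = refl
    go (F ∷ Fs) = cong (seq (f F) j ℚ.+_) (go Fs)

  total-weight : ∀ j → seq (sumOver system weight) j ≡ 1ℚ
  total-weight j = trans (seq-sumOver weight j) (trans
    (∑-cong (members system) (λ F → sym (ℚ.*-identityʳ (weightℚ F))))
    (trans (sum-system (λ _ → 1ℚ)) (trans (cong (cellVolume ℚ.*_)
      (trans (∑-const allCells 1ℚ) (ℚ.*-identityʳ (ι (length allCells)))))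
      (trans (ℚ.*-comm cellVolume (ι (length allCells))) total-volume))))

  energy : Coloring n → ℚ
  energy χ = ∑ allCells (λ g → ι (ℤ.∣ colorSum χ (shadow g) ∣ ℕ.^ 2))

  seq-energy : ∀ χ j → seq (sumOver system (λ F → weight F * fromℕ (ℤ.∣ colorSum χ F ∣ ℕ.^ 2))) j ≡ cellVolume ℚ.* energy χ
  seq-energy χ j = trans (seq-sumOver (λ F → weight F * fromℕ (ℤ.∣ colorSum χ F ∣ ℕ.^ 2)) j)
    (sum-system (λ F → ι (ℤ.∣ colorSum χ F ∣ ℕ.^ 2)))

  0≤cellVolume : 0ℚ ℚ.≤ cellVolume
  0≤cellVolume = 0≤^ℚ (ℚ.<⇒≤ 0<mesh) d

  colorSum-cong : ∀ {χ χ' : Coloring n} → (∀ v → χ v ≡ χ' v) → ∀ F → colorSum χ F ≡ colorSum χ' F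
  colorSum-cong {χ} {χ'} eq F = go n (λ v → cong (λ s → if lookup F v then s ℤ.◃ 1 else ℤ.0ℤ) (eq v))
    where
    go : ∀ m {f g : Fin m → ℤ} → (∀ v → f v ≡ g v) → Vector.foldr ℤ._+_ ℤ.0ℤ f ≡ Vector.foldr ℤ._+_ ℤ.0ℤ g
    go zero    eq = refl
    go (suc m) eq = cong₂ ℤ._+_ (eq zero) (go m (λ v → eq (suc v)))

  -- Colorings are functions, which can be compared only pointwise; therefore `f` is required to
  -- respect pointwise equality. As its values are rational, the minimum is found by comparisons.
  argmin : ∀ m (f : (Fin m → Sign) → ℚ) → (∀ χ χ' → (∀ v → χ v ≡ χ' v) → f χ ≡ f χ') → ∃ λ χ → ∀ χ' → f χ ℚ.≤ f χ'
  argmin zero    f f-cong = (λ ()) , λ χ' → ℚ.≤-reflexive (f-cong _ χ' (λ ()))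
  argmin (suc m) f f-cong = choose (ℚ.≤-total (f (cons Sign.+ χ⁺)) (f (cons Sign.- χ⁻)))
    where
    cons : Sign → (Fin m → Sign) → Fin (suc m) → Sign
    cons = Vector._∷_
    cons-cong : ∀ σ χ χ' → (∀ v → χ v ≡ χ' v) → ∀ v → cons σ χ v ≡ cons σ χ' v
    cons-cong σ χ χ' eq zero    = refl
    cons-cong σ χ χ' eq (suc v) = eq v
    best : ∀ σ → ∃ λ χ → ∀ χ' → f (cons σ χ) ℚ.≤ f (cons σ χ')
    best σ = argmin m (λ χ → f (cons σ χ)) (λ χ χ' eq → f-cong (cons σ χ) (cons σ χ') (cons-cong σ χ χ' eq))
    χ⁺ = proj₁ (best Sign.+)
    χ⁻ = proj₁ (best Sign.-)
    η : ∀ χ v → cons (χ zero) (λ v → χ (suc v)) v ≡ χ v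
    η χ zero    = refl
    η χ (suc v) = refl
    lower-bound : ∀ b → b ℚ.≤ f (cons Sign.+ χ⁺) → b ℚ.≤ f (cons Sign.- χ⁻) → ∀ χ → b ℚ.≤ f χ
    lower-bound b b≤⁺ b≤⁻ χ = ℚ.≤-trans (go (χ zero)) (ℚ.≤-reflexive (f-cong (cons (χ zero) (λ v → χ (suc v))) χ (η χ)))
      where
      go : ∀ σ → b ℚ.≤ f (cons σ (λ v → χ (suc v)))
      go Sign.+ = ℚ.≤-trans b≤⁺ (proj₂ (best Sign.+) (λ v → χ (suc v)))
      go Sign.- = ℚ.≤-trans b≤⁻ (proj₂ (best Sign.-) (λ v → χ (suc v)))
    choose : f (cons Sign.+ χ⁺) ℚ.≤ f (cons Sign.- χ⁻) ⊎ f (cons Sign.- χ⁻) ℚ.≤ f (cons Sign.+ χ⁺) → ∃ λ χ → ∀ χ' → f χ ℚ.≤ f χ'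
    choose (inj₁ le) = cons Sign.+ χ⁺ , lower-bound _ ℚ.≤-refl le
    choose (inj₂ le) = cons Sign.- χ⁻ , lower-bound _ le ℚ.≤-refl

  optimal : ∃ λ χ → ∀ χ' → energy χ ℚ.≤ energy χ'
  optimal = argmin n energy (λ χ χ' eq → ∑-cong allCells (λ g → cong (λ c → ι (ℤ.∣ c ∣ ℕ.^ 2)) (colorSum-cong {χ} {χ'} eq (shadow g))))

  disc² : ℚ
  disc² = cellVolume ℚ.* energy (proj₁ optimal)

  0≤disc² : 0ℚ ℚ.≤ disc²
  0≤disc² = 0≤* 0≤cellVolume (0≤∑ allCells (λ g → 0≤ι (ℤ.∣ colorSum (proj₁ optimal) (shadow g) ∣ ℕ.^ 2)))

  open SquareRoot disc² 0≤disc²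

  isAnchoredDisc : IsAnchoredDisc 2 P sqrt
  isAnchoredDisc = system , isAnchoredSystem , weight , isCellMeasure ,
    (λ F _ → fromℚ-mono-≤ 0ℚ (weightℚ F) (0≤* (0≤ι (length (cells F))) 0≤cellVolume)) ,
    (1ℚ , 0<1 , 0 , λ j _ → ℚ.≤-reflexive (trans (ℚ.+-identityˡ 1ℚ) (sym (total-weight j)))) ,
    (proj₁ optimal , 1ℝ , inverse-one , sqrt-isRoot (1ℝ * S (proj₁ optimal))
      (λ j → trans (ℚ.*-identityˡ (seq (S (proj₁ optimal)) j)) (seq-energy (proj₁ optimal) j))) ,
    λ χ v (u , u-inverse , v-root) → sqrt≤ u v (sumOver system weight) (S χ)
      (*-monoˡ cellVolume 0≤cellVolume (proj₂ optimal χ)) total-weight (seq-energy χ) u-inverse v-root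
    where
    S : Coloring n → ℝ
    S χ = sumOver system (λ F → weight F * fromℕ (ℤ.∣ colorSum χ F ∣ ℕ.^ 2))
    inverse-one : IsInverse (sumOver system weight) 1ℝ
    inverse-one ε 0<ε = 0 , λ j _ → subst (λ t → ℚ.∣ 1ℚ ℚ.* t ℚ.- 1ℚ ∣ ℚ.< ε) (sym (total-weight j)) 0<ε

-- Color sums as integrals of signed measures.

module ColorSums where

  abs² : ∀ i → ι (ℤ.∣ i ∣ ℕ.^ 2) ≡ i ℚ./ 1 ℚ.* (i ℚ./ 1)
  abs² i = trans (cong (ℚ._/ 1) (square i)) (/1-* i i)
    where
    square : ∀ i → ℤ.+ (ℤ.∣ i ∣ ℕ.^ 2) ≡ i ℤ.* i
    square (ℤ.+ n)      = trans (cong (λ m → ℤ.+ (n ℕ.* m)) (ℕ.*-identityʳ n)) (ℤ.pos-* n n)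
    square (ℤ.-[1+ n ]) = cong (λ m → ℤ.+ (suc n ℕ.* m)) (ℕ.*-identityʳ (suc n))

  sumℤ : ∀ {n} → (Fin n → ℤ) → ℤ
  sumℤ = Vector.foldr ℤ._+_ ℤ.0ℤ

  colored : ∀ {n} → Coloring n → (Fin n → Bool) → Fin n → ℤ
  colored χ b v = if b v then χ v ℤ.◃ 1 else ℤ.0ℤ

  sumℤ-signed : ∀ {A : Set} {n} (ps : Vec A n) (χ : Coloring n) (b : Fin n → Bool) (f : A → ℚ) →
    (∀ v → f (lookup ps v) ≡ (if b v then 1ℚ else 0ℚ)) → sumℤ (colored χ b) ℚ./ 1 ≡ ∫ (signed ps (Vec.tabulate χ)) f
  sumℤ-signed []       χ b f eq = refl
  sumℤ-signed (p ∷ ps) χ b f eq = trans (/1-+ (colored χ b zero) (sumℤ (λ v → colored χ b (suc v))))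
    (cong₂ ℚ._+_ (trans (term (χ zero) (b zero)) (cong (sign (χ zero) ℚ.*_) (sym (eq zero))))
      (sumℤ-signed ps (λ v → χ (suc v)) (λ v → b (suc v)) f (λ v → eq (suc v))))
    where
    term : ∀ σ b → (if b then σ ℤ.◃ 1 else ℤ.0ℤ) ℚ./ 1 ≡ sign σ ℚ.* (if b then 1ℚ else 0ℚ)
    term Sign.+ true  = refl
    term Sign.+ false = refl
    term Sign.- true  = refl
    term Sign.- false = refl

  ∣sumℤ∣≤ : ∀ {n} (χ : Coloring n) b → ℤ.∣ sumℤ (colored χ b) ∣ ℕ.≤ n
  ∣sumℤ∣≤ {zero}  χ b = ℕ.z≤n
  ∣sumℤ∣≤ {suc n} χ b = ℕ.≤-trans (ℤ.∣i+j∣≤∣i∣+∣j∣ (colored χ b zero) (sumℤ (λ v → colored χ b (suc v))))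
    (ℕ.+-mono-≤ (term (χ zero) (b zero)) (∣sumℤ∣≤ (λ v → χ (suc v)) (λ v → b (suc v))))
    where
    term : ∀ σ b → ℤ.∣ if b then σ ℤ.◃ 1 else ℤ.0ℤ ∣ ℕ.≤ 1
    term Sign.+ true  = ℕ.≤-refl
    term Sign.- true  = ℕ.≤-refl
    term σ      false = ℕ.z≤n

open ColorSums

-- Numerical estimates for the constants.

module Estimates where

  square-^ : ∀ a n → a ℕ.^ n ℕ.* a ℕ.^ n ≡ (a ℕ.* a) ℕ.^ n
  square-^ a zero    = refl
  square-^ a (suc n) = trans (regroup a (a ℕ.^ n)) (cong (a ℕ.* a ℕ.*_) (square-^ a n))
    where
    regroup : ∀ a p → a ℕ.* p ℕ.* (a ℕ.* p) ≡ a ℕ.* a ℕ.* (p ℕ.* p)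
    regroup = ℕ-solve-∀

  product-^ : ∀ a b n → (a ℕ.* b) ℕ.^ n ≡ a ℕ.^ n ℕ.* b ℕ.^ n
  product-^ a b zero    = refl
  product-^ a b (suc n) = trans (cong (a ℕ.* b ℕ.*_) (product-^ a b n)) (regroup a b (a ℕ.^ n) (b ℕ.^ n))
    where
    regroup : ∀ a b c d → a ℕ.* b ℕ.* (c ℕ.* d) ≡ a ℕ.* c ℕ.* (b ℕ.* d)
    regroup = ℕ-solve-∀

  n≤2^n : ∀ n → n ℕ.≤ 2 ℕ.^ n
  n≤2^n zero    = ℕ.z≤n
  n≤2^n (suc n) = ℕ.≤-trans (ℕ.+-mono-≤ (ℕ.m^n>0 2 n) (n≤2^n n)) (ℕ.≤-reflexive (cong (2 ℕ.^ n ℕ.+_) (sym (ℕ.+-identityʳ (2 ℕ.^ n)))))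

  -- 9 * 18 ^ d exceeds the square root of the constant 80 * 320 ^ d in energy≥.
  scale : ℕ → ℕ
  scale d = 9 ℕ.* 18 ℕ.^ d

  scale² : ∀ d → 80 ℕ.* 320 ℕ.^ d ℕ.≤ scale d ℕ.* scale d
  scale² d = begin
      80 ℕ.* 320 ℕ.^ d                ≤⟨ ℕ.*-mono-≤ (ℕ.n≤1+n 80) (ℕ.^-monoˡ-≤ d (ℕ.m≤m+n 320 4)) ⟩
      81 ℕ.* 324 ℕ.^ d                ≡⟨ cong (81 ℕ.*_) (sym (square-^ 18 d)) ⟩
      81 ℕ.* (18 ℕ.^ d ℕ.* 18 ℕ.^ d)  ≡⟨ regroup (18 ℕ.^ d) ⟩
      scale d ℕ.* scale d             ∎
    where
    open ℕ.≤-Reasoning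
    regroup : ∀ p → 81 ℕ.* (p ℕ.* p) ≡ 9 ℕ.* p ℕ.* (9 ℕ.* p)
    regroup = ℕ-solve-∀

  0<scale : ∀ d → 0 ℕ.< scale d
  0<scale d = ℕ.*-mono-≤ {1} {9} (ℕ.s≤s ℕ.z≤n) (ℕ.m^n>0 18 d)

  square-cancel-≤ : ∀ {m n} → m ℕ.* m ℕ.≤ n ℕ.* n → m ℕ.≤ n
  square-cancel-≤ {m} {n} mm≤nn with m ℕ.≤? n
  ... | yes m≤n = m≤n
  ... | no  m≰n = contradiction mm≤nn (ℕ.<⇒≱ (ℕ.*-mono-< (ℕ.≰⇒> m≰n) (ℕ.≰⇒> m≰n)))

  -- With `m = e * k`, both 2 and `k ^ e` are at most `2 ^ m`. So the logarithm of the number of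
  -- points is at most linear in `k`, whereas the discrepancy is at least of order `k ^ e`.
  size-bound : ∀ e k → 1 ℕ.≤ e ℕ.* k → 2 ℕ.* (k ℕ.^ e ℕ.* 4 ℕ.^ (e ℕ.* k)) ℕ.≤ 2 ℕ.^ (4 ℕ.* (e ℕ.* k))
  size-bound e k 1≤ek = begin
      2 ℕ.* (k ℕ.^ e ℕ.* 4 ℕ.^ m)                       ≤⟨ ℕ.*-mono-≤ (ℕ.^-monoʳ-≤ 2 1≤ek) (ℕ.*-mono-≤ (ℕ.^-monoˡ-≤ e (n≤2^n k)) (ℕ.≤-refl {4 ℕ.^ m})) ⟩
      2 ℕ.^ m ℕ.* ((2 ℕ.^ k) ℕ.^ e ℕ.* 4 ℕ.^ m)         ≡⟨ cong₂ (λ a b → 2 ℕ.^ m ℕ.* (a ℕ.* b))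
                                                             (trans (ℕ.^-*-assoc 2 k e) (cong (2 ℕ.^_) (ℕ.*-comm k e))) (sym (square-^ 2 m)) ⟩
      2 ℕ.^ m ℕ.* (2 ℕ.^ m ℕ.* (2 ℕ.^ m ℕ.* 2 ℕ.^ m))   ≡⟨ regroup (2 ℕ.^ m) ⟩
      (2 ℕ.^ m) ℕ.^ 4                                   ≡⟨ trans (ℕ.^-*-assoc 2 m 4) (cong (2 ℕ.^_) (ℕ.*-comm m 4)) ⟩
      2 ℕ.^ (4 ℕ.* m)                                   ∎
    where
    open ℕ.≤-Reasoning
    m = e ℕ.* k
    regroup : ∀ p → p ℕ.* (p ℕ.* (p ℕ.* p)) ≡ p ℕ.* (p ℕ.* (p ℕ.* (p ℕ.* 1)))
    regroup = ℕ-solve-∀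

open Estimates

-- The constant, the number of points and the final bound.

module _ (e : ℕ) (0<e : 0 ℕ.< e) where

  private
    d = suc e
    -- The logarithm is at most `4 * e * k`, the discrepancy at least `k ^ e / scale d`; their
    -- comparison needs the factor `scale d` and the `e`-th power of `4 * e`.
    constant : ℕ
    constant = scale d ℕ.* (4 ℕ.* e) ℕ.^ e

    0<constant : 0 ℕ.< constant
    0<constant = ℕ.*-mono-≤ (0<scale d) (ℕ.m^n>0 (4 ℕ.* e) {{ℕ.>-nonZero (ℕ.*-mono-≤ {1} {4} (ℕ.s≤s ℕ.z≤n) 0<e)}} e)

  c₀ : ℚ
  c₀ = proj₁ (inverse (ι constant) (ι-mono-< 0<constant))

  0<c₀ : 0ℚ ℚ.< c₀
  0<c₀ = proj₁ (proj₂ (inverse (ι constant) (ι-mono-< 0<constant)))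

  module _ (N : ℕ) where

    private
      -- The factor `scale d` cancels against the one in `k^e≤`, so that the number of points
      -- exceeds `N`.
      k = scale d ℕ.* suc N

      0<k : 0 ℕ.< k
      0<k = ℕ.*-mono-≤ (0<scale d) (ℕ.s≤s (ℕ.z≤n {N}))

    open Construction e k 0<k
    open AnchoredSystem depth e points injective

    private
      κ = ι (k ℕ.^ e)

      energy≡ : ∀ χ → let D = discrepancy (signed points (Vec.tabulate χ)) in
        energy χ ≡ ∑ grid (λ x → D x ℚ.* D x)
      energy≡ χ = ∑-cong grid (λ x → trans (abs² (colorSum χ (shadow x))) (cong (λ t → t ℚ.* t)
        (sumℤ-signed points χ (lookup (shadow x)) (λ p → product-matrix le p x) (λ v →
          trans (product-matrix-le (lookup points v) x) (cong (if_then 1ℚ else 0ℚ) (sym (lookup-shadow x v)))))))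

      energy≤ : ∀ χ → energy χ ℚ.≤ V ℚ.* ι (count ℕ.* count)
      energy≤ χ = ℚ.≤-trans (∑-mono grid (λ x → ι-mono-≤ (square (∣sumℤ∣≤ χ (lookup (shadow x))))))
        (ℚ.≤-reflexive (∑-const grid (ι (count ℕ.* count))))
        where
        square : ∀ {a b} → a ℕ.≤ b → a ℕ.^ 2 ℕ.≤ b ℕ.* b
        square {a} a≤b = ℕ.≤-trans (ℕ.≤-reflexive (cong (a ℕ.*_) (ℕ.*-identityʳ a))) (ℕ.*-mono-≤ a≤b a≤b)

      K = 80 ℕ.* 320 ℕ.^ suc e

      κ²V≤ : ∀ χ → κ ℚ.* κ ℚ.* V ℚ.≤ ι K ℚ.* energy χ
      κ²V≤ χ = ℚ.≤-trans (energy≥ (Vec.tabulate χ)) (ℚ.≤-reflexive (cong (ι K ℚ.*_) (sym (energy≡ χ))))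

      -- The selection bounds the number of points only from above. A lower bound comes from the
      -- energy: no color sum exceeds the number of points in absolute value, so a large energy
      -- requires many points.
      k^e≤ : k ℕ.^ e ℕ.≤ scale d ℕ.* count
      k^e≤ = square-cancel-≤ (ι-cancel-≤ (ℚ.*-cancelʳ-≤-pos V {{ℚ.positive 0<V}} (begin
          ι (k ℕ.^ e ℕ.* k ℕ.^ e) ℚ.* V
            ≡⟨ cong (ℚ._* V) (ι-* (k ℕ.^ e) (k ℕ.^ e)) ⟩
          κ ℚ.* κ ℚ.* V
            ≤⟨ κ²V≤ χ ⟩
          ι K ℚ.* energy χ
            ≤⟨ *-monoˡ (ι K) (0≤ι K) (energy≤ χ) ⟩
          ι K ℚ.* (V ℚ.* ι (count ℕ.* count))
            ≡⟨ trans (regroup (ι K) V (ι (count ℕ.* count))) (cong (ℚ._* V) (sym (ι-* K (count ℕ.* count)))) ⟩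
          ι (K ℕ.* (count ℕ.* count)) ℚ.* V
            ≤⟨ *-monoʳ V (ℚ.<⇒≤ 0<V) (ι-mono-≤ (ℕ.≤-trans (ℕ.*-monoˡ-≤ (count ℕ.* count) (scale² d))
                 (ℕ.≤-reflexive (regroup' (scale d) count)))) ⟩
          ι (scale d ℕ.* count ℕ.* (scale d ℕ.* count)) ℚ.* V ∎)))
        where
        open ℚ.≤-Reasoning
        χ = proj₁ optimal
        regroup : ∀ a v b → a ℚ.* (v ℚ.* b) ≡ a ℚ.* b ℚ.* v
        regroup = solve-∀ ℚ-ring
        regroup' : ∀ a b → a ℕ.* a ℕ.* (b ℕ.* b) ≡ a ℕ.* b ℕ.* (a ℕ.* b)
        regroup' = ℕ-solve-∀

    N≤count : N ℕ.≤ count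
    N≤count = ℕ.<⇒≤ (ℕ.*-cancelˡ-≤ (scale d) {{ℕ.>-nonZero (0<scale d)}} (ℕ.≤-trans (k≤k^ e 0<e) k^e≤))
      where
      k≤k^ : ∀ e → 0 ℕ.< e → k ℕ.≤ k ℕ.^ e
      k≤k^ (suc e) _ = ℕ.m≤m*n k (k ℕ.^ e) {{ℕ.m^n≢0 k e {{ℕ.>-nonZero 0<k}}}}

    private
      ℓ = 4 ℕ.* (e ℕ.* k)

      r : ℚ
      r = c₀ ℚ.* ι ℓ ^ℚ e

      rC≡κ : r ℚ.* ι (scale d) ≡ κ
      rC≡κ = begin
          c₀ ℚ.* ι ℓ ^ℚ e ℚ.* ι (scale d)
            ≡⟨ cong (λ t → c₀ ℚ.* t ℚ.* ι (scale d)) (trans (ι-^ ℓ e) (cong ι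
                 (trans (cong (ℕ._^ e) (sym (ℕ.*-assoc 4 e k))) (product-^ (4 ℕ.* e) k e)))) ⟩
          c₀ ℚ.* ι ((4 ℕ.* e) ℕ.^ e ℕ.* k ℕ.^ e) ℚ.* ι (scale d)
            ≡⟨ cong (λ t → c₀ ℚ.* t ℚ.* ι (scale d)) (ι-* ((4 ℕ.* e) ℕ.^ e) (k ℕ.^ e)) ⟩
          c₀ ℚ.* (ι ((4 ℕ.* e) ℕ.^ e) ℚ.* κ) ℚ.* ι (scale d)
            ≡⟨ regroup c₀ (ι ((4 ℕ.* e) ℕ.^ e)) κ (ι (scale d)) ⟩
          ι (scale d) ℚ.* ι ((4 ℕ.* e) ℕ.^ e) ℚ.* c₀ ℚ.* κ
            ≡⟨ cong (λ t → t ℚ.* c₀ ℚ.* κ) (sym (ι-* (scale d) ((4 ℕ.* e) ℕ.^ e))) ⟩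
          ι constant ℚ.* c₀ ℚ.* κ
            ≡⟨ trans (cong (ℚ._* κ) (proj₂ (proj₂ (inverse (ι constant) (ι-mono-< 0<constant))))) (ℚ.*-identityˡ κ) ⟩
          κ ∎
        where
        open ≡-Reasoning
        regroup : ∀ c a k s → c ℚ.* (a ℚ.* k) ℚ.* s ≡ s ℚ.* a ℚ.* c ℚ.* k
        regroup = solve-∀ ℚ-ring

      r²≤disc² : r ℚ.* r ℚ.≤ disc²
      r²≤disc² = ℚ.*-cancelʳ-≤-pos (C ℚ.* C) {{ℚ.positive (0<* 0<C 0<C)}} (begin
          r ℚ.* r ℚ.* (C ℚ.* C)
            ≡⟨ trans (regroup r C) (cong (λ t → t ℚ.* t) rC≡κ) ⟩
          κ ℚ.* κ
            ≡⟨ trans (sym (ℚ.*-identityʳ (κ ℚ.* κ))) (cong (κ ℚ.* κ ℚ.*_) (sym total-volume)) ⟩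
          κ ℚ.* κ ℚ.* (V ℚ.* cellVolume)
            ≡⟨ sym (ℚ.*-assoc (κ ℚ.* κ) V cellVolume) ⟩
          κ ℚ.* κ ℚ.* V ℚ.* cellVolume
            ≤⟨ *-monoʳ cellVolume 0≤cellVolume (κ²V≤ (proj₁ optimal)) ⟩
          ι K ℚ.* energy (proj₁ optimal) ℚ.* cellVolume
            ≡⟨ regroup' (ι K) (energy (proj₁ optimal)) cellVolume ⟩
          disc² ℚ.* ι K
            ≤⟨ *-monoˡ disc² 0≤disc² (ℚ.≤-trans (ι-mono-≤ (scale² d)) (ℚ.≤-reflexive (ι-* (scale d) (scale d)))) ⟩
          disc² ℚ.* (C ℚ.* C) ∎)
        where
        open ℚ.≤-Reasoning
        C = ι (scale d)
        0<C : 0ℚ ℚ.< C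
        0<C = ι-mono-< (0<scale d)
        regroup : ∀ r c → r ℚ.* r ℚ.* (c ℚ.* c) ≡ r ℚ.* c ℚ.* (r ℚ.* c)
        regroup = solve-∀ ℚ-ring
        regroup' : ∀ k e v → k ℚ.* e ℚ.* v ≡ v ℚ.* e ℚ.* k
        regroup' = solve-∀ ℚ-ring

      count≤ : count ℕ.≤ 2 ℕ.^ ℓ
      count≤ = ℕ.≤-trans size≤ (size-bound e k (ℕ.*-mono-≤ 0<e 0<k))

    log-bound : fromℚ c₀ * log count ^ e ≤ SquareRoot.sqrt disc² 0≤disc²
    log-bound = SquareRoot.sqrt≥ disc² 0≤disc² (fromℚ c₀ * log count ^ e) {r}
      (λ j → *-monoˡ c₀ (ℚ.<⇒≤ 0<c₀)
        (seq-^-bound (log count) j (0≤ι ℓ) (0≤logSum count j) (logSum≤ ℓ count≤ j) e))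
      r²≤disc²

    large-discrepancy : Σ ℕ λ n → N ≤ℕ n ×
      Σ (PointSet d n) λ P → Σ ℝ λ D →
        IsAnchoredDisc 2 P D × fromℚ c₀ * log n ^ e ≤ D
    large-discrepancy = count , N≤count , P , SquareRoot.sqrt disc² 0≤disc² , isAnchoredDisc , log-bound

theorem7p1 : ∀ (d : ℕ) → 2 ≤ℕ d →
    Σ ℝ λ c → 0ℝ < c ×
    (∀ (N : ℕ) → Σ ℕ λ n → N ≤ℕ n ×
    Σ (PointSet d n) λ P → Σ ℝ λ D →
    IsAnchoredDisc 2 P D × c * log n ^ (d ∸ 1) ≤ D)
theorem7p1 (suc zero) (ℕ.s≤s ())
theorem7p1 (suc (suc e)) _ = fromℚ (c₀ (suc e) ℕ.z<s) ,
  (c₀ (suc e) ℕ.z<s , 0<c₀ (suc e) ℕ.z<s , 0 , λ _ _ → ℚ.≤-reflexive (ℚ.+-identityˡ (c₀ (suc e) ℕ.z<s))) ,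
  large-discrepancy (suc e) ℕ.z<s
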